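{- For every $n\ge2$, the set $\mathcal A^s_n$ of signed arc permutations, endowed with the map $w\mapsto\mathrm{sDes}(w)$, is a fine set for the $B_n$-character induced from the $B_{n-1}$-representation on the exterior algebra $\bigwedge V_{n-1}$. Equivalently, $$\sum_{w\in\mathcal A^s_n}F_{\mathrm{sDes}(w)}(x,y)=\mathrm{ch}\Big(\sum_{k=0}^{n-1}\chi^{(k),(1^{n-k-1})}\big\uparrow^{B_n}_{B_{n-1}}\Big).$$
   Context: $B_n$: signed permutations $w=(w(1),\dots,w(n))$; $|a|$ denotes the absolute value (bar removed). $w\in B_n$ is a signed arc permutation if for each $i\in\{2,\dots,n-1\}$: the set $\{|w(1)|,\dots,|w(i-1)|\}$ is an interval in $\mathbb Z_n$ (cyclically consecutive residues, $n$ identified with $0$), and $w(i)$ is unbarred if $|w(i)|-1\in\{|w(1)|,\dots,|w(i-1)|\}$ and barred if $|w(i)|+1\in\{|w(1)|,\dots,|w(i-1)|\}$ (arithmetic in $\mathbb Z_n$). $V_{n-1}$ is an $(n-1)$-dimensional complex vector space on which $B_{n-1}$ acts by permuting coordinates and switching their signs; $B_{n-1}\le B_n$ is the subgroup fixing $n$; $\uparrow^{B_n}_{B_{n-1}}$ is induction. $\chi^{\lambda,\mu}$ is the irreducible $B_{n-1}$-character with Frobenius characteristic $s_\lambda(x)s_\mu(y)$; $\mathrm{ch}(\chi)=\frac{1}{2^nn!}\sum_w\chi(w)p^+_\alpha p^-_\beta$ with $(\alpha,\beta)$ the signed cycle type of $w$ (lengths of positive cycles — pairs of disjoint cycles $c,\bar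 c$ on $\{1,\dots,n,\bar1,\dots,\bar n\}$ — and negative cycles $c=\bar c$, counted with half length), $p^\pm_j=\sum_i(x_i^j\pm y_i^j)$. $\mathrm{sDes}(w)=(S,\varepsilon)$: with $\bar1<_r\cdots<_r\bar n<_r1<_r\cdots<_rn$, $S$ consists of $n$ and all $s\in[n-1]$ with $w(s)>_rw(s+1)$ or with $w(s)$ barred and $w(s+1)$ unbarred; $\varepsilon(s)=-$ iff $w(s)$ barred. For $\sigma=(S,\varepsilon)$ with $S=\{s_1<\dots<s_m=n\}$, $s_0=0$: sign vector $\tilde\varepsilon(j)=\varepsilon(s_i)$ for $s_{i-1}<j\le s_i$; ${\rm wDes}(\sigma)$ the set of $s_i$, $i<m$, with $\varepsilon(s_i)=\varepsilon(s_{i+1})$ or ($\varepsilon(s_i)=+$, $\varepsilon(s_{i+1})=-$); $F_\sigma(x,y)=\sum z_{i_1}\cdots z_{i_n}$ over $i_1\le\dots\le i_n$ with $i_j<i_{j+1}$ for $j\in{\rm wDes}(\sigma)$, $z_{i_j}=x_{i_j}$ if $\tilde\varepsilon(j)=+$, else $y_{i_j}$. Fine sets: for a signed composition $\gamma=(\gamma_1,\dots,\gamma_m)$ of $n$ (some parts barred), partial sums $r_i$, $r_0=0$, $S(\gamma)=\{r_1,\dots,r_m\}$, blocks $I_i=\{r_{i-1}+1,\dots,r_i\}$: $\mathrm{wt}_\gamma(\sigma)=0$ if for some $i$, $S\cap\{r_{i-1}+1,\dots,r_i-1\}$ is not an initial segment of $\{r_{i-1}+1,\dots,r_i-1\}$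 or $\tilde\varepsilon$ is not constant on $I_i$; else $(-1)^{|S\setminus S(\gamma)|+n_\gamma(\sigma)}$, $n_\gamma(\sigma)$ the number of $i$ with $\tilde\varepsilon=-$ on $I_i$ and $\gamma_i$ barred. A finite set $\mathcal B$ with map $\mathrm{sDes}$ is fine for a class function $\chi$ of $B_n$ if $\chi(\gamma)=\sum_{b\in\mathcal B}\mathrm{wt}_\gamma(\mathrm{sDes}(b))$ for all $\gamma$, $\chi(\gamma)$ being the value at elements of signed cycle type (sorted unbarred parts; sorted barred parts of $\gamma$). -}

module Defs where

open import Data.Bool using (Bool; true; false; _∧_; _∨_; not; if_then_else_)
open import Data.Nat as ℕ using (ℕ; zero; suc; _+_; _∸_; _≡ᵇ_; _<ᵇ_; _≤ᵇ_)
open import Data.Integer as ℤ using (ℤ; +_; -[1+_]; ∣_∣)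
open import Data.List using (List; []; _∷_; _++_; [_]; map; filterᵇ; concatMap; length; upTo; foldr)
open import Data.Bool.ListAction using (all; any)
open import Data.Product using (_×_; _,_; proj₁; proj₂)
open import Function using (_∘_)

-- Conventions.
-- * A signed permutation w ∈ B_n is the list (w(1),…,w(n)) of nonzero
--   integers; a barred entry ī is the negative integer -i.
-- * Positions and absolute values are natural numbers 1..n.
-- * A sign / "barred" flag is a Bool: true = barred (= sign −).

range1 : ℕ → List ℕ
range1 n = map suc (upTo n)

eqBool : Bool → Bool → Bool
eqBool true  b = b
eqBool false b = not b

elemᵇ : ℕ → List ℕ → Bool
elemᵇ x xs = any (x ≡ᵇ_) xs

countᵇ : ℕ → List ℕ → ℕ
countᵇ x xs = length (filterᵇ (x ≡ᵇ_) xs)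

sameSet : List ℕ → List ℕ → Bool
sameSet xs ys = all (λ x → elemᵇ x ys) xs ∧ all (λ y → elemᵇ y xs) ys

iter : {A : Set} → (A → A) → ℕ → A → A
iter f zero    a = a
iter f (suc k) a = f (iter f k a)

sumℤ : List ℤ → ℤ
sumℤ = foldr ℤ._+_ (+ 0)

prodℤ : List ℤ → ℤ
prodℤ = foldr ℤ._*_ (+ 1)

minusOnePow : ℕ → ℤ
minusOnePow zero          = + 1
minusOnePow (suc zero)    = ℤ.- (+ 1)
minusOnePow (suc (suc k)) = minusOnePow k

barred : ℤ → Bool
barred (+ _)      = false
barred -[1+ _ ]   = true

signOf : ℤ → ℤ
signOf v = if barred v then ℤ.- (+ 1) else + 1

-- w(i), 1-indexed (junk value 0 outside 1..length w)
at : List ℤ → ℕ → ℤ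
at []       _             = + 0
at (x ∷ xs) zero          = + 0
at (x ∷ xs) (suc zero)    = x
at (x ∷ xs) (suc (suc i)) = at xs (suc i)

applyS : List ℤ → ℤ → ℤ
applyS w v = if barred v then ℤ.- (at w ∣ v ∣) else at w ∣ v ∣

words : {A : Set} → List A → ℕ → List (List A)
words xs zero    = [ [] ]
words xs (suc k) = concatMap (λ a → map (a ∷_) (words xs k)) xs

signedLetters : ℕ → List ℤ
signedLetters n = concatMap (λ k → + k ∷ ℤ.- (+ k) ∷ []) (range1 n)

isSignedPerm : ℕ → List ℤ → Bool
isSignedPerm n w = (length w ≡ᵇ n) ∧ all (λ k → countᵇ k (map ∣_∣ w) ≡ᵇ 1) (range1 n)

B : ℕ → List (List ℤ)
B n = filterᵇ (isSignedPerm n) (words (signedLetters n) n)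

compose : ℕ → List ℤ → List ℤ → List ℤ
compose n u v = map (λ i → applyS u (at v i)) (range1 n)

preimage : ℕ → List ℤ → ℕ → ℤ
preimage n w i =
  foldr (λ j acc → if ∣ at w j ∣ ≡ᵇ i
                   then (if barred (at w j) then ℤ.- (+ j) else + j)
                   else acc)
        (+ 0) (range1 n)

inverse : ℕ → List ℤ → List ℤ
inverse n w = map (preimage n w) (range1 n)

conj : ℕ → List ℤ → List ℤ → List ℤ
conj n x g = compose n (inverse n x) (compose n g x)

absMap : List ℤ → ℕ → ℕ
absMap w i = ∣ at w i ∣

cycLen : ℕ → List ℤ → ℕ → ℕ
cycLen n w i = foldr (λ k acc → if iter (absMap w) k i ≡ᵇ i then k else acc) 0 (range1 n)

orbit : ℕ → List ℤ → ℕ → List ℕ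
orbit n w i = map (λ k → iter (absMap w) k i) (upTo (cycLen n w i))

-- the cycle of w on {1..n,1̄..n̄} through i contains ī, i.e. c = c̄ (negative cycle)
cycleNeg : ℕ → List ℤ → ℕ → Bool
cycleNeg n w i = barred (iter (applyS w) (cycLen n w i) (+ i))

isCycleMin : ℕ → List ℤ → ℕ → Bool
isCycleMin n w i = all (λ j → i ≤ᵇ j) (orbit n w i)

-- lengths of positive cycles (pairs c, c̄), one entry per pair
posCycleLengths : ℕ → List ℤ → List ℕ
posCycleLengths n w =
  map (cycLen n w) (filterᵇ (λ i → isCycleMin n w i ∧ not (cycleNeg n w i)) (range1 n))

-- half lengths of negative cycles (c = c̄)
negCycleLengths : ℕ → List ℤ → List ℕ
negCycleLengths n w =
  map (cycLen n w) (filterᵇ (λ i → isCycleMin n w i ∧ cycleNeg n w i) (range1 n))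

sublists : {A : Set} → List A → List (List A)
sublists []       = [ [] ]
sublists (x ∷ xs) = sublists xs ++ map (x ∷_) (sublists xs)

inversions : List ℕ → ℕ
inversions []       = 0
inversions (x ∷ xs) = length (filterᵇ (λ y → y <ᵇ x) xs) + inversions xs

-- For I = {i₁<…<i_k} (an increasing list), the coefficient of e_I in
-- h·e_I = (h e_{i₁}) ∧ … ∧ (h e_{i_k}), where h e_i = ±e_{|h(i)|}.
diagCoeff : List ℤ → List ℕ → ℤ
diagCoeff h I =
  if all (λ i → elemᵇ (absMap h i) I) I ∧ all (λ i → any (λ j → absMap h j ≡ᵇ i) I) I
  then prodℤ (map (signOf ∘ at h) I) ℤ.* minusOnePow (inversions (map (absMap h) I))
  else + 0

-- trace of h ∈ B_m on ⋀V_m (basis e_I, I ⊆ [m])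
extChar : ℕ → List ℤ → ℤ
extChar m h = sumℤ (map (diagCoeff h) (sublists (range1 m)))

-- h ∈ B_n lies in B_{n-1} (h fixes n)
fixesLast : ℕ → List ℤ → Bool
fixesLast n h = not (barred (at h n)) ∧ (∣ at h n ∣ ≡ᵇ n)

extChar⁰ : ℕ → List ℤ → ℤ
extChar⁰ n h = if fixesLast n h then extChar (n ∸ 1) h else + 0

-- |B_{n-1}|, computed as the order of the stabiliser of n in B_n
subgroupOrder : ℕ → ℕ
subgroupOrder n = length (filterᵇ (fixesLast n) (B n))

-- |B_{n-1}| · (ind_{B_{n-1}}^{B_n} χ_{⋀V_{n-1}})(g) = Σ_{x ∈ B_n} χ⁰(x⁻¹ g x)
inducedScaled : ℕ → List ℤ → ℤ
inducedScaled n g = sumℤ (map (λ x → extChar⁰ n (conj n x g)) (B n))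

predMod : ℕ → ℕ → ℕ
predMod n a = if a ≡ᵇ 1 then n else a ∸ 1

succMod : ℕ → ℕ → ℕ
succMod n a = if a ≡ᵇ n then 1 else suc a

window : ℕ → ℕ → ℕ → List ℕ
window n a ℓ = map (λ t → iter (succMod n) t a) (upTo ℓ)

isInterval : ℕ → List ℕ → Bool
isInterval n P = any (λ a → any (λ ℓ → sameSet (window n a ℓ) P) (upTo (suc n))) (range1 n)

arcCond : ℕ → List ℤ → ℕ → Bool
arcCond n w i =
  isInterval n P
  ∧ (not (elemᵇ (predMod n a) P) ∨ not (barred (at w i)))
  ∧ (not (elemᵇ (succMod n a) P) ∨ barred (at w i))
  where
    P = map (absMap w) (range1 (i ∸ 1))
    a = absMap w i

isArc : ℕ → List ℤ → Bool
isArc n w = all (arcCond n w) (filterᵇ (2 ≤ᵇ_) (range1 (n ∸ 1)))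

arcPerms : ℕ → List (List ℤ)
arcPerms n = filterᵇ (isArc n) (B n)

-- Signed descent set: σ = (S, ε) encoded as the increasing list of pairs
-- (s, ε(s) = −) for s ∈ S.

SignedSet : Set
SignedSet = List (ℕ × Bool)

-- position in the order 1̄ <_r … <_r n̄ <_r 1 <_r … <_r n
rank : ℕ → ℤ → ℕ
rank n v = if barred v then ∣ v ∣ else n + ∣ v ∣

inDes : ℕ → List ℤ → ℕ → Bool
inDes n w s = (s ≡ᵇ n)
            ∨ (rank n (at w (suc s)) <ᵇ rank n (at w s))
            ∨ (barred (at w s) ∧ not (barred (at w (suc s))))

sDes : ℕ → List ℤ → SignedSet
sDes n w = map (λ s → s , barred (at w s)) (filterᵇ (inDes n w) (range1 n))

memS : SignedSet → ℕ → Bool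
memS σ j = any (λ p → proj₁ p ≡ᵇ j) σ

-- ε̃(j) = ε(s_i) for the least s_i ∈ S with j ≤ s_i   (true = −)
tildeEps : SignedSet → ℕ → Bool
tildeEps σ j = foldr (λ p acc → if j ≤ᵇ proj₁ p then proj₂ p else acc) false σ

-- Signed compositions and the weights wt_γ
-- γ = list of parts (γ_i , γ_i barred)

SignedComposition : Set
SignedComposition = List (ℕ × Bool)

unbarredParts : SignedComposition → List ℕ
unbarredParts γ = map proj₁ (filterᵇ (not ∘ proj₂) γ)

barredParts : SignedComposition → List ℕ
barredParts γ = map proj₁ (filterᵇ proj₂ γ)

blocksFrom : ℕ → SignedComposition → List (ℕ × ℕ × Bool)
blocksFrom r []             = []
blocksFrom r ((k , b) ∷ γ) = (r , r + k , b) ∷ blocksFrom (r + k) γ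

blocks : SignedComposition → List (ℕ × ℕ × Bool)
blocks = blocksFrom 0

Sγ : SignedComposition → List ℕ
Sγ γ = map (proj₁ ∘ proj₂) (blocks γ)

segment : ℕ → ℕ → List ℕ
segment a k = map (λ t → a + suc t) (upTo k)

blockOK : SignedSet → ℕ × ℕ × Bool → Bool
blockOK σ (a , b , _) = initSeg ∧ constEps
  where
    inner = segment a (b ∸ a ∸ 1)
    initSeg  = any (λ t → all (λ j → eqBool (memS σ j) (j ≤ᵇ a + t)) inner)
                   (upTo (suc (length inner)))
    constEps = all (λ j → eqBool (tildeEps σ j) (tildeEps σ (suc a))) (segment a (b ∸ a))

wt : SignedComposition → SignedSet → ℤ
wt γ σ =
  if all (blockOK σ) (blocks γ)
  then minusOnePow (length (filterᵇ (λ p → not (elemᵇ (proj₁ p) (Sγ γ))) σ) + nγ)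
  else + 0
  where
    nγ = length (filterᵇ (λ blk → proj₂ (proj₂ blk) ∧ tildeEps σ (suc (proj₁ blk))) (blocks γ))

arcWeightSum : ℕ → SignedComposition → ℤ
arcWeightSum n γ = sumℤ (map (λ w → wt γ (sDes n w)) (arcPerms n))

{-# OPTIONS --safe #-}
module Submission where

-- Both sides equal N · m₁ · ∏ᵢ (1 + (-1)^{kᵢ-1+bᵢ}), where N = |B_{n-1}|, the kᵢ are the parts of γ,
-- bᵢ = 1 if kᵢ is barred, and m₁ is the number of unbarred parts equal to 1.
--
-- Induced character: the diagonal coefficient of e_I for x⁻¹gx vanishes unless I is a union of cycles, and on
-- such unions it is multiplicative with value (-1)^{k-1+b} on a cycle (sort the elements of I in cycle order:
-- the sign of a rotation of k letters is (-1)^{k-1}). So the trace on ⋀V_n is the product above, it is twice the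
-- trace on ⋀V_{n-1} when x⁻¹gx fixes n, and this happens for 2N elements x per positive fixed point of g.
--
-- Arc permutations: they are determined by w(1) and by the signs, which are arbitrary; for fixed signs the position
-- q of the letter n may replace w(1). Two adjacent entries of equal sign are cyclically consecutive, so the descents
-- inside a block of constant sign are none (unbarred) or all (barred), except for one gap at q. Hence the weight is
-- a product over the blocks, the sum over the signs factorises, and the sum over the positions q inside
-- one block cancels to 0 unless the block has size 1.

open import Defs
open import Data.Bool using (Bool; true; false; _∧_; _∨_; not; if_then_else_; T)
open import Data.Bool.ListAction using (all; any)
open import Data.Bool.Properties using (T-∧; T?)
open import Data.Empty using (⊥-elim)
open import Data.Integer as ℤ using (ℤ; +_; -[1+_]; ∣_∣)
import Data.Integer.Properties as ℤₚ
open ℤₚ using (*-identityˡ; *-identityʳ; *-zeroʳ; +-identityˡ)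
open import Data.Integer.Tactic.RingSolver using (solve-∀)
open import Data.List using (List; []; _∷_; _++_; [_]; map; filterᵇ; concat; concatMap; length; upTo; applyUpTo; foldr; take; drop)
import Data.List.Properties as Listₚ
open Listₚ using (map-∘; length-map; map-++)
open import Data.List.Membership.Propositional using (_∈_; _∉_; lose; find)
import Data.List.Membership.Propositional.Properties as ∈ₚ
open ∈ₚ using (∈-map⁺; ∈-map⁻; ∈-++⁺ˡ; ∈-++⁺ʳ; ∈-++⁻; ∈-upTo⁺; ∈-upTo⁻; ∈-concatMap⁺; ∈-concatMap⁻)
open import Data.List.Membership.Propositional.Properties.WithK using (unique∧set⇒bag)
open import Data.List.Relation.Binary.BagAndSetEquality using (∼bag⇒↭)
open import Data.List.Relation.Binary.Permutation.Propositional as Perm using (_↭_)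
open Perm using (↭-sym)
import Data.List.Relation.Binary.Permutation.Propositional.Properties as Permₚ
open Permₚ using (∈-resp-↭; ↭-length)
open import Data.List.Relation.Unary.All as All using (All; []; _∷_)
import Data.List.Relation.Unary.All.Properties as Allₚ
open import Data.List.Relation.Unary.AllPairs as AllPairs using (AllPairs; []; _∷_)
import Data.List.Relation.Unary.AllPairs.Properties as AllPairsₚ
open import Data.List.Relation.Unary.Any using (here; there)
import Data.List.Relation.Unary.Any.Properties as Anyₚ
open import Data.List.Relation.Unary.Unique.Propositional using (Unique)
import Data.List.Relation.Unary.Unique.Propositional.Properties as Uniqueₚ
open import Data.Nat as ℕ using (ℕ; zero; suc; _+_; _*_; _∸_; _≤_; _<_; z≤n; s≤s; _≡ᵇ_; _<ᵇ_; _≤ᵇ_; NonZero)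
open import Data.Nat.DivMod using (_%_; _/_; m≡m%n+[m/n]*n; [m+kn]%n≡m%n; [m+n]%n≡m%n; m<n⇒m%n≡m; m%n<n; n%n≡0)
open import Data.Nat.ListAction using (sum)
import Data.Nat.Properties as ℕₚ
open ℕₚ using (+-assoc; +-cancelˡ-<; +-comm; +-identityʳ; +-monoʳ-<; +-monoʳ-≤; +-monoˡ-≤; +-suc; <-asym)
open ℕₚ using (<-≤-trans; <ᵇ⇒<; <⇒<ᵇ; <⇒≢; <⇒≤; <⇒≱; m+[n∸m]≡n; m+n∸m≡n; m<m+n; m<n⇒m<1+n; m∸n+n≡m; m∸n≤m; m≤m+n)
open ℕₚ using (m≤n+m; m≤n⇒m<n∨m≡n; m≤n⇒m≤1+n; m≤n⇒∃[o]m+o≡n; n<1+n; n≤1+n; suc-injective; suc-pred; ≡ᵇ⇒≡; ≡⇒≡ᵇ)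
open ℕₚ using (≤-<-trans; ≤-antisym; ≤-pred; ≤-refl; ≤-reflexive; ≤-total; ≤-trans; ≤ᵇ⇒≤; ≤⇒≤ᵇ; ≤∧≢⇒<; ≮⇒≥)
import Data.Nat.Tactic.RingSolver as NatSolver
open import Data.Product using (_×_; _,_; proj₁; proj₂; ∃; ∃₂)
open import Data.Sum using (_⊎_; inj₁; inj₂; [_,_]′)
open import Data.Unit using (tt)
open import Function using (_∘_; id; mk⇔; _|>_)
open import Function.Bundles using (module Equivalence)
open import Relation.Binary.Definitions using (tri<; tri≈; tri>)
open import Relation.Binary.PropositionalEquality hiding ([_])
open import Relation.Nullary using (¬_; yes; no; contradiction)

-- Two choices shape the argument. The subgroup B_{n-1} is not stable under conjugation, while the
-- trace on ⋀V_n is a class function; doubling every summand trades ⋀V_{n-1} for ⋀V_n, so the cycles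
-- of g need only be transported along x⁻¹. The 2 is cancelled at the end against the two signs that
-- x(n) may have. The definitions list subsets in increasing order, whereas a cycle is natural in
-- cyclic order. The sign of a bijection on a subset is therefore taken relative to an arbitrary
-- listing of that subset. For arc permutations, ℤ_n is lifted to ℕ: the letters read so far are the
-- residues of a stretch lo..hi, a barred letter is lo - 1 and an unbarred one hi + 1. A start at n
-- + a leaves room for every decrement. Shifting the start shifts all letters alike, so the letter n
-- meets each position exactly once. Inside a block of size k at least 2 only q = 1 and q = k
-- contribute, with opposite totals; positions outside the block all give the same factor 1 +
-- (-1)^{k-1+b}.

private variable
  A C : Set

-- Booleans, boolean quantifiers and membership

T-ext : ∀ {a b} → (T a → T b) → (T b → T a) → a ≡ b
T-ext {false} {false} f g = refl
T-ext {false} {true}  f g = ⊥-elim (g tt)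
T-ext {true}  {false} f g = ⊥-elim (f tt)
T-ext {true}  {true}  f g = refl

T⇒≡ : ∀ {b} → T b → b ≡ true
T⇒≡ {true} _ = refl

¬T⇒≡ : ∀ {b} → ¬ T b → b ≡ false
¬T⇒≡ {true}  h = ⊥-elim (h tt)
¬T⇒≡ {false} h = refl

≡⇒T : ∀ {b} → b ≡ true → T b
≡⇒T refl = tt

∧-⁻ : ∀ {a b} → T (a ∧ b) → T a × T b
∧-⁻ = Equivalence.to T-∧

∧-⁺ : ∀ {a b} → T a → T b → T (a ∧ b)
∧-⁺ p q = Equivalence.from T-∧ (p , q)

≡ᵇ-refl : ∀ n → (n ≡ᵇ n) ≡ true
≡ᵇ-refl n = T⇒≡ (≡⇒≡ᵇ n n refl)

≢⇒≡ᵇ-false : ∀ {m n} → m ≢ n → (m ≡ᵇ n) ≡ false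
≢⇒≡ᵇ-false {m} {n} m≢n = ¬T⇒≡ (m≢n ∘ ≡ᵇ⇒≡ m n)

all-⁻ : ∀ (p : A → Bool) xs {x} → T (all p xs) → x ∈ xs → T (p x)
all-⁻ p xs t = All.lookup (Allₚ.all⁺ p xs t)

all-⁺ : ∀ (p : A → Bool) xs → (∀ {x} → x ∈ xs → T (p x)) → T (all p xs)
all-⁺ p xs h = Allₚ.all⁻ p (All.tabulate h)

any-⁻ : ∀ (p : A → Bool) xs → T (any p xs) → ∃ λ x → x ∈ xs × T (p x)
any-⁻ p xs t = find (Anyₚ.any⁻ p xs t)

any-⁺ : ∀ (p : A → Bool) {xs x} → x ∈ xs → T (p x) → T (any p xs)
any-⁺ p x∈ t = Anyₚ.any⁺ p (lose x∈ t)

elem-⁻ : ∀ {x} xs → T (elemᵇ x xs) → x ∈ xs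
elem-⁻ {x} xs t with any-⁻ (x ≡ᵇ_) xs t
... | y , y∈ , e = subst (_∈ xs) (sym (≡ᵇ⇒≡ x y e)) y∈

elem-⁺ : ∀ {x xs} → x ∈ xs → T (elemᵇ x xs)
elem-⁺ {x} x∈ = any-⁺ (x ≡ᵇ_) x∈ (≡⇒≡ᵇ x x refl)

∈-filterᵇ⁺ : ∀ {p : A → Bool} {x xs} → x ∈ xs → T (p x) → x ∈ filterᵇ p xs
∈-filterᵇ⁺ {p = p} = ∈ₚ.∈-filter⁺ (T? ∘ p)

∈-filterᵇ⁻ : ∀ {p : A → Bool} {x xs} → x ∈ filterᵇ p xs → x ∈ xs × T (p x)
∈-filterᵇ⁻ {p = p} = ∈ₚ.∈-filter⁻ (T? ∘ p)

∈-range1⁺ : ∀ {i n} → 1 ≤ i → i ≤ n → i ∈ range1 n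
∈-range1⁺ {suc i} _ i≤n = ∈-map⁺ suc (∈-upTo⁺ i≤n)

∈-range1⁻ : ∀ {i n} → i ∈ range1 n → 1 ≤ i × i ≤ n
∈-range1⁻ i∈ with ∈-map⁻ suc i∈
... | j , j∈ , refl = s≤s z≤n , ∈-upTo⁻ j∈

range1-unique : ∀ n → Unique (range1 n)
range1-unique n = Uniqueₚ.map⁺ suc-injective (Uniqueₚ.upTo⁺ n)

length-range1 : ∀ n → length (range1 n) ≡ n
length-range1 n = trans (length-map suc (upTo n)) (Listₚ.length-upTo n)

-- Duplicate-free lists

unique-↭ : ∀ {xs ys : List A} → Unique xs → Unique ys →
  (∀ {x} → x ∈ xs → x ∈ ys) → (∀ {x} → x ∈ ys → x ∈ xs) → xs ↭ ys
unique-↭ u v f g = ∼bag⇒↭ (unique∧set⇒bag u v (mk⇔ f g))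

Unique-↭ : ∀ {xs ys : List A} → xs ↭ ys → Unique xs → Unique ys
Unique-↭ Perm.refl u = u
Unique-↭ (Perm.prep x p) (x∉ ∷ u) = Permₚ.All-resp-↭ p x∉ ∷ Unique-↭ p u
Unique-↭ (Perm.swap x y p) ((x≢y ∷ x∉) ∷ y∉ ∷ u) =
  ((x≢y ∘ sym) ∷ Permₚ.All-resp-↭ p y∉) ∷ Permₚ.All-resp-↭ p x∉ ∷ Unique-↭ p u
Unique-↭ (Perm.trans p q) u = Unique-↭ q (Unique-↭ p u)

Unique-head : ∀ {x : A} {xs} → Unique (x ∷ xs) → x ∉ xs
Unique-head (x∉ ∷ _) x∈ = All.lookup x∉ x∈ refl

∷-Unique : ∀ {x : A} {xs} → x ∉ xs → Unique xs → Unique (x ∷ xs)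
∷-Unique x∉ u = Allₚ.¬Any⇒All¬ _ x∉ ∷ u

Unique-++⁻ : ∀ (xs : List A) {ys} → Unique (xs ++ ys) →
  Unique xs × Unique ys × (∀ {x} → x ∈ xs → x ∉ ys)
Unique-++⁻ [] u = [] , u , λ ()
Unique-++⁻ (x ∷ xs) (x∉ ∷ u) with Unique-++⁻ xs u
... | u₁ , u₂ , d = Allₚ.++⁻ˡ xs x∉ ∷ u₁ , u₂ ,
  λ { (here refl) y∈ → All.lookup (Allₚ.++⁻ʳ xs x∉) y∈ refl ; (there x∈) → d x∈ }

map-unique : ∀ {f : A → C} {xs} → (∀ {x y} → x ∈ xs → y ∈ xs → f x ≡ f y → x ≡ y) →
  Unique xs → Unique (map f xs)
map-unique {xs = []} inj [] = []
map-unique {f = f} {xs = x ∷ xs} inj u@(_ ∷ u′) =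
  ∷-Unique (λ fx∈ → let y , y∈ , e = ∈-map⁻ f fx∈ in
              Unique-head u (subst (_∈ xs) (sym (inj (here refl) (there y∈) e)) y∈))
           (map-unique (λ p q → inj (there p) (there q)) u′)

-- Pigeonhole: distinct elements of `xs` take away distinct occurrences in `ys`, and the length
-- bound leaves nothing over. This is how injectivity yields surjectivity throughout.
unique-⊆-↭ : ∀ {xs ys : List A} → Unique xs → (∀ {x} → x ∈ xs → x ∈ ys) →
  length ys ≤ length xs → xs ↭ ys
unique-⊆-↭ {xs = []} {[]} u sub le = Perm.refl
unique-⊆-↭ {xs = x ∷ xs} {ys} u@(_ ∷ u′) sub le with ∈ₚ.∈-∃++ (sub (here refl))
... | as , bs , refl = Perm.trans (Perm.prep x rec) (↭-sym (Permₚ.shift x as bs))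
  where
  sub′ : ∀ {y} → y ∈ xs → y ∈ as ++ bs
  sub′ y∈ with ∈-resp-↭ (Permₚ.shift x as bs) (sub (there y∈))
  ... | here refl = contradiction y∈ (Unique-head u)
  ... | there y∈′ = y∈′
  rec : xs ↭ as ++ bs
  rec = unique-⊆-↭ u′ sub′
    (≤-pred (subst (_≤ suc (length xs)) (↭-length (Permₚ.shift x as bs)) le))

self-map-↭ : ∀ {f : A → A} {xs} → Unique xs → (∀ {x} → x ∈ xs → f x ∈ xs) →
  (∀ {x y} → x ∈ xs → y ∈ xs → f x ≡ f y → x ≡ y) → map f xs ↭ xs
self-map-↭ {f = f} {xs} u stable inj = unique-⊆-↭ (map-unique inj u)
  (λ y∈ → let x , x∈ , e = ∈-map⁻ f y∈ in subst (_∈ xs) (sym e) (stable x∈))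
  (≤-reflexive (sym (length-map f xs)))

-- Finite sums and products

∑ : List A → (A → ℤ) → ℤ
∑ xs f = sumℤ (map f xs)

∏ : List A → (A → ℤ) → ℤ
∏ xs f = prodℤ (map f xs)

[_]ᵢ : Bool → ℤ
[ b ]ᵢ = if b then + 1 else + 0

∑-cong : ∀ (xs : List A) {f g : A → ℤ} → (∀ {x} → x ∈ xs → f x ≡ g x) → ∑ xs f ≡ ∑ xs g
∑-cong [] h = refl
∑-cong (x ∷ xs) h = cong₂ ℤ._+_ (h (here refl)) (∑-cong xs (h ∘ there))

∑-0 : ∀ (xs : List A) {f : A → ℤ} → (∀ {x} → x ∈ xs → f x ≡ + 0) → ∑ xs f ≡ + 0
∑-0 [] h = refl
∑-0 (x ∷ xs) h = cong₂ ℤ._+_ (h (here refl)) (∑-0 xs (h ∘ there))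

private
  swap-+ : ∀ a b c → a ℤ.+ (b ℤ.+ c) ≡ b ℤ.+ (a ℤ.+ c)
  swap-+ = solve-∀
  swap-* : ∀ a b c → a ℤ.* (b ℤ.* c) ≡ b ℤ.* (a ℤ.* c)
  swap-* = solve-∀
  inter-+ : ∀ a b c d → (a ℤ.+ b) ℤ.+ (c ℤ.+ d) ≡ (a ℤ.+ c) ℤ.+ (b ℤ.+ d)
  inter-+ = solve-∀
  square-first : ∀ a b → (a ℤ.* b) ℤ.* a ≡ (a ℤ.* a) ℤ.* b
  square-first = solve-∀
  inter-+ℕ : ∀ a b c d → (a + b) + (c + d) ≡ (a + c) + (b + d)
  inter-+ℕ = NatSolver.solve-∀
  swap-last-+ℕ : ∀ a b c → a + b + c ≡ a + c + b
  swap-last-+ℕ = NatSolver.solve-∀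
  inter-* : ∀ a b c d → (a ℤ.* b) ℤ.* (c ℤ.* d) ≡ (a ℤ.* c) ℤ.* (b ℤ.* d)
  inter-* = solve-∀

∑-↭ : ∀ {xs ys : List A} (f : A → ℤ) → xs ↭ ys → ∑ xs f ≡ ∑ ys f
∑-↭ f Perm.refl = refl
∑-↭ f (Perm.prep x p) = cong (ℤ._+_ (f x)) (∑-↭ f p)
∑-↭ f (Perm.swap x y p) = trans (cong (λ z → f x ℤ.+ (f y ℤ.+ z)) (∑-↭ f p)) (swap-+ (f x) (f y) _)
∑-↭ f (Perm.trans p q) = trans (∑-↭ f p) (∑-↭ f q)

∏-↭ : ∀ {xs ys : List A} (f : A → ℤ) → xs ↭ ys → ∏ xs f ≡ ∏ ys f
∏-↭ f Perm.refl = refl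
∏-↭ f (Perm.prep x p) = cong (f x ℤ.*_) (∏-↭ f p)
∏-↭ f (Perm.swap x y p) = trans (cong (λ z → f x ℤ.* (f y ℤ.* z)) (∏-↭ f p)) (swap-* (f x) (f y) _)
∏-↭ f (Perm.trans p q) = trans (∏-↭ f p) (∏-↭ f q)

∏-cong : ∀ (xs : List A) {f g : A → ℤ} → (∀ {x} → x ∈ xs → f x ≡ g x) → ∏ xs f ≡ ∏ xs g
∏-cong [] h = refl
∏-cong (x ∷ xs) h = cong₂ ℤ._*_ (h (here refl)) (∏-cong xs (h ∘ there))

∏-map : ∀ (h : A → C) xs (f : C → ℤ) → ∏ (map h xs) f ≡ ∏ xs (f ∘ h)
∏-map h xs f = cong prodℤ (sym (map-∘ xs))

∏-++ : ∀ xs {ys : List A} (f : A → ℤ) → ∏ (xs ++ ys) f ≡ ∏ xs f ℤ.* ∏ ys f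
∏-++ [] f = sym (*-identityˡ _)
∏-++ (x ∷ xs) f = trans (cong (f x ℤ.*_) (∏-++ xs f)) (sym (ℤₚ.*-assoc (f x) _ _))

∏-* : ∀ (xs : List A) (f g : A → ℤ) → ∏ xs (λ x → f x ℤ.* g x) ≡ ∏ xs f ℤ.* ∏ xs g
∏-* [] f g = refl
∏-* (x ∷ xs) f g = trans (cong (f x ℤ.* g x ℤ.*_) (∏-* xs f g)) (inter-* (f x) (g x) _ _)

∑-++ : ∀ xs {ys : List A} (f : A → ℤ) → ∑ (xs ++ ys) f ≡ ∑ xs f ℤ.+ ∑ ys f
∑-++ [] f = sym (+-identityˡ _)
∑-++ (x ∷ xs) f = trans (cong (ℤ._+_ (f x)) (∑-++ xs f)) (sym (ℤₚ.+-assoc (f x) _ _))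

∑-map : ∀ (h : A → C) xs (f : C → ℤ) → ∑ (map h xs) f ≡ ∑ xs (f ∘ h)
∑-map h xs f = cong sumℤ (sym (map-∘ xs))

∑-concatMap : ∀ (h : A → List C) xs (f : C → ℤ) → ∑ (concatMap h xs) f ≡ ∑ xs (λ a → ∑ (h a) f)
∑-concatMap h [] f = refl
∑-concatMap h (x ∷ xs) f = trans (∑-++ (h x) f) (cong (ℤ._+_ (∑ (h x) f)) (∑-concatMap h xs f))

∑-*ˡ : ∀ c (xs : List A) (f : A → ℤ) → ∑ xs (λ x → c ℤ.* f x) ≡ c ℤ.* ∑ xs f
∑-*ˡ c [] f = sym (*-zeroʳ c)
∑-*ˡ c (x ∷ xs) f = trans (cong (ℤ._+_ (c ℤ.* f x)) (∑-*ˡ c xs f)) (sym (ℤₚ.*-distribˡ-+ c (f x) _))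

∑-*ʳ : ∀ c (xs : List A) (f : A → ℤ) → ∑ xs (λ x → f x ℤ.* c) ≡ ∑ xs f ℤ.* c
∑-*ʳ c xs f = trans (∑-cong xs (λ {x} _ → ℤₚ.*-comm (f x) c))
  (trans (∑-*ˡ c xs f) (ℤₚ.*-comm c _))

∑-+ : ∀ (xs : List A) (f g : A → ℤ) → ∑ xs (λ x → f x ℤ.+ g x) ≡ ∑ xs f ℤ.+ ∑ xs g
∑-+ [] f g = refl
∑-+ (x ∷ xs) f g = trans (cong (ℤ._+_ (f x ℤ.+ g x)) (∑-+ xs f g)) (inter-+ (f x) (g x) _ _)

∑-swap : ∀ (xs : List A) (ys : List C) (f : A → C → ℤ) →
  ∑ xs (λ x → ∑ ys (f x)) ≡ ∑ ys (λ y → ∑ xs (λ x → f x y))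
∑-swap [] ys f = sym (∑-0 ys (λ _ → refl))
∑-swap (x ∷ xs) ys f = trans (cong (ℤ._+_ (∑ ys (f x))) (∑-swap xs ys f))
  (sym (∑-+ ys (f x) (λ y → ∑ xs (λ x → f x y))))

∑-filterᵇ : ∀ (p : A → Bool) xs (f : A → ℤ) →
  ∑ (filterᵇ p xs) f ≡ ∑ xs (λ x → if p x then f x else + 0)
∑-filterᵇ p [] f = refl
∑-filterᵇ p (x ∷ xs) f with p x
... | true  = cong (ℤ._+_ (f x)) (∑-filterᵇ p xs f)
... | false = trans (∑-filterᵇ p xs f) (sym (+-identityˡ _))

length-filterᵇ : ∀ (p : A → Bool) xs → + length (filterᵇ p xs) ≡ ∑ xs (λ x → [ p x ]ᵢ)
length-filterᵇ p [] = refl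
length-filterᵇ p (x ∷ xs) with p x
... | true  = cong (ℤ._+_ (+ 1)) (length-filterᵇ p xs)
... | false = trans (length-filterᵇ p xs) (sym (+-identityˡ _))

∑-delta : ∀ {xs} (v : ℕ) (f : ℕ → ℤ) → Unique xs → v ∈ xs →
  ∑ xs (λ c → if v ≡ᵇ c then f c else + 0) ≡ f v
∑-delta {x ∷ xs} v f u (here refl) rewrite ≡ᵇ-refl v =
  trans (cong (ℤ._+_ (f v)) (∑-0 xs λ {c} c∈ → off c c∈)) (ℤₚ.+-identityʳ _)
  where
  off : ∀ c → c ∈ xs → (if v ≡ᵇ c then f c else + 0) ≡ + 0
  off c c∈ rewrite ≢⇒≡ᵇ-false {v} {c} (λ { refl → Unique-head u c∈ }) = refl
∑-delta {x ∷ xs} v f u@(_ ∷ u′) (there v∈)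
  rewrite ≢⇒≡ᵇ-false {v} {x} (λ { refl → Unique-head u v∈ }) =
  trans (+-identityˡ _) (∑-delta v f u′ v∈)

minusOnePow-suc : ∀ k → minusOnePow (suc k) ≡ ℤ.- minusOnePow k
minusOnePow-suc zero = refl
minusOnePow-suc (suc zero) = refl
minusOnePow-suc (suc (suc k)) = minusOnePow-suc k

minusOnePow-+ : ∀ j k → minusOnePow (j + k) ≡ minusOnePow j ℤ.* minusOnePow k
minusOnePow-+ zero k = sym (*-identityˡ _)
minusOnePow-+ (suc j) k = begin
  minusOnePow (suc (j + k))              ≡⟨ minusOnePow-suc (j + k) ⟩
  ℤ.- minusOnePow (j + k)                ≡⟨ cong ℤ.-_ (minusOnePow-+ j k) ⟩
  ℤ.- (minusOnePow j ℤ.* minusOnePow k)  ≡⟨ ℤₚ.neg-distribˡ-* (minusOnePow j) _ ⟩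
  ℤ.- minusOnePow j ℤ.* minusOnePow k    ≡⟨ cong (ℤ._* minusOnePow k) (minusOnePow-suc j) ⟨
  minusOnePow (suc j) ℤ.* minusOnePow k  ∎
  where open ≡-Reasoning

minusOnePow-double : ∀ k → minusOnePow (k + k) ≡ + 1
minusOnePow-double zero = refl
minusOnePow-double (suc k) rewrite +-suc k k = minusOnePow-double k

-- Signs of permutations of lists

less : ℕ → List ℕ → ℕ
less x ys = length (filterᵇ (λ y → y <ᵇ x) ys)

-- The inversions of `xs ++ ys` with one letter in each part. Their number is unchanged when either
-- part is permuted.
cross : List ℕ → List ℕ → ℕ
cross []       ys = 0
cross (x ∷ xs) ys = less x ys + cross xs ys

less-∷ : ∀ x y ys → less x (y ∷ ys) ≡ less x [ y ] + less x ys
less-∷ x y ys with y <ᵇ x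
... | true  = refl
... | false = refl

less-++ : ∀ x ys zs → less x (ys ++ zs) ≡ less x ys + less x zs
less-++ x [] zs = refl
less-++ x (y ∷ ys) zs with y <ᵇ x
... | true  = cong suc (less-++ x ys zs)
... | false = less-++ x ys zs

less-↭ : ∀ x {ys zs} → ys ↭ zs → less x ys ≡ less x zs
less-↭ x p = ↭-length (Permₚ.filter-↭ (T? ∘ (λ y → y <ᵇ x)) p)

cross-↭ʳ : ∀ xs {ys zs} → ys ↭ zs → cross xs ys ≡ cross xs zs
cross-↭ʳ [] p = refl
cross-↭ʳ (x ∷ xs) p = cong₂ _+_ (less-↭ x p) (cross-↭ʳ xs p)

private
  swap-+ℕ : ∀ a b c → a + (b + c) ≡ b + (a + c)
  swap-+ℕ a b c = trans (sym (+-assoc a b c)) (trans (cong (_+ c) (+-comm a b)) (+-assoc b a c))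

cross-↭ˡ : ∀ {xs ys} zs → xs ↭ ys → cross xs zs ≡ cross ys zs
cross-↭ˡ zs Perm.refl = refl
cross-↭ˡ zs (Perm.prep x p) = cong (_+_ (less x zs)) (cross-↭ˡ zs p)
cross-↭ˡ zs (Perm.swap x y p) = trans (cong (λ k → less x zs + (less y zs + k)) (cross-↭ˡ zs p))
    (swap-+ℕ (less x zs) (less y zs) _)
cross-↭ˡ zs (Perm.trans p q) = trans (cross-↭ˡ zs p) (cross-↭ˡ zs q)

inversions-++ : ∀ xs ys → inversions (xs ++ ys) ≡ inversions xs + (cross xs ys + inversions ys)
inversions-++ [] ys = refl
inversions-++ (x ∷ xs) ys rewrite less-++ x xs ys | inversions-++ xs ys =
  shuffle (less x xs) (less x ys) (inversions xs) (cross xs ys) (inversions ys)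
  where
  shuffle : ∀ a b c d e → a + b + (c + (d + e)) ≡ a + c + (b + d + e)
  shuffle = NatSolver.solve-∀

listSign : List ℕ → ℤ
listSign xs = minusOnePow (inversions xs)

listSign-∷ : ∀ x xs → listSign (x ∷ xs) ≡ minusOnePow (less x xs) ℤ.* listSign xs
listSign-∷ x xs = minusOnePow-+ (less x xs) (inversions xs)

listSign-square : ∀ xs → listSign xs ℤ.* listSign xs ≡ + 1
listSign-square xs = trans (sym (minusOnePow-+ (inversions xs) (inversions xs))) (minusOnePow-double (inversions xs))

less-less : ∀ {x y} → x ≢ y → less x [ y ] + less y [ x ] ≡ 1
less-less {x} {y} x≢y with y <ᵇ x in e₁ | x <ᵇ y in e₂
... | true  | true  = contradiction (<ᵇ⇒< x y (≡⇒T e₂)) (<-asym (<ᵇ⇒< y x (≡⇒T e₁)))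
... | true  | false = refl
... | false | true  = refl
... | false | false = contradiction (≤-antisym
    (≮⇒≥ λ p → subst T e₁ (<⇒<ᵇ p)) (≮⇒≥ λ p → subst T e₂ (<⇒<ᵇ p))) x≢y

flip-sign : ∀ {a b} → a + b ≡ 1 → minusOnePow a ≡ ℤ.- minusOnePow b
flip-sign {zero}        {suc zero} refl = refl
flip-sign {suc zero}    {zero}     refl = refl

-- Exactly one of the two orders of x and y is an inversion, and the letters of `zs` see x and y
-- only through counts that do not depend on their order.
listSign-swap : ∀ {x y} zs → x ≢ y → listSign (x ∷ y ∷ zs) ≡ ℤ.- listSign (y ∷ x ∷ zs)
listSign-swap {x} {y} zs x≢y = begin
  listSign (x ∷ y ∷ zs)  ≡⟨ expand x y ⟩
  s x [ y ] ℤ.* (s x zs ℤ.* (s y zs ℤ.* listSign zs))  ≡⟨ cong (ℤ._* (s x zs ℤ.* (s y zs ℤ.* listSign zs)))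
      (flip-sign {less x [ y ]} {less y [ x ]} (less-less x≢y)) ⟩
  (ℤ.- s y [ x ]) ℤ.* (s x zs ℤ.* (s y zs ℤ.* listSign zs))  ≡⟨ arith (s y [ x ]) (s x zs) (s y zs) (listSign zs) ⟩
  ℤ.- (s y [ x ] ℤ.* (s y zs ℤ.* (s x zs ℤ.* listSign zs)))  ≡⟨ cong ℤ.-_ (expand y x) ⟨
  ℤ.- listSign (y ∷ x ∷ zs) ∎
  where
  open ≡-Reasoning
  s : ℕ → List ℕ → ℤ
  s x ys = minusOnePow (less x ys)
  arith : ∀ a b c d → (ℤ.- a) ℤ.* (b ℤ.* (c ℤ.* d)) ≡ ℤ.- (a ℤ.* (c ℤ.* (b ℤ.* d)))
  arith = solve-∀
  expand : ∀ x y → listSign (x ∷ y ∷ zs) ≡ s x [ y ] ℤ.* (s x zs ℤ.* (s y zs ℤ.* listSign zs))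
  expand x y = begin
    listSign (x ∷ y ∷ zs)  ≡⟨ listSign-∷ x (y ∷ zs) ⟩
    s x (y ∷ zs) ℤ.* listSign (y ∷ zs)  ≡⟨ cong₂ ℤ._*_ (trans (cong minusOnePow (less-∷ x y zs))
        (minusOnePow-+ (less x [ y ]) (less x zs))) (listSign-∷ y zs) ⟩
    s x [ y ] ℤ.* s x zs ℤ.* (s y zs ℤ.* listSign zs)  ≡⟨ ℤₚ.*-assoc (s x [ y ]) (s x zs) _ ⟩
    s x [ y ] ℤ.* (s x zs ℤ.* (s y zs ℤ.* listSign zs)) ∎

-- The sign of f as a bijection from the set L onto its image, independent of the order of L.
relSign : (ℕ → ℕ) → List ℕ → ℤ
relSign f L = listSign (map f L) ℤ.* listSign L

-- The factor that x adds counts smaller letters in the rest, which depends on the rest only up to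
-- permutation.
relSign-prep : ∀ f x {xs ys} → xs ↭ ys → relSign f xs ≡ relSign f ys → relSign f (x ∷ xs) ≡ relSign f (x ∷ ys)
relSign-prep f x {xs} {ys} p e = begin
  relSign f (x ∷ xs)  ≡⟨ expand xs ⟩
  minusOnePow (less (f x) (map f xs)) ℤ.* minusOnePow (less x xs) ℤ.* relSign f xs
    ≡⟨ cong₂ ℤ._*_ (cong₂ (λ a b → minusOnePow a ℤ.* minusOnePow b) (less-↭ (f x) (Permₚ.map⁺ f p)) (less-↭ x p)) e ⟩
  minusOnePow (less (f x) (map f ys)) ℤ.* minusOnePow (less x ys) ℤ.* relSign f ys ≡⟨ expand ys ⟨
  relSign f (x ∷ ys) ∎
  where
  open ≡-Reasoning
  expand : ∀ xs → relSign f (x ∷ xs) ≡ minusOnePow (less (f x) (map f xs)) ℤ.* minusOnePow (less x xs) ℤ.* relSign f xs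
  expand xs = trans (cong₂ ℤ._*_ (listSign-∷ (f x) (map f xs)) (listSign-∷ x xs))
    (inter-* (minusOnePow (less (f x) (map f xs))) (listSign (map f xs)) (minusOnePow (less x xs)) (listSign xs))

-- Exchanging two neighbours negates the sign of the listing and the sign of the listed images
-- alike, provided that both the letters and their images differ.
relSign-↭ : ∀ f {L L′} → Unique L → Unique (map f L) → L ↭ L′ → relSign f L ≡ relSign f L′
relSign-↭ f u v Perm.refl = refl
relSign-↭ f (_ ∷ u) (_ ∷ v) (Perm.prep x p) = relSign-prep f x p (relSign-↭ f u v p)
relSign-↭ f {x ∷ y ∷ xs} {.y ∷ .x ∷ ys} ((x≢y ∷ _) ∷ _ ∷ u) ((fx≢fy ∷ _) ∷ _ ∷ v) (Perm.swap .x .y p) = begin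
  relSign f (x ∷ y ∷ xs) ≡⟨ relSign-prep f x (Perm.prep y p) (relSign-prep f y p (relSign-↭ f u v p)) ⟩
  relSign f (x ∷ y ∷ ys) ≡⟨ cong₂ ℤ._*_ (listSign-swap (map f ys) fx≢fy) (listSign-swap ys x≢y) ⟩
  (ℤ.- listSign (f y ∷ f x ∷ map f ys)) ℤ.* (ℤ.- listSign (y ∷ x ∷ ys))
    ≡⟨ arith (listSign (f y ∷ f x ∷ map f ys)) (listSign (y ∷ x ∷ ys)) ⟩
  relSign f (y ∷ x ∷ ys) ∎
  where
  open ≡-Reasoning
  arith : ∀ a b → (ℤ.- a) ℤ.* (ℤ.- b) ≡ a ℤ.* b
  arith = solve-∀
relSign-↭ f u v (Perm.trans p q) =
  trans (relSign-↭ f u v p) (relSign-↭ f (Unique-↭ p u) (Unique-↭ (Permₚ.map⁺ f p) v) q)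

listSign-++ : ∀ xs ys → listSign (xs ++ ys) ≡ minusOnePow (cross xs ys) ℤ.* (listSign xs ℤ.* listSign ys)
listSign-++ xs ys = begin
  listSign (xs ++ ys) ≡⟨ cong minusOnePow (inversions-++ xs ys) ⟩
  minusOnePow (inversions xs + (cross xs ys + inversions ys)) ≡⟨ minusOnePow-+ (inversions xs) _ ⟩
  listSign xs ℤ.* minusOnePow (cross xs ys + inversions ys) ≡⟨ cong (listSign xs ℤ.*_) (minusOnePow-+ (cross xs ys) _) ⟩
  listSign xs ℤ.* (minusOnePow (cross xs ys) ℤ.* listSign ys) ≡⟨ swap-* (listSign xs) (minusOnePow (cross xs ys))
      (listSign ys) ⟩
  minusOnePow (cross xs ys) ℤ.* (listSign xs ℤ.* listSign ys) ∎
  where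
  open ≡-Reasoning

-- As f permutes each part, the images have as many inversions across the two parts as the letters
-- themselves, and these contributions multiply to a square.
relSign-++ : ∀ f {xs ys} → map f xs ↭ xs → map f ys ↭ ys →
  relSign f (xs ++ ys) ≡ relSign f xs ℤ.* relSign f ys
relSign-++ f {xs} {ys} p q = begin
  listSign (map f (xs ++ ys)) ℤ.* listSign (xs ++ ys)
    ≡⟨ cong (λ l → listSign l ℤ.* listSign (xs ++ ys)) (map-++ f xs ys) ⟩
  listSign (map f xs ++ map f ys) ℤ.* listSign (xs ++ ys)
    ≡⟨ cong₂ ℤ._*_ (listSign-++ (map f xs) (map f ys)) (listSign-++ xs ys) ⟩
  (minusOnePow (cross (map f xs) (map f ys)) ℤ.* (a′ ℤ.* b′)) ℤ.* (c ℤ.* (a ℤ.* b))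
    ≡⟨ cong (λ k → (minusOnePow k ℤ.* (a′ ℤ.* b′)) ℤ.* (c ℤ.* (a ℤ.* b))) (trans (cross-↭ˡ (map f ys) p)
        (cross-↭ʳ xs q)) ⟩
  (c ℤ.* (a′ ℤ.* b′)) ℤ.* (c ℤ.* (a ℤ.* b)) ≡⟨ arith a a′ b b′ c ⟩
  (c ℤ.* c) ℤ.* ((a′ ℤ.* a) ℤ.* (b′ ℤ.* b))
    ≡⟨ cong (ℤ._* ((a′ ℤ.* a) ℤ.* (b′ ℤ.* b))) (trans (sym (minusOnePow-+ (cross xs ys) (cross xs ys)))
        (minusOnePow-double (cross xs ys))) ⟩
  + 1 ℤ.* ((a′ ℤ.* a) ℤ.* (b′ ℤ.* b)) ≡⟨ *-identityˡ _ ⟩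
  relSign f xs ℤ.* relSign f ys ∎
  where
  open ≡-Reasoning
  a a′ b b′ c : ℤ
  a = listSign xs
  a′ = listSign (map f xs)
  b = listSign ys
  b′ = listSign (map f ys)
  c = minusOnePow (cross xs ys)
  arith : ∀ a a′ b b′ c → (c ℤ.* (a′ ℤ.* b′)) ℤ.* (c ℤ.* (a ℤ.* b)) ≡ (c ℤ.* c) ℤ.* ((a′ ℤ.* a) ℤ.* (b′ ℤ.* b))
  arith = solve-∀

-- Every letter of `ys` forms an inversion with x either when x stands in front or when x stands
-- behind, never both. The sum is the exponent in the sign of a rotation.
less-cross : ∀ {x} ys → x ∉ ys → less x ys + cross ys [ x ] ≡ length ys
less-cross [] _ = refl
less-cross {x} (y ∷ ys) x∉ = begin
  less x (y ∷ ys) + (less y [ x ] + cross ys [ x ])        ≡⟨ cong (_+ (less y [ x ] + cross ys [ x ]))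
      (less-∷ x y ys) ⟩
  (less x [ y ] + less x ys) + (less y [ x ] + cross ys [ x ]) ≡⟨ inter-+ℕ (less x [ y ]) _ _ _ ⟩
  (less x [ y ] + less y [ x ]) + (less x ys + cross ys [ x ]) ≡⟨ cong₂ _+_ (less-less (x∉ ∘ here))
      (less-cross ys (x∉ ∘ there)) ⟩
  suc (length ys) ∎
  where
  open ≡-Reasoning

-- Cycles

-- The end d is kept apart from the start c so that the tail of a chain is again a chain; a cycle is
-- the case d = c.
data Chain (f : ℕ → ℕ) (d : ℕ) : ℕ → List ℕ → Set where
  end  : ∀ {c} → f c ≡ d → Chain f d c []
  step : ∀ {c e cs} → f c ≡ e → Chain f d e cs → Chain f d c (e ∷ cs)

data Cycle (f : ℕ → ℕ) : List ℕ → Set where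
  cycle : ∀ {c cs} → Chain f c c cs → Cycle f (c ∷ cs)

map-chain : ∀ {f d c cs} → Chain f d c cs → map f (c ∷ cs) ≡ cs ++ [ d ]
map-chain (end e) = cong [_] e
map-chain (step e ch) = cong₂ _∷_ e (map-chain ch)

cycle-↭ : ∀ {f L} → Cycle f L → map f L ↭ L
cycle-↭ {f} (cycle {c} {cs} ch) rewrite map-chain ch = ↭-sym (Permₚ.∷↭∷ʳ c cs)

-- Listed in cyclic order, the images are the rotated list. The inversions within `cs` occur in both
-- listings and cancel, so only those involving c remain.
relSign-cycle : ∀ {f L} → Unique L → Cycle f L → relSign f L ≡ minusOnePow (length L ∸ 1)
relSign-cycle {f} u (cycle {c} {cs} ch) = begin
  listSign (map f (c ∷ cs)) ℤ.* listSign (c ∷ cs) ≡⟨ cong (λ l → listSign l ℤ.* listSign (c ∷ cs)) (map-chain ch) ⟩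
  listSign (cs ++ [ c ]) ℤ.* listSign (c ∷ cs) ≡⟨ cong₂ ℤ._*_ (listSign-++ cs [ c ]) (listSign-∷ c cs) ⟩
  (y ℤ.* (listSign cs ℤ.* + 1)) ℤ.* (x ℤ.* listSign cs) ≡⟨ arith x y (listSign cs) ⟩
  (listSign cs ℤ.* listSign cs) ℤ.* (x ℤ.* y) ≡⟨ cong₂ ℤ._*_ (listSign-square cs)
      (sym (minusOnePow-+ (less c cs) (cross cs [ c ]))) ⟩
  + 1 ℤ.* minusOnePow (less c cs + cross cs [ c ]) ≡⟨ *-identityˡ _ ⟩
  minusOnePow (less c cs + cross cs [ c ]) ≡⟨ cong minusOnePow (less-cross cs (Unique-head u)) ⟩
  minusOnePow (length cs) ∎
  where
  open ≡-Reasoning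
  x y : ℤ
  x = minusOnePow (less c cs)
  y = minusOnePow (cross cs [ c ])
  arith : ∀ x y z → (y ℤ.* (z ℤ.* + 1)) ℤ.* (x ℤ.* z) ≡ (z ℤ.* z) ℤ.* (x ℤ.* y)
  arith = solve-∀

chain-closed : ∀ {f d c cs} {P : ℕ → Set} → Chain f d c cs → (∀ {i} → i ∈ c ∷ cs → P i → P (f i)) →
  P c → (∀ {i} → i ∈ c ∷ cs → P i) × P d
chain-closed {P = P} (end e) cl pc = (λ { (here refl) → pc }) , subst P e (cl (here refl) pc)
chain-closed {P = P} (step e ch) cl pc with chain-closed {P = P} ch (cl ∘ there) (subst P e (cl (here refl) pc))
... | q , r = (λ { (here refl) → pc ; (there i∈) → q i∈ }) , r

chain-tail : ∀ {f d c cs} {P : ℕ → Set} → Chain f d c cs → (∀ {i} → i ∈ c ∷ cs → P i → P (f i)) →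
  ∀ {a} → a ∈ c ∷ cs → P a → P d
chain-tail {P = P} ch cl (here refl) pa = proj₂ (chain-closed {P = P} ch cl pa)
chain-tail {P = P} (step e ch) cl (there a∈) pa = chain-tail {P = P} ch (cl ∘ there) a∈ pa

-- From a the property travels to the end of the chain, which is its starting point, and from there
-- through the whole cycle.
cycle-closed : ∀ {f L} {P : ℕ → Set} → Cycle f L → (∀ {i} → i ∈ L → P i → P (f i)) →
  ∀ {a} → a ∈ L → P a → ∀ {i} → i ∈ L → P i
cycle-closed {P = P} (cycle ch) cl a∈ pa = proj₁ (chain-closed {P = P} ch cl (chain-tail {P = P} ch cl a∈ pa))

-- Sums over subsets

sublists-⊆ : ∀ {L I : List A} → I ∈ sublists L → ∀ {x} → x ∈ I → x ∈ L
sublists-⊆ {L = []} (here refl) x∈ = x∈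
sublists-⊆ {L = y ∷ L} I∈ x∈ with ∈-++⁻ (sublists L) I∈
... | inj₁ I∈ = there (sublists-⊆ I∈ x∈)
... | inj₂ I∈ with ∈-map⁻ (y ∷_) I∈
...   | J , J∈ , refl with x∈
...     | here e   = here e
...     | there x∈ = there (sublists-⊆ J∈ x∈)

sublists-AllPairs : ∀ {R : A → A → Set} {L I} → I ∈ sublists L → AllPairs R L → AllPairs R I
sublists-AllPairs {L = []} (here refl) u = u
sublists-AllPairs {L = y ∷ L} I∈ (y∉ ∷ u) with ∈-++⁻ (sublists L) I∈
... | inj₁ I∈ = sublists-AllPairs I∈ u
... | inj₂ I∈ with ∈-map⁻ (y ∷_) I∈
...   | J , J∈ , refl = All.tabulate (λ x∈ → All.lookup y∉ (sublists-⊆ J∈ x∈)) ∷ sublists-AllPairs J∈ u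

∑-sublists-∷ : ∀ (x : A) xs Φ → ∑ (sublists (x ∷ xs)) Φ ≡ ∑ (sublists xs) Φ ℤ.+ ∑ (sublists xs) (Φ ∘ (x ∷_))
∑-sublists-∷ x xs Φ = trans (∑-++ (sublists xs) Φ) (cong (ℤ._+_ (∑ (sublists xs) Φ)) (∑-map (x ∷_) (sublists xs) Φ))

∑-sublists-++ : ∀ (xs ys : List A) Φ →
  ∑ (sublists (xs ++ ys)) Φ ≡ ∑ (sublists xs) (λ I → ∑ (sublists ys) (λ J → Φ (I ++ J)))
∑-sublists-++ [] ys Φ = sym (ℤₚ.+-identityʳ _)
∑-sublists-++ (x ∷ xs) ys Φ = begin
  ∑ (sublists (x ∷ xs ++ ys)) Φ ≡⟨ ∑-sublists-∷ x (xs ++ ys) Φ ⟩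
  ∑ (sublists (xs ++ ys)) Φ ℤ.+ ∑ (sublists (xs ++ ys)) (Φ ∘ (x ∷_))
    ≡⟨ cong₂ ℤ._+_ (∑-sublists-++ xs ys Φ) (∑-sublists-++ xs ys (Φ ∘ (x ∷_))) ⟩
  _ ≡⟨ ∑-sublists-∷ x xs (λ I → ∑ (sublists ys) (λ J → Φ (I ++ J))) ⟨
  ∑ (sublists (x ∷ xs)) (λ I → ∑ (sublists ys) (λ J → Φ (I ++ J))) ∎
  where open ≡-Reasoning

-- Invariance is asked for on duplicate-free lists only, since signs are independent of the listing
-- only there.
SetFunction : List A → (List A → ℤ) → Set
SetFunction L Φ = ∀ {I J} → (∀ {x} → x ∈ I → x ∈ L) → Unique I → I ↭ J → Φ I ≡ Φ J

setFunction-tail : ∀ {x : A} {L Φ} → SetFunction (x ∷ L) Φ → SetFunction L Φ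
setFunction-tail h sub = h (there ∘ sub)

setFunction-∷ : ∀ {x : A} {L Φ} → x ∉ L → SetFunction (x ∷ L) Φ → SetFunction L (Φ ∘ (x ∷_))
setFunction-∷ {x = x} x∉ h sub u p =
  h (λ { (here e) → here e ; (there y∈) → there (sub y∈) }) (∷-Unique (x∉ ∘ sub) u) (Perm.prep x p)

-- This is what allows the increasing enumeration of subsets to be replaced by one that lists the
-- cycles one after another, each in cyclic order.
∑-sublists-↭ : ∀ {L L′ : List A} {Φ} → Unique L → SetFunction L Φ → L ↭ L′ →
  ∑ (sublists L) Φ ≡ ∑ (sublists L′) Φ
∑-sublists-↭ u h Perm.refl = refl
∑-sublists-↭ {Φ = Φ} u@(_ ∷ u′) h (Perm.prep {xs = xs} {ys = ys} x p) = begin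
  ∑ (sublists (x ∷ xs)) Φ ≡⟨ ∑-sublists-∷ x xs Φ ⟩
  ∑ (sublists xs) Φ ℤ.+ ∑ (sublists xs) (Φ ∘ (x ∷_))
    ≡⟨ cong₂ ℤ._+_ (∑-sublists-↭ u′ (setFunction-tail h) p) (∑-sublists-↭ u′ (setFunction-∷ (Unique-head u) h) p) ⟩
  ∑ (sublists ys) Φ ℤ.+ ∑ (sublists ys) (Φ ∘ (x ∷_)) ≡⟨ ∑-sublists-∷ x ys Φ ⟨
  ∑ (sublists (x ∷ ys)) Φ ∎
  where open ≡-Reasoning
∑-sublists-↭ {Φ = Φ} u@((x≢y ∷ _) ∷ v@(_ ∷ u′)) h (Perm.swap {xs = xs} {ys = ys} x y p) = begin
  ∑ (sublists (x ∷ y ∷ xs)) Φ ≡⟨ expand x y xs ⟩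
  (S xs Φ ℤ.+ S xs (Φ ∘ (y ∷_))) ℤ.+ (S xs (Φ ∘ (x ∷_)) ℤ.+ S xs (Φ ∘ (x ∷_) ∘ (y ∷_)))
    ≡⟨ cong₂ ℤ._+_
         (cong₂ ℤ._+_ (∑-sublists-↭ u′ (setFunction-tail (setFunction-tail h)) p)
             (∑-sublists-↭ u′ (setFunction-∷ y∉ (setFunction-tail h)) p))
         (cong₂ ℤ._+_ (∑-sublists-↭ u′ (setFunction-tail hx) p) (∑-sublists-↭ u′ (setFunction-∷ y∉ hx) p)) ⟩
  (S ys Φ ℤ.+ S ys (Φ ∘ (y ∷_))) ℤ.+ (S ys (Φ ∘ (x ∷_)) ℤ.+ S ys (Φ ∘ (x ∷_) ∘ (y ∷_)))
    -- Only subsets containing both x and y notice the exchange; for them the set-function property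
    -- reorders the first two letters.
    ≡⟨ cong (λ z → (S ys Φ ℤ.+ S ys (Φ ∘ (y ∷_))) ℤ.+ (S ys (Φ ∘ (x ∷_)) ℤ.+ z)) (∑-cong (sublists ys) xy) ⟩
  (S ys Φ ℤ.+ S ys (Φ ∘ (y ∷_))) ℤ.+ (S ys (Φ ∘ (x ∷_)) ℤ.+ S ys (Φ ∘ (y ∷_) ∘ (x ∷_)))
    ≡⟨ inter-+ (S ys Φ) (S ys (Φ ∘ (y ∷_))) (S ys (Φ ∘ (x ∷_))) (S ys (Φ ∘ (y ∷_) ∘ (x ∷_))) ⟩
  (S ys Φ ℤ.+ S ys (Φ ∘ (x ∷_))) ℤ.+ (S ys (Φ ∘ (y ∷_)) ℤ.+ S ys (Φ ∘ (y ∷_) ∘ (x ∷_))) ≡⟨ expand y x ys ⟨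
  ∑ (sublists (y ∷ x ∷ ys)) Φ ∎
  where
  open ≡-Reasoning
  S : List _ → (List _ → ℤ) → ℤ
  S xs Φ = ∑ (sublists xs) Φ
  y∉ : y ∉ xs
  y∉ = Unique-head v
  hx : SetFunction (y ∷ xs) (Φ ∘ (x ∷_))
  hx = setFunction-∷ (Unique-head u) h
  expand : ∀ x y xs → S (x ∷ y ∷ xs) Φ ≡ (S xs Φ ℤ.+ S xs (Φ ∘ (y ∷_))) ℤ.+ (S xs (Φ ∘ (x ∷_)) ℤ.+ S xs
      (Φ ∘ (x ∷_) ∘ (y ∷_)))
  expand x y xs = trans (∑-sublists-∷ x (y ∷ xs) Φ) (cong₂ ℤ._+_ (∑-sublists-∷ y xs Φ) (∑-sublists-∷ y xs (Φ ∘ (x ∷_))))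
  xy : ∀ {I} → I ∈ sublists ys → Φ (x ∷ y ∷ I) ≡ Φ (y ∷ x ∷ I)
  xy {I} I∈ = h sub (∷-Unique x∉ (∷-Unique (y∉ ∘ I⊆) (sublists-AllPairs I∈ (Unique-↭ p u′)))) (Perm.swap x y Perm.refl)
    where
    I⊆ : ∀ {z} → z ∈ I → z ∈ xs
    I⊆ z∈ = ∈-resp-↭ (↭-sym p) (sublists-⊆ I∈ z∈)
    sub : ∀ {z} → z ∈ x ∷ y ∷ I → z ∈ x ∷ y ∷ xs
    sub (here e) = here e
    sub (there (here e)) = there (here e)
    sub (there (there z∈)) = there (there (I⊆ z∈))
    x∉ : x ∉ y ∷ I
    x∉ (here e) = x≢y e
    x∉ (there z∈) = Unique-head u (there (I⊆ z∈))
∑-sublists-↭ {L = L} u h (Perm.trans p q) = trans (∑-sublists-↭ u h p)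
  (∑-sublists-↭ (Unique-↭ p u)
    (λ sub v r → h (λ x∈ → ∈-resp-↭ (↭-sym p) (sub x∈)) v r) q)

-- Together with `∑-sublists-full` this leaves just the empty and the full subset of a cycle,
-- according to whether its first element is chosen.
∑-sublists-[] : ∀ (xs : List A) (Φ : List A → ℤ) →
  (∀ {a I} → a ∷ I ∈ sublists xs → Φ (a ∷ I) ≡ + 0) → ∑ (sublists xs) Φ ≡ Φ []
∑-sublists-[] [] Φ h = ℤₚ.+-identityʳ _
∑-sublists-[] (x ∷ xs) Φ h = begin
  ∑ (sublists (x ∷ xs)) Φ ≡⟨ ∑-sublists-∷ x xs Φ ⟩
  ∑ (sublists xs) Φ ℤ.+ ∑ (sublists xs) (Φ ∘ (x ∷_))
    ≡⟨ cong₂ ℤ._+_ (∑-sublists-[] xs Φ (h ∘ ∈-++⁺ˡ))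
        (∑-0 (sublists xs) (λ I∈ → h (∈-++⁺ʳ (sublists xs) (∈-map⁺ (x ∷_) I∈)))) ⟩
  Φ [] ℤ.+ + 0 ≡⟨ ℤₚ.+-identityʳ _ ⟩
  Φ [] ∎
  where open ≡-Reasoning

∑-sublists-full : ∀ {xs : List A} (Φ : List A → ℤ) → Unique xs →
  (∀ {x I} → I ∈ sublists xs → x ∈ xs → x ∉ I → Φ I ≡ + 0) → ∑ (sublists xs) Φ ≡ Φ xs
∑-sublists-full {xs = []} Φ u h = ℤₚ.+-identityʳ _
∑-sublists-full {xs = x ∷ xs} Φ u@(_ ∷ u′) h = begin
  ∑ (sublists (x ∷ xs)) Φ ≡⟨ ∑-sublists-∷ x xs Φ ⟩
  ∑ (sublists xs) Φ ℤ.+ ∑ (sublists xs) (Φ ∘ (x ∷_))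
    ≡⟨ cong₂ ℤ._+_
         (∑-0 (sublists xs) (λ I∈ → h (∈-++⁺ˡ I∈) (here refl) (Unique-head u ∘ sublists-⊆ I∈)))
         (∑-sublists-full (Φ ∘ (x ∷_)) u′ λ I∈ y∈ y∉ →
            h (∈-++⁺ʳ (sublists xs) (∈-map⁺ (x ∷_) I∈)) (there y∈)
              λ { (here refl) → Unique-head u y∈ ; (there y∈′) → y∉ y∈′ }) ⟩
  + 0 ℤ.+ Φ (x ∷ xs) ≡⟨ +-identityˡ _ ⟩
  Φ (x ∷ xs) ∎
  where open ≡-Reasoning

-- Traces on the exterior algebra

stable : (ℕ → ℕ) → List ℕ → Bool
stable f I = all (λ i → elemᵇ (f i) I) I ∧ all (λ i → any (λ j → f j ≡ᵇ i) I) I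

record Stable (f : ℕ → ℕ) (I : List ℕ) : Set where
  constructor mkStable
  field
    into : ∀ {i} → i ∈ I → f i ∈ I
    onto : ∀ {i} → i ∈ I → ∃ λ j → j ∈ I × f j ≡ i

open Stable

stable-⁻ : ∀ f I → T (stable f I) → Stable f I
stable-⁻ f I t with ∧-⁻ {all (λ i → elemᵇ (f i) I) I} t
... | t₁ , t₂ = mkStable
  (λ i∈ → elem-⁻ I (all-⁻ (λ i → elemᵇ (f i) I) I t₁ i∈))
  (λ {i} i∈ → let j , j∈ , e = any-⁻ (λ j → f j ≡ᵇ i) I (all-⁻ (λ i → any (λ j → f j ≡ᵇ i) I) I t₂ i∈)
              in j , j∈ , ≡ᵇ⇒≡ _ _ e)

stable-⁺ : ∀ f I → Stable f I → T (stable f I)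
stable-⁺ f I s = ∧-⁺ (all-⁺ (λ i → elemᵇ (f i) I) I (elem-⁺ ∘ into s))
  (all-⁺ (λ i → any (λ j → f j ≡ᵇ i) I) I (λ {i} i∈ → let j , j∈ , e = onto s i∈ in any-⁺ (λ j → f j ≡ᵇ i) j∈ (≡⇒≡ᵇ _ _ e)))

stable-ext : ∀ f {I J} → (Stable f I → Stable f J) → (Stable f J → Stable f I) → stable f I ≡ stable f J
stable-ext f {I} {J} p q = T-ext (stable-⁺ f J ∘ p ∘ stable-⁻ f I) (stable-⁺ f I ∘ q ∘ stable-⁻ f J)

Stable-↭ : ∀ {f I J} → I ↭ J → Stable f I → Stable f J
Stable-↭ p s = mkStable
  (∈-resp-↭ p ∘ into s ∘ ∈-resp-↭ (↭-sym p))
  (λ i∈ → let j , j∈ , e = onto s (∈-resp-↭ (↭-sym p) i∈) in j , ∈-resp-↭ p j∈ , e)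

stable⇒↭ : ∀ {f I} → Unique I → Stable f I → I ↭ map f I
stable⇒↭ {f} {I} u s = unique-⊆-↭ u
  (λ i∈ → let j , j∈ , e = onto s i∈ in subst (_∈ map f I) e (∈-map⁺ f j∈))
  (≤-reflexive (length-map f I))

cycle-stable : ∀ {f L} → Cycle f L → Stable f L
cycle-stable {f} {L} c = mkStable
  (∈-resp-↭ (cycle-↭ c) ∘ ∈-map⁺ f)
  (λ i∈ → let j , j∈ , e = ∈-map⁻ f (∈-resp-↭ (↭-sym (cycle-↭ c)) i∈) in j , j∈ , sym e)

-- The diagonal coefficient of e_I, written so that it does not require I to be increasing.
coeff : (ℕ → ℕ) → (ℕ → ℤ) → List ℕ → ℤ
coeff f s I = if stable f I then ∏ I s ℤ.* relSign f I else + 0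

coeff-↭ : ∀ f s {I J} → Unique I → I ↭ J → coeff f s I ≡ coeff f s J
coeff-↭ f s {I} {J} u p rewrite sym (stable-ext f {I} {J} (Stable-↭ p) (Stable-↭ (↭-sym p)))
  with stable f I in e
... | false = refl
... | true  = cong₂ ℤ._*_ (∏-↭ s p)
  (relSign-↭ f u (Unique-↭ (stable⇒↭ u (stable-⁻ f I (≡⇒T e))) u) p)

coeff-unstable : ∀ f s {I} → ¬ T (stable f I) → coeff f s I ≡ + 0
coeff-unstable f s {I} h rewrite ¬T⇒≡ h = refl

cycleFactor : (ℕ → ℤ) → List ℕ → ℤ
cycleFactor s L = ∏ L s ℤ.* minusOnePow (length L ∸ 1)

stable-cycle-++ : ∀ f {L I} → Unique (L ++ I) → Cycle f L → (∀ {i} → i ∈ I → f i ∉ L) →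
  stable f (L ++ I) ≡ stable f I
stable-cycle-++ f {L} {I} u c out = stable-ext f restrict extend
  where
  d : ∀ {x} → x ∈ L → x ∉ I
  d = proj₂ (proj₂ (Unique-++⁻ L u))
  restrict : Stable f (L ++ I) → Stable f I
  restrict st = mkStable
    (λ i∈ → [ (λ b → contradiction b (out i∈)) , id ]′ (∈-++⁻ L (into st (∈-++⁺ʳ L i∈))))
    (λ {i} i∈ → let j , j∈ , e = onto st (∈-++⁺ʳ L i∈) in
       j , [ (λ j∈L → contradiction i∈ (d (subst (_∈ L) e (into (cycle-stable c) j∈L)))) , id ]′ (∈-++⁻ L j∈) , e)
  extend : Stable f I → Stable f (L ++ I)
  extend st = mkStable
    (λ i∈ → [ ∈-++⁺ˡ ∘ into (cycle-stable c) , ∈-++⁺ʳ L ∘ into st ]′ (∈-++⁻ L i∈))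
    (λ i∈ → [ (λ i∈ → let j , j∈ , e = onto (cycle-stable c) i∈ in j , ∈-++⁺ˡ j∈ , e)
             , (λ i∈ → let j , j∈ , e = onto st i∈ in j , ∈-++⁺ʳ L j∈ , e) ]′ (∈-++⁻ L i∈))

coeff-cycle-++ : ∀ f s {L I} → Unique (L ++ I) → Cycle f L → (∀ {i} → i ∈ I → f i ∉ L) →
  coeff f s (L ++ I) ≡ cycleFactor s L ℤ.* coeff f s I
coeff-cycle-++ f s {L} {I} u c out
  rewrite stable-cycle-++ f u c out
  with stable f I in e
... | false = sym (*-zeroʳ (cycleFactor s L))
... | true  = begin
  ∏ (L ++ I) s ℤ.* relSign f (L ++ I)
    ≡⟨ cong₂ ℤ._*_ (∏-++ L s) (relSign-++ f (cycle-↭ c) (↭-sym (stable⇒↭ uI (stable-⁻ f I (≡⇒T e))))) ⟩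
  (∏ L s ℤ.* ∏ I s) ℤ.* (relSign f L ℤ.* relSign f I)
    ≡⟨ cong (λ z → (∏ L s ℤ.* ∏ I s) ℤ.* (z ℤ.* relSign f I)) (relSign-cycle uL c) ⟩
  (∏ L s ℤ.* ∏ I s) ℤ.* (minusOnePow (length L ∸ 1) ℤ.* relSign f I)
    ≡⟨ inter-* (∏ L s) (∏ I s) (minusOnePow (length L ∸ 1)) (relSign f I) ⟩
  cycleFactor s L ℤ.* (∏ I s ℤ.* relSign f I) ∎
  where
  open ≡-Reasoning
  uL : Unique L
  uL = proj₁ (Unique-++⁻ L u)
  uI : Unique I
  uI = proj₁ (proj₂ (Unique-++⁻ L u))

-- A subset splits into its parts in L and in R, and stability forces the part in L to be empty or
-- all of L. The two cases give the summands 1 and `cycleFactor s L`.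
∑-coeff-cycle : ∀ f s {L R} → Unique (L ++ R) → Cycle f L → (∀ {i} → i ∈ R → f i ∈ R) →
  ∑ (sublists (L ++ R)) (coeff f s) ≡ (+ 1 ℤ.+ cycleFactor s L) ℤ.* ∑ (sublists R) (coeff f s)
∑-coeff-cycle f s {L} {R} u c@(cycle {x} {xs} _) closed = begin
  ∑ (sublists (L ++ R)) (coeff f s) ≡⟨ ∑-sublists-++ L R (coeff f s) ⟩
  ∑ (sublists L) φ ≡⟨ ∑-sublists-∷ x xs φ ⟩
  ∑ (sublists xs) φ ℤ.+ ∑ (sublists xs) (φ ∘ (x ∷_)) ≡⟨ cong₂ ℤ._+_ (∑-sublists-[] xs φ without) (∑-sublists-full (φ ∘ (x ∷_)) uxs with-x) ⟩
  φ [] ℤ.+ φ L ≡⟨ cong (ℤ._+_ (φ [])) full ⟩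
  φ [] ℤ.+ cycleFactor s L ℤ.* φ [] ≡⟨ arith (φ []) (cycleFactor s L) ⟩
  (+ 1 ℤ.+ cycleFactor s L) ℤ.* φ [] ∎
  where
  open ≡-Reasoning
  φ : List ℕ → ℤ
  φ I = ∑ (sublists R) (λ J → coeff f s (I ++ J))
  arith : ∀ a b → a ℤ.+ b ℤ.* a ≡ (+ 1 ℤ.+ b) ℤ.* a
  arith = solve-∀
  uL : Unique L
  uL = proj₁ (Unique-++⁻ L u)
  uR : Unique R
  uR = proj₁ (proj₂ (Unique-++⁻ L u))
  uxs : Unique xs
  uxs = AllPairs.tail uL
  disj : ∀ {i} → i ∈ L → i ∉ R
  disj = proj₂ (proj₂ (Unique-++⁻ L u))
  full : φ L ≡ cycleFactor s L ℤ.* φ []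
  full = trans (∑-cong (sublists R) (λ J∈ → coeff-cycle-++ f s
      (Uniqueₚ.++⁺ uL (sublists-AllPairs J∈ uR) (λ (p , q) → disj p (sublists-⊆ J∈ q)))
      c (λ j∈ fj∈ → disj fj∈ (closed (sublists-⊆ J∈ j∈)))))
    (∑-*ˡ (cycleFactor s L) (sublists R) (coeff f s))
  -- If `I ++ J` were stable, I would be closed under f, because f keeps L inside L and J lies in R.
  -- Being nonempty, I would then contain the whole cycle, hence also b.
  vanish : ∀ {I a b} → (∀ {i} → i ∈ I → i ∈ L) → a ∈ I → b ∈ L → b ∉ I → φ I ≡ + 0
  vanish {I} {a} {b} I⊆L a∈ b∈ b∉ = ∑-0 (sublists R) λ {J} J∈ → coeff-unstable f s {I ++ J} (unstable J∈)
    where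
    unstable : ∀ {J} → J ∈ sublists R → ¬ T (stable f (I ++ J))
    unstable {J} J∈ t = b∉ (cycle-closed {P = _∈ I} c cl (I⊆L a∈) a∈ b∈)
      where
      cl : ∀ {i} → i ∈ L → i ∈ I → f i ∈ I
      cl i∈L i∈ with ∈-++⁻ I (into (stable-⁻ f (I ++ J) t) (∈-++⁺ˡ i∈))
      ... | inj₁ p = p
      ... | inj₂ q = contradiction (sublists-⊆ J∈ q) (disj (into (cycle-stable c) i∈L))
  without : ∀ {a I} → a ∷ I ∈ sublists xs → φ (a ∷ I) ≡ + 0
  without I∈ = vanish (there ∘ sublists-⊆ I∈) (here refl) (here refl) (Unique-head uL ∘ sublists-⊆ I∈)
  with-x : ∀ {y I} → I ∈ sublists xs → y ∈ xs → y ∉ I → φ (x ∷ I) ≡ + 0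
  with-x I∈ y∈ y∉ = vanish (λ { (here e) → here e ; (there i∈) → there (sublists-⊆ I∈ i∈) })
    (here refl) (there y∈) (λ { (here refl) → Unique-head uL y∈ ; (there p) → y∉ p })

cycles-closed : ∀ {f Cs} → All (Cycle f) Cs → ∀ {i} → i ∈ concat Cs → f i ∈ concat Cs
cycles-closed {Cs = C ∷ Cs} (c ∷ cs) i∈ with ∈-++⁻ C i∈
... | inj₁ p = ∈-++⁺ˡ (into (cycle-stable c) p)
... | inj₂ q = ∈-++⁺ʳ C (cycles-closed cs q)

∑-coeff-cycles : ∀ f s {Cs} → All (Cycle f) Cs → Unique (concat Cs) →
  ∑ (sublists (concat Cs)) (coeff f s) ≡ ∏ Cs (λ C → + 1 ℤ.+ cycleFactor s C)
∑-coeff-cycles f s {[]} [] u = refl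
∑-coeff-cycles f s {C ∷ Cs} (c ∷ cs) u = trans (∑-coeff-cycle f s u c (cycles-closed cs))
  (cong ((+ 1 ℤ.+ cycleFactor s C) ℤ.*_) (∑-coeff-cycles f s cs (proj₁ (proj₂ (Unique-++⁻ C u)))))

sorted⇒inversions-0 : ∀ {L} → AllPairs _<_ L → inversions L ≡ 0
sorted⇒inversions-0 [] = refl
sorted⇒inversions-0 {x ∷ xs} (x< ∷ s) = cong₂ _+_ (zero-less x<) (sorted⇒inversions-0 s)
  where
  zero-less : ∀ {ys} → All (x <_) ys → less x ys ≡ 0
  zero-less [] = refl
  zero-less {y ∷ ys} (x<y ∷ h) with y <ᵇ x in e
  ... | false = zero-less h
  ... | true  = contradiction (<ᵇ⇒< y x (≡⇒T e)) (<-asym x<y)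

range1-sorted : ∀ n → AllPairs _<_ (range1 n)
range1-sorted n = AllPairsₚ.map⁺ (AllPairs.map s≤s (AllPairsₚ.applyUpTo⁺₁ id n (λ i<j _ → i<j)))

-- An increasing list has no inversions, so the relative sign is the sign of the list of images
-- alone.
diagCoeff-coeff : ∀ h {I} → AllPairs _<_ I → diagCoeff h I ≡ coeff (absMap h) (signOf ∘ at h) I
diagCoeff-coeff h {I} s rewrite sorted⇒inversions-0 s
  with stable (absMap h) I
... | false = refl
... | true  = cong (∏ I (signOf ∘ at h) ℤ.*_) (sym (*-identityʳ _))

extChar-coeff : ∀ m h {L} → L ↭ range1 m → extChar m h ≡ ∑ (sublists L) (coeff (absMap h) (signOf ∘ at h))
extChar-coeff m h {L} p = trans
  (∑-cong (sublists (range1 m)) (λ I∈ → diagCoeff-coeff h (sublists-AllPairs I∈ (range1-sorted m))))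
  (sym (∑-sublists-↭ (Unique-↭ (↭-sym p) (range1-unique m))
    (λ _ v q → coeff-↭ (absMap h) (signOf ∘ at h) v q) p))

extChar-cycles : ∀ m h {Cs} → All (Cycle (absMap h)) Cs → concat Cs ↭ range1 m →
  extChar m h ≡ ∏ Cs (λ C → + 1 ℤ.+ cycleFactor (signOf ∘ at h) C)
extChar-cycles m h cs p = trans (extChar-coeff m h p)
  (∑-coeff-cycles (absMap h) (signOf ∘ at h) cs (Unique-↭ (↭-sym p) (range1-unique m)))

range1-suc-↭ : ∀ m → suc m ∷ range1 m ↭ range1 (suc m)
range1-suc-↭ m = unique-⊆-↭
  (∷-Unique (λ p → ℕₚ.1+n≰n (proj₂ (∈-range1⁻ p))) (range1-unique m))
  (λ { (here refl) → ∈-range1⁺ (s≤s z≤n) ≤-refl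
     ; (there p) → let l , r = ∈-range1⁻ p in ∈-range1⁺ l (m≤n⇒m≤1+n r) })
  (≤-reflexive (trans (length-range1 (suc m)) (cong suc (sym (length-range1 m)))))

-- The positively fixed letter n is a cycle of length 1 with factor 1 + 1; in other words, ⋀V_n is
-- two copies of ⋀V_{n-1} for such h.
extChar-fixed : ∀ n h → 1 ≤ n → (∀ {i} → i ∈ range1 (n ∸ 1) → absMap h i ∈ range1 (n ∸ 1)) → at h n ≡ + n →
  extChar n h ≡ + 2 ℤ.* extChar (n ∸ 1) h
extChar-fixed (suc m) h _ closed e = begin
  extChar (suc m) h ≡⟨ extChar-coeff (suc m) h (range1-suc-↭ m) ⟩
  ∑ (sublists (suc m ∷ range1 m)) (coeff f s)
    ≡⟨ ∑-coeff-cycle f s (Unique-↭ (↭-sym (range1-suc-↭ m)) (range1-unique (suc m)))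
        (cycle (end (cong ∣_∣ e))) closed ⟩
  (+ 1 ℤ.+ cycleFactor s [ suc m ]) ℤ.* ∑ (sublists (range1 m)) (coeff f s)
    ≡⟨ cong₂ ℤ._*_ (cong (λ v → + 1 ℤ.+ (signOf v ℤ.* + 1) ℤ.* + 1) e) (sym (extChar-coeff m h Perm.refl)) ⟩
  + 2 ℤ.* extChar m h ∎
  where
  open ≡-Reasoning
  f = absMap h
  s = signOf ∘ at h

-- Signed permutations

range1-∷ : ∀ n → range1 (suc n) ≡ 1 ∷ map suc (range1 n)
range1-∷ n = cong (λ l → 1 ∷ map suc l) (sym (Listₚ.map-applyUpTo id suc n))

map-at : ∀ w → map (at w) (range1 (length w)) ≡ w
map-at [] = refl
map-at (x ∷ w) = begin
  map (at (x ∷ w)) (range1 (suc (length w))) ≡⟨ cong (map (at (x ∷ w))) (range1-∷ (length w)) ⟩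
  x ∷ map (at (x ∷ w)) (map suc (range1 (length w))) ≡⟨ cong (x ∷_) (map-∘ (range1 (length w))) ⟨
  x ∷ map (at (x ∷ w) ∘ suc) (range1 (length w)) ≡⟨ cong (x ∷_) (map-∘ (upTo (length w))) ⟨
  x ∷ map (at w ∘ suc) (upTo (length w)) ≡⟨ cong (x ∷_) (map-∘ (upTo (length w))) ⟩
  x ∷ map (at w) (range1 (length w)) ≡⟨ cong (x ∷_) (map-at w) ⟩
  x ∷ w ∎
  where open ≡-Reasoning

at-map : ∀ (F : ℤ → ℤ) w {i} → i ∈ range1 (length w) → at (map F w) i ≡ F (at w i)
at-map F [] ()
at-map F (x ∷ w) {suc zero} i∈ = refl
at-map F (x ∷ w) {suc (suc i)} i∈ = at-map F w (∈-range1⁺ (s≤s z≤n) (≤-pred (proj₂ (∈-range1⁻ i∈))))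
at-map F (x ∷ w) {zero} i∈ with proj₁ (∈-range1⁻ i∈)
... | ()

at-tabulate : ∀ (F : ℕ → ℤ) n {i} → i ∈ range1 n → at (map F (range1 n)) i ≡ F i
at-tabulate F n i∈ with ∈-range1⁻ i∈
at-tabulate F (suc n) {suc zero} i∈ | _ , s≤s _ = refl
at-tabulate F (suc n) {suc (suc i)} i∈ | _ , s≤s i≤ = begin
  at (map F (map suc (applyUpTo suc n))) (suc i) ≡⟨ cong (λ l → at (map F (map suc l)) (suc i))
      (Listₚ.map-applyUpTo id suc n) ⟨
  at (map F (map suc (range1 n))) (suc i) ≡⟨ cong (λ l → at l (suc i)) (map-∘ (range1 n)) ⟨
  at (map (F ∘ suc) (range1 n)) (suc i) ≡⟨ at-tabulate (F ∘ suc) n (∈-range1⁺ (s≤s z≤n) i≤) ⟩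
  F (suc (suc i)) ∎
  where open ≡-Reasoning

concatMap-unique : ∀ {h : A → List C} {xs} → Unique xs → (∀ {a} → a ∈ xs → Unique (h a)) →
  (∀ {a b y} → a ∈ xs → b ∈ xs → y ∈ h a → y ∈ h b → a ≡ b) → Unique (concatMap h xs)
concatMap-unique {xs = []} u uh d = []
concatMap-unique {h = h} {xs = x ∷ xs} u@(_ ∷ u′) uh d = Uniqueₚ.++⁺ (uh (here refl))
  (concatMap-unique u′ (uh ∘ there) (λ p q → d (there p) (there q)))
  λ (p , q) → let b , b∈ , q′ = find (∈-concatMap⁻ h q) in
    Unique-head u (subst (_∈ xs) (sym (d (here refl) (there b∈) p q′)) b∈)

∈-words⁺ : ∀ {xs : List A} {w} → (∀ {x} → x ∈ w → x ∈ xs) → w ∈ words xs (length w)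
∈-words⁺ {w = []} h = here refl
∈-words⁺ {w = x ∷ w} h = ∈-concatMap⁺ _ (lose (h (here refl)) (∈-map⁺ (x ∷_) (∈-words⁺ (h ∘ there))))

∈-words⁻ : ∀ {xs : List A} k {w} → w ∈ words xs k → length w ≡ k × (∀ {x} → x ∈ w → x ∈ xs)
∈-words⁻ zero (here refl) = refl , λ ()
∈-words⁻ {xs = xs} (suc k) w∈ with find (∈-concatMap⁻ (λ a → map (a ∷_) (words xs k)) {xs} w∈)
... | a , a∈ , p with ∈-map⁻ (a ∷_) p
...   | v , v∈ , refl with ∈-words⁻ k v∈
...     | e , h = cong suc e , λ { (here refl) → a∈ ; (there q) → h q }

words-unique : ∀ {xs : List A} k → Unique xs → Unique (words xs k)
words-unique zero u = [] ∷ []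
words-unique (suc k) u = concatMap-unique u
  (λ _ → Uniqueₚ.map⁺ Listₚ.∷-injectiveʳ (words-unique k u))
  (λ {a} {b} _ _ p q → let v , _ , e = ∈-map⁻ (a ∷_) p ; v′ , _ , e′ = ∈-map⁻ (b ∷_) q in
     Listₚ.∷-injectiveˡ (trans (sym e) e′))

∈-signedLetters⁺ : ∀ {n v} → ∣ v ∣ ∈ range1 n → v ∈ signedLetters n
∈-signedLetters⁺ {v = + k} p = ∈-concatMap⁺ _ (lose p (here refl))
∈-signedLetters⁺ {v = -[1+ k ]} p = ∈-concatMap⁺ _ (lose p (there (here refl)))

signedLetters-unique : ∀ n → Unique (signedLetters n)
signedLetters-unique n = concatMap-unique (range1-unique n)
  (λ k∈ → ((λ e → distinct (proj₁ (∈-range1⁻ k∈)) e) ∷ []) ∷ [] ∷ [])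
  (λ _ _ p q → trans (sym (abs p)) (abs q))
  where
  distinct : ∀ {k} → 1 ≤ k → + k ≢ ℤ.- (+ k)
  distinct (s≤s _) ()
  abs : ∀ {k v} → v ∈ + k ∷ ℤ.- (+ k) ∷ [] → ∣ v ∣ ≡ k
  abs (here refl) = refl
  abs {k} (there (here refl)) = ℤₚ.∣-i∣≡∣i∣ (+ k)

countᵇ-unique : ∀ {x xs} → Unique xs → x ∈ xs → countᵇ x xs ≡ 1
countᵇ-unique {x} {xs} u x∈ = ℤₚ.+-injective (trans (length-filterᵇ (x ≡ᵇ_) xs) (∑-delta x (λ _ → + 1) u x∈))

countᵇ-↭ : ∀ x {xs ys} → xs ↭ ys → countᵇ x xs ≡ countᵇ x ys
countᵇ-↭ x p = ↭-length (Permₚ.filter-↭ (T? ∘ (x ≡ᵇ_)) p)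

countᵇ-∈ : ∀ {x xs} → countᵇ x xs ≡ 1 → x ∈ xs
countᵇ-∈ {x} {xs} e with filterᵇ (x ≡ᵇ_) xs in eq
countᵇ-∈ {x} {xs} e | y ∷ _ with ∈-filterᵇ⁻ {p = x ≡ᵇ_} {y} {xs} (subst (y ∈_) (sym eq) (here refl))
... | y∈ , t = subst (_∈ xs) (sym (≡ᵇ⇒≡ x y t)) y∈

-- A word of length n in whose absolute values each of 1..n occurs has no room for repetitions.
B-⁻ : ∀ {n w} → w ∈ B n → map ∣_∣ w ↭ range1 n
B-⁻ {n} {w} w∈ with ∈-filterᵇ⁻ {p = isSignedPerm n} {xs = words (signedLetters n) n} w∈
... | _ , t with ∧-⁻ {length w ≡ᵇ n} t
...   | t₁ , t₂ = ↭-sym (unique-⊆-↭ (range1-unique n)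
  (λ k∈ → countᵇ-∈ (≡ᵇ⇒≡ _ _ (all-⁻ (λ k → countᵇ k (map ∣_∣ w) ≡ᵇ 1) (range1 n) t₂ k∈)))
  (≤-reflexive (trans (length-map ∣_∣ w) (trans (≡ᵇ⇒≡ _ _ t₁) (sym (length-range1 n))))))

SP-length : ∀ {n w} → map ∣_∣ w ↭ range1 n → length w ≡ n
SP-length {n} {w} p = trans (sym (length-map ∣_∣ w)) (trans (↭-length p) (length-range1 n))

B-⁺ : ∀ {n w} → map ∣_∣ w ↭ range1 n → w ∈ B n
B-⁺ {n} {w} p = ∈-filterᵇ⁺ {p = isSignedPerm n}
  (subst (λ k → w ∈ words (signedLetters n) k) len
    (∈-words⁺ (λ v∈ → ∈-signedLetters⁺ (∈-resp-↭ p (∈-map⁺ ∣_∣ v∈)))))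
  (∧-⁺ (≡⇒≡ᵇ _ _ len) (all-⁺ (λ k → countᵇ k (map ∣_∣ w) ≡ᵇ 1) (range1 n)
    (λ {k} k∈ → ≡⇒≡ᵇ _ _ (trans (countᵇ-↭ k p) (countᵇ-unique (range1-unique n) k∈)))))
  where len = SP-length p

B-unique : ∀ n → Unique (B n)
B-unique n = Uniqueₚ.filter⁺ (T? ∘ isSignedPerm n) (words-unique n (signedLetters-unique n))

unique-map-injective : ∀ {f : A → C} {xs} → Unique (map f xs) → ∀ {x y} → x ∈ xs → y ∈ xs → f x ≡ f y → x ≡ y
unique-map-injective u (here refl) (here refl) e = refl
unique-map-injective {f = f} {x ∷ xs} u (here refl) (there q) e = contradiction (subst (_∈ map f xs) (sym e)
    (∈-map⁺ f q)) (Unique-head u)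
unique-map-injective {f = f} {x ∷ xs} u (there p) (here refl) e = contradiction
    (subst (_∈ map f xs) e (∈-map⁺ f p)) (Unique-head u)
unique-map-injective (_ ∷ u) (there p) (there q) e = unique-map-injective u p q e

module _ {n w} (w∈ : w ∈ B n) where
  private
    p : map (absMap w) (range1 n) ↭ range1 n
    p = subst (_↭ range1 n)
      (trans (cong (map ∣_∣) (sym (map-at w)))
        (trans (sym (map-∘ (range1 (length w)))) (cong (map (absMap w) ∘ range1) (SP-length (B-⁻ w∈)))))
      (B-⁻ w∈)

  B-length : length w ≡ n
  B-length = SP-length (B-⁻ w∈)

  absMap-∈ : ∀ {i} → i ∈ range1 n → absMap w i ∈ range1 n
  absMap-∈ i∈ = ∈-resp-↭ p (∈-map⁺ (absMap w) i∈)

  absMap-injective : ∀ {i j} → i ∈ range1 n → j ∈ range1 n → absMap w i ≡ absMap w j → i ≡ j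
  absMap-injective = unique-map-injective (Unique-↭ (↭-sym p) (range1-unique n))

  absMap-surjective : ∀ {c} → c ∈ range1 n → ∃ λ i → i ∈ range1 n × absMap w i ≡ c
  absMap-surjective c∈ with ∈-map⁻ (absMap w) (∈-resp-↭ (↭-sym p) c∈)
  ... | i , i∈ , e = i , i∈ , sym e

-- Conjugation

withSign : Bool → ℕ → ℤ
withSign b j = if b then ℤ.- (+ j) else + j

∣withSign∣ : ∀ b j → ∣ withSign b j ∣ ≡ j
∣withSign∣ true  j = ℤₚ.∣-i∣≡∣i∣ (+ j)
∣withSign∣ false j = refl

barred-withSign : ∀ b {j} → 1 ≤ j → barred (withSign b j) ≡ b
barred-withSign true  (s≤s _) = refl
barred-withSign false (s≤s _) = refl

withSign-barred : ∀ v → withSign (barred v) ∣ v ∣ ≡ v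
withSign-barred (+ k) = refl
withSign-barred -[1+ k ] = refl

signB : Bool → ℤ
signB b = if b then ℤ.- (+ 1) else + 1

signB-square : ∀ b → signB b ℤ.* signB b ≡ + 1
signB-square true  = refl
signB-square false = refl

signOf-neg : ∀ v → 1 ≤ ∣ v ∣ → signOf (ℤ.- v) ≡ ℤ.- signOf v
signOf-neg (+ suc k) _ = refl
signOf-neg -[1+ k ] _ = refl

∣applyS∣ : ∀ w v → ∣ applyS w v ∣ ≡ absMap w ∣ v ∣
∣applyS∣ w v with barred v
... | true  = ℤₚ.∣-i∣≡∣i∣ (at w ∣ v ∣)
... | false = refl

signOf-applyS : ∀ w v → 1 ≤ absMap w ∣ v ∣ → signOf (applyS w v) ≡ signOf v ℤ.* signOf (at w ∣ v ∣)
signOf-applyS w v h with barred v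
... | true  = trans (signOf-neg (at w ∣ v ∣) h) (sym (ℤₚ.-1*i≡-i (signOf (at w ∣ v ∣))))
... | false = sym (*-identityˡ _)

preimage-at : ∀ {n x} → x ∈ B n → ∀ {j} → j ∈ range1 n → preimage n x (absMap x j) ≡ withSign (barred (at x j)) j
preimage-at {n} {x} x∈ {j} j∈ = go (range1 n) id j∈
  where
  go : ∀ L → (∀ {i} → i ∈ L → i ∈ range1 n) → j ∈ L →
    foldr (λ i acc → if absMap x i ≡ᵇ absMap x j then (if barred (at x i) then ℤ.- (+ i) else + i) else acc) (+ 0) L
      ≡ withSign (barred (at x j)) j
  go (i ∷ L) sub j∈L with absMap x i ≡ᵇ absMap x j in e
  ... | true rewrite absMap-injective x∈ (sub (here refl)) j∈ (≡ᵇ⇒≡ _ _ (≡⇒T e)) = refl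
  go (i ∷ L) sub (here refl) | false = ⊥-elim (subst T e (≡⇒≡ᵇ (absMap x i) _ refl))
  go (i ∷ L) sub (there q) | false = go L (sub ∘ there) q

-- Absolute values and signs are treated separately: on absolute values the conjugate h is y⁻¹ ∘ f ∘
-- y, and `sx`, `sg`, `sh` record the signs of x, g and the conjugate.
module Conjugate {n x g} (x∈ : x ∈ B n) (g∈ : g ∈ B n) where

  y y⁻¹ h f : ℕ → ℕ
  y = absMap x
  y⁻¹ = absMap (inverse n x)
  h = absMap (conj n x g)
  f = absMap g

  at-inverse : ∀ {j} → j ∈ range1 n → at (inverse n x) (y j) ≡ withSign (barred (at x j)) j
  at-inverse j∈ = trans (at-tabulate (preimage n x) n (absMap-∈ x∈ j∈)) (preimage-at x∈ j∈)

  y⁻¹-y : ∀ {j} → j ∈ range1 n → y⁻¹ (y j) ≡ j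
  y⁻¹-y {j} j∈ = trans (cong ∣_∣ (at-inverse j∈)) (∣withSign∣ (barred (at x j)) j)

  y⁻¹-∈ : ∀ {c} → c ∈ range1 n → y⁻¹ c ∈ range1 n
  y⁻¹-∈ c∈ with absMap-surjective x∈ c∈
  ... | j , j∈ , refl = subst (_∈ range1 n) (sym (y⁻¹-y j∈)) j∈

  y-y⁻¹ : ∀ {c} → c ∈ range1 n → y (y⁻¹ c) ≡ c
  y-y⁻¹ c∈ with absMap-surjective x∈ c∈
  ... | j , j∈ , refl = cong y (y⁻¹-y j∈)

  at-conj : ∀ {i} → i ∈ range1 n → at (conj n x g) i ≡ applyS (inverse n x) (applyS g (at x i))
  at-conj i∈ = trans (at-tabulate _ n i∈) (cong (applyS (inverse n x)) (at-tabulate _ n i∈))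

  h-y⁻¹ : ∀ {c} → c ∈ range1 n → h (y⁻¹ c) ≡ y⁻¹ (f c)
  h-y⁻¹ {c} c∈ = begin
    ∣ at (conj n x g) (y⁻¹ c) ∣ ≡⟨ cong ∣_∣ (at-conj (y⁻¹-∈ c∈)) ⟩
    ∣ applyS (inverse n x) (applyS g (at x (y⁻¹ c))) ∣ ≡⟨ ∣applyS∣ (inverse n x) (applyS g (at x (y⁻¹ c))) ⟩
    y⁻¹ ∣ applyS g (at x (y⁻¹ c)) ∣ ≡⟨ cong y⁻¹ (∣applyS∣ g (at x (y⁻¹ c))) ⟩
    y⁻¹ (f (y (y⁻¹ c))) ≡⟨ cong (y⁻¹ ∘ f) (y-y⁻¹ c∈) ⟩
    y⁻¹ (f c) ∎
    where open ≡-Reasoning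

  h-def : ∀ {i} → i ∈ range1 n → h i ≡ y⁻¹ (f (y i))
  h-def {i} i∈ = trans (cong h (sym (y⁻¹-y i∈))) (h-y⁻¹ (absMap-∈ x∈ i∈))

  h-∈ : ∀ {i} → i ∈ range1 n → h i ∈ range1 n
  h-∈ i∈ = subst (_∈ range1 n) (sym (h-def i∈)) (y⁻¹-∈ (absMap-∈ g∈ (absMap-∈ x∈ i∈)))

  y-h : ∀ {i} → i ∈ range1 n → y (h i) ≡ f (y i)
  y-h i∈ = trans (cong y (h-def i∈)) (y-y⁻¹ (absMap-∈ g∈ (absMap-∈ x∈ i∈)))

  h-injective : ∀ {i j} → i ∈ range1 n → j ∈ range1 n → h i ≡ h j → i ≡ j
  h-injective i∈ j∈ e = absMap-injective x∈ i∈ j∈ (absMap-injective g∈ (absMap-∈ x∈ i∈) (absMap-∈ x∈ j∈)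
    (trans (sym (y-h i∈)) (trans (cong y e) (y-h j∈))))

  sx sg sh : ℕ → ℤ
  sx = signOf ∘ at x
  sg = signOf ∘ at g
  sh = signOf ∘ at (conj n x g)

  -- The inverse of x carries at y (h i) the sign that x carries at h i. Thus the signs of the
  -- conjugate differ from those of g by a coboundary of the signs of x.
  sh-def : ∀ {i} → i ∈ range1 n → sh i ≡ (sx i ℤ.* sg (y i)) ℤ.* sx (h i)
  sh-def {i} i∈ = begin
    sh i ≡⟨ cong signOf (at-conj i∈) ⟩
    signOf (applyS (inverse n x) (applyS g (at x i)))
      ≡⟨ signOf-applyS (inverse n x) (applyS g (at x i))
          (proj₁ (∈-range1⁻ (y⁻¹-∈ (subst (_∈ range1 n) (sym abs) (absMap-∈ g∈ (absMap-∈ x∈ i∈)))))) ⟩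
    signOf (applyS g (at x i)) ℤ.* signOf (at (inverse n x) ∣ applyS g (at x i) ∣)
      ≡⟨ cong₂ ℤ._*_ (signOf-applyS g (at x i) (proj₁ (∈-range1⁻ (absMap-∈ g∈ (absMap-∈ x∈ i∈)))))
           (cong (signOf ∘ at (inverse n x)) (trans abs (sym (y-h i∈)))) ⟩
    (sx i ℤ.* sg (y i)) ℤ.* signOf (at (inverse n x) (y (h i)))
      ≡⟨ cong (λ v → (sx i ℤ.* sg (y i)) ℤ.* signOf v) (at-inverse (h-∈ i∈)) ⟩
    (sx i ℤ.* sg (y i)) ℤ.* signOf (withSign (barred (at x (h i))) (h i))
      ≡⟨ cong (λ b → (sx i ℤ.* sg (y i)) ℤ.* signB b) (barred-withSign (barred (at x (h i)))
          (proj₁ (∈-range1⁻ (h-∈ i∈)))) ⟩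
    (sx i ℤ.* sg (y i)) ℤ.* sx (h i) ∎
    where
    open ≡-Reasoning
    abs : ∣ applyS g (at x i) ∣ ≡ f (y i)
    abs = ∣applyS∣ g (at x i)

  chain-conj : ∀ {d c cs} → (∀ {i} → i ∈ c ∷ cs → i ∈ range1 n) → Chain f d c cs →
    Chain h (y⁻¹ d) (y⁻¹ c) (map y⁻¹ cs)
  chain-conj sub (end e) = end (trans (h-y⁻¹ (sub (here refl))) (cong y⁻¹ e))
  chain-conj sub (step e ch) = step (trans (h-y⁻¹ (sub (here refl))) (cong y⁻¹ e)) (chain-conj (sub ∘ there) ch)

  cycle-conj : ∀ {L} → (∀ {i} → i ∈ L → i ∈ range1 n) → Cycle f L → Cycle h (map y⁻¹ L)
  cycle-conj sub (cycle ch) = cycle (chain-conj sub ch)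

  -- The signs of x cancel along a cycle.
  cycleFactor-conj : ∀ {L} → (∀ {i} → i ∈ L → i ∈ range1 n) → Cycle f L →
    cycleFactor sh (map y⁻¹ L) ≡ cycleFactor sg L
  cycleFactor-conj {L} sub c = cong₂ ℤ._*_ signs (cong (λ k → minusOnePow (k ∸ 1)) (length-map y⁻¹ L))
    where
    open ≡-Reasoning
    M = map y⁻¹ L
    M-∈ : ∀ {j} → j ∈ M → j ∈ range1 n
    M-∈ j∈ with ∈-map⁻ y⁻¹ j∈
    ... | i , i∈ , refl = y⁻¹-∈ (sub i∈)
    square : ∀ L → ∏ L sx ℤ.* ∏ L sx ≡ + 1
    square [] = refl
    square (i ∷ L) = begin
      (sx i ℤ.* ∏ L sx) ℤ.* (sx i ℤ.* ∏ L sx) ≡⟨ arith′ (sx i) (∏ L sx) ⟩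
      (sx i ℤ.* sx i) ℤ.* (∏ L sx ℤ.* ∏ L sx) ≡⟨ cong₂ ℤ._*_ (signB-square (barred (at x i))) (square L) ⟩
      + 1 ∎
      where
      arith′ : ∀ a b → (a ℤ.* b) ℤ.* (a ℤ.* b) ≡ (a ℤ.* a) ℤ.* (b ℤ.* b)
      arith′ = solve-∀
    signs : ∏ M sh ≡ ∏ L sg
    signs = begin
      ∏ M sh ≡⟨ ∏-cong M (λ j∈ → sh-def (M-∈ j∈)) ⟩
      ∏ M (λ i → (sx i ℤ.* sg (y i)) ℤ.* sx (h i)) ≡⟨ ∏-* M (λ i → sx i ℤ.* sg (y i)) (sx ∘ h) ⟩
      ∏ M (λ i → sx i ℤ.* sg (y i)) ℤ.* ∏ M (sx ∘ h) ≡⟨ cong₂ ℤ._*_ (∏-* M sx (sg ∘ y)) (trans (sym (∏-map h M sx))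
          (∏-↭ sx (cycle-↭ (cycle-conj sub c)))) ⟩
      (∏ M sx ℤ.* ∏ M (sg ∘ y)) ℤ.* ∏ M sx ≡⟨ square-first (∏ M sx) (∏ M (sg ∘ y)) ⟩
      (∏ M sx ℤ.* ∏ M sx) ℤ.* ∏ M (sg ∘ y) ≡⟨ cong (ℤ._* ∏ M (sg ∘ y)) (square M) ⟩
      + 1 ℤ.* ∏ M (sg ∘ y) ≡⟨ *-identityˡ _ ⟩
      ∏ M (sg ∘ y) ≡⟨ ∏-map y⁻¹ L (sg ∘ y) ⟩
      ∏ L (sg ∘ y ∘ y⁻¹) ≡⟨ ∏-cong L (λ i∈ → cong sg (y-y⁻¹ (sub i∈))) ⟩
      ∏ L sg ∎

  -- The map y⁻¹ carries the cycles of g to those of the conjugate without changing their factors,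
  -- so x disappears from the result.
  extChar-conj : ∀ {Cs} → All (Cycle f) Cs → concat Cs ↭ range1 n →
    extChar n (conj n x g) ≡ ∏ Cs (λ C → + 1 ℤ.+ cycleFactor sg C)
  extChar-conj {Cs} cs p = begin
    extChar n (conj n x g) ≡⟨ extChar-cycles n (conj n x g) cycles cover ⟩
    ∏ (map (map y⁻¹) Cs) (λ C → + 1 ℤ.+ cycleFactor sh C) ≡⟨ ∏-map (map y⁻¹) Cs _ ⟩
    ∏ Cs (λ C → + 1 ℤ.+ cycleFactor sh (map y⁻¹ C))
      ≡⟨ ∏-cong Cs (λ C∈ → cong (ℤ._+_ (+ 1)) (cycleFactor-conj (sub C∈) (All.lookup cs C∈))) ⟩
    ∏ Cs (λ C → + 1 ℤ.+ cycleFactor sg C) ∎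
    where
    open ≡-Reasoning
    sub : ∀ {C} → C ∈ Cs → ∀ {i} → i ∈ C → i ∈ range1 n
    sub C∈ i∈ = ∈-resp-↭ p (∈ₚ.∈-concat⁺′ i∈ C∈)
    cycles : All (Cycle h) (map (map y⁻¹) Cs)
    cycles = Allₚ.map⁺ (All.tabulate (λ C∈ → cycle-conj (sub C∈) (All.lookup cs C∈)))
    cover : concat (map (map y⁻¹) Cs) ↭ range1 n
    cover rewrite Listₚ.concat-map {f = y⁻¹} Cs = Perm.trans (Permₚ.map⁺ y⁻¹ p)
      (self-map-↭ (range1-unique n) y⁻¹-∈ (λ i∈ j∈ e → trans (sym (y-y⁻¹ i∈)) (trans (cong y e) (y-y⁻¹ j∈))))

-- The induced character

-- `fixesLast n g` is definitionally the instance c = n; the lemmas below are applied to it in that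
-- guise.
fixesPos : List ℤ → ℕ → Bool
fixesPos g c = not (barred (at g c)) ∧ (absMap g c ≡ᵇ c)

not-T : ∀ {b} → T (not b) → b ≡ false
not-T {false} _ = refl

fixesPos-⁻ : ∀ g c → T (fixesPos g c) → at g c ≡ + c
fixesPos-⁻ g c t with ∧-⁻ {not (barred (at g c))} t
... | t₁ , t₂ = trans (sym (withSign-barred (at g c))) (cong₂ withSign (not-T t₁) (≡ᵇ⇒≡ _ _ t₂))

fixesPos-sign : ∀ g c → T (fixesPos g c) → barred (at g c) ≡ false
fixesPos-sign g c t = cong barred (fixesPos-⁻ g c t)

fixesPos-∣∣ : ∀ g c → T (fixesPos g c) → absMap g c ≡ c
fixesPos-∣∣ g c t = cong ∣_∣ (fixesPos-⁻ g c t)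

fixesPos-intro : ∀ g c → barred (at g c) ≡ false → absMap g c ≡ c → T (fixesPos g c)
fixesPos-intro g c e₁ e₂ = ∧-⁺ (subst (T ∘ not) (sym e₁) tt) (≡⇒≡ᵇ _ _ e₂)

signB-injective : ∀ {a b} → signB a ≡ signB b → a ≡ b
signB-injective {true}  {true}  e = refl
signB-injective {false} {false} e = refl

module Induced {n x g} (1≤n : 1 ≤ n) (x∈ : x ∈ B n) (g∈ : g ∈ B n) where
  open Conjugate {n} x∈ g∈
  private
    n∈ : n ∈ range1 n
    n∈ = ∈-range1⁺ 1≤n ≤-refl

  -- At a fixed point of h the two signs contributed by x sit at the same place and form a square.
  sign-fixed : ∀ {i} → i ∈ range1 n → h i ≡ i → barred (at (conj n x g) i) ≡ barred (at g (y i))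
  sign-fixed {i} i∈ e = signB-injective (begin
    sh i ≡⟨ sh-def i∈ ⟩
    (sx i ℤ.* sg (y i)) ℤ.* sx (h i) ≡⟨ cong (λ j → (sx i ℤ.* sg (y i)) ℤ.* sx j) e ⟩
    (sx i ℤ.* sg (y i)) ℤ.* sx i ≡⟨ square-first (sx i) (sg (y i)) ⟩
    (sx i ℤ.* sx i) ℤ.* sg (y i) ≡⟨ cong (ℤ._* sg (y i)) (signB-square (barred (at x i))) ⟩
    + 1 ℤ.* sg (y i) ≡⟨ *-identityˡ _ ⟩
    sg (y i) ∎)
    where
    open ≡-Reasoning

  h-fixed : ∀ {i} → i ∈ range1 n → f (y i) ≡ y i → h i ≡ i
  h-fixed i∈ e = trans (h-def i∈) (trans (cong y⁻¹ e) (y⁻¹-y i∈))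

  f-fixed : ∀ {i} → i ∈ range1 n → h i ≡ i → f (y i) ≡ y i
  f-fixed i∈ e = trans (sym (y-h i∈)) (cong y e)

  fixesLast-conj : fixesLast n (conj n x g) ≡ fixesPos g (y n)
  fixesLast-conj = T-ext
    (λ t → let hn = fixesPos-∣∣ (conj n x g) n t in
      fixesPos-intro g (y n) (trans (sym (sign-fixed n∈ hn)) (fixesPos-sign (conj n x g) n t)) (f-fixed n∈ hn))
    (λ t → let hn = h-fixed n∈ (fixesPos-∣∣ g (y n) t) in
      fixesPos-intro (conj n x g) n (trans (sign-fixed n∈ hn) (fixesPos-sign g (y n) t)) hn)

  closed : at (conj n x g) n ≡ + n → ∀ {i} → i ∈ range1 (n ∸ 1) → h i ∈ range1 (n ∸ 1)
  closed hn {i} i∈ = ∈-range1⁺ (proj₁ (∈-range1⁻ (h-∈ i∈n)))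
      (ℕₚ.<⇒≤pred (≤∧≢⇒< (proj₂ (∈-range1⁻ (h-∈ i∈n)))
        λ hi≡n → <⇒≢ i<n (h-injective i∈n n∈ (trans hi≡n (sym (cong ∣_∣ hn))))))
    where
    i<n : i < n
    i<n = subst (suc i ≤_) (suc-pred n ⦃ ℕ.>-nonZero 1≤n ⦄) (s≤s (proj₂ (∈-range1⁻ i∈)))
    i∈n : i ∈ range1 n
    i∈n = ∈-range1⁺ (proj₁ (∈-range1⁻ i∈)) (<⇒≤ i<n)

  -- Doubling replaces the trace on ⋀V_{n-1} by the one on ⋀V_n, which is insensitive to
  -- conjugation; x survives only in the test whether g fixes |x(n)| positively.
  extChar⁰-conj : ∀ {Cs} → All (Cycle f) Cs → concat Cs ↭ range1 n →
    + 2 ℤ.* extChar⁰ n (conj n x g) ≡ ∏ Cs (λ C → + 1 ℤ.+ cycleFactor sg C) ℤ.* [ fixesPos g (y n) ]ᵢ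
  extChar⁰-conj {Cs} cs p = trans
    (scale-if (fixesLast n (conj n x g)) (extChar (n ∸ 1) (conj n x g)) (∏ Cs (λ C → + 1 ℤ.+ cycleFactor sg C)) main)
    (cong (λ b → ∏ Cs (λ C → + 1 ℤ.+ cycleFactor sg C) ℤ.* [ b ]ᵢ) fixesLast-conj)
    where
    scale-if : ∀ b E P → (T b → + 2 ℤ.* E ≡ P) → + 2 ℤ.* (if b then E else + 0) ≡ P ℤ.* [ b ]ᵢ
    scale-if true  E P h = trans (h tt) (sym (*-identityʳ P))
    scale-if false E P h = sym (*-zeroʳ P)
    main : T (fixesLast n (conj n x g)) → + 2 ℤ.* extChar (n ∸ 1) (conj n x g) ≡ ∏ Cs (λ C → + 1 ℤ.+ cycleFactor sg C)
    main t = trans (sym (extChar-fixed n (conj n x g) 1≤n (closed (fixesPos-⁻ (conj n x g) n t))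
        (fixesPos-⁻ (conj n x g) n t)))
      (extChar-conj cs p)

∑-involution : ∀ {xs : List A} (φ : A → A) (F : A → ℤ) → Unique xs →
  (∀ {x} → x ∈ xs → φ x ∈ xs) → (∀ {x} → x ∈ xs → φ (φ x) ≡ x) → ∑ xs (F ∘ φ) ≡ ∑ xs F
∑-involution {xs = xs} φ F u stab inv = trans (sym (∑-map φ xs F))
  (∑-↭ F (self-map-↭ u stab (λ p q e → trans (sym (inv p)) (trans (cong φ e) (inv q)))))

map-id-on : ∀ {f : A → A} {xs} → (∀ {x} → x ∈ xs → f x ≡ x) → map f xs ≡ xs
map-id-on {xs = []} h = refl
map-id-on {xs = x ∷ xs} h = cong₂ _∷_ (h (here refl)) (map-id-on (h ∘ there))

-- Relabelling the letters of every word by an involution π permutes `B n`; τ is the action of π on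
-- absolute values, which decides membership.
∑-B-relabel : ∀ n (π : ℤ → ℤ) (τ : ℕ → ℕ) → (∀ v → ∣ π v ∣ ≡ τ ∣ v ∣) →
  (∀ {v} → ∣ v ∣ ∈ range1 n → π (π v) ≡ v) → (∀ {k} → k ∈ range1 n → τ k ∈ range1 n) →
  (∀ {k} → k ∈ range1 n → τ (τ k) ≡ k) → (F : List ℤ → ℤ) →
  ∑ (B n) (F ∘ map π) ≡ ∑ (B n) F
∑-B-relabel n π τ abs ππ τ∈ ττ F = ∑-involution (map π) F (B-unique n) stab inv
  where
  stab : ∀ {w} → w ∈ B n → map π w ∈ B n
  stab {w} w∈ = B-⁺ (subst (_↭ range1 n)
      (trans (sym (map-∘ w)) (trans (Listₚ.map-cong (sym ∘ abs) w) (map-∘ w)))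
      (Perm.trans (Permₚ.map⁺ τ (B-⁻ w∈))
        (self-map-↭ (range1-unique n) τ∈ (λ p q e → trans (sym (ττ p)) (trans (cong τ e) (ττ q))))))
  inv : ∀ {w} → w ∈ B n → map π (map π w) ≡ w
  inv {w} w∈ = trans (sym (map-∘ w))
    (map-id-on (λ v∈ → ππ (∈-resp-↭ (B-⁻ w∈) (∈-map⁺ ∣_∣ v∈))))

transpose : ℕ → ℕ → ℕ → ℕ
transpose a b k = if k ≡ᵇ a then b else if k ≡ᵇ b then a else k

transpose-∈ : ∀ {a b k n} → a ∈ range1 n → b ∈ range1 n → k ∈ range1 n → transpose a b k ∈ range1 n
transpose-∈ {a} {b} {k} a∈ b∈ k∈ with k ≡ᵇ a
... | true = b∈
... | false with k ≡ᵇ b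
...   | true = a∈
...   | false = k∈

transpose-involutive : ∀ a b k → transpose a b (transpose a b k) ≡ k
transpose-involutive a b k with k ≡ᵇ a in e₁
... | true with b ≡ᵇ a in e₃
...   | true = trans (≡ᵇ⇒≡ b a (≡⇒T e₃)) (sym (≡ᵇ⇒≡ k a (≡⇒T e₁)))
...   | false rewrite ≡ᵇ-refl b = sym (≡ᵇ⇒≡ k a (≡⇒T e₁))
transpose-involutive a b k | false with k ≡ᵇ b in e₂
...   | true rewrite ≡ᵇ-refl a = sym (≡ᵇ⇒≡ k b (≡⇒T e₂))
...   | false rewrite e₁ | e₂ = refl

module LastCount (n : ℕ) (n∈ : n ∈ range1 n) where

  at-relabel : ∀ π {x} → x ∈ B n → at (map π x) n ≡ π (at x n)
  at-relabel π {x} x∈ = at-map π x (subst (λ k → n ∈ range1 k) (sym (B-length {n} x∈)) n∈)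

  transposeℤ : ℕ → ℤ → ℤ
  transposeℤ c v = withSign (barred v) (transpose c n ∣ v ∣)

  -- Exchanging the letters c and n with their signs kept matches the words ending in c, up to sign,
  -- with those ending in n.
  ∑-last-transpose : ∀ {c} → c ∈ range1 n →
    ∑ (B n) (λ x → [ absMap x n ≡ᵇ c ]ᵢ) ≡ ∑ (B n) (λ x → [ absMap x n ≡ᵇ n ]ᵢ)
  ∑-last-transpose {c} c∈ = trans (∑-cong (B n) (λ x∈ → cong [_]ᵢ (match x∈)))
      (∑-B-relabel n (transposeℤ c) (transpose c n) (λ v → ∣withSign∣ (barred v) _) ππ
        (transpose-∈ c∈ n∈) (λ {k} _ → transpose-involutive c n k) (λ x → [ absMap x n ≡ᵇ n ]ᵢ))
    where
    ππ : ∀ {v} → ∣ v ∣ ∈ range1 n → transposeℤ c (transposeℤ c v) ≡ v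
    ππ {v} v∈ = trans (cong₂ withSign (barred-withSign (barred v) (proj₁ (∈-range1⁻ (transpose-∈ c∈ n∈ v∈))))
        (trans (cong (transpose c n) (∣withSign∣ (barred v) _)) (transpose-involutive c n ∣ v ∣))) (withSign-barred v)
    key : ∀ k → (k ≡ᵇ c) ≡ (transpose c n k ≡ᵇ n)
    key k with k ≡ᵇ c in e
    ... | true = sym (≡ᵇ-refl n)
    ... | false with k ≡ᵇ n in e′
    ...   | false = sym e′
    ...   | true  = sym (≢⇒≡ᵇ-false {c} {n} (λ { refl → subst T (trans (sym e′) e) tt }))
    match : ∀ {x} → x ∈ B n → (absMap x n ≡ᵇ c) ≡ (absMap (map (transposeℤ c) x) n ≡ᵇ n)
    match {x} x∈ = trans (key (absMap x n)) (cong (_≡ᵇ n)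
      (sym (trans (cong ∣_∣ (at-relabel (transposeℤ c) x∈)) (∣withSign∣ (barred (at x n)) _))))

  -- Negating all letters matches the words with x(n) = -n with those having x(n) = n, and the
  -- latter form the subgroup B_{n-1}.
  ∑-last-n : ∑ (B n) (λ x → [ absMap x n ≡ᵇ n ]ᵢ) ≡ + 2 ℤ.* + subgroupOrder n
  ∑-last-n = begin
    ∑ (B n) (λ x → [ absMap x n ≡ᵇ n ]ᵢ) ≡⟨ ∑-cong (B n) (λ {x} _ → split x) ⟩
    ∑ (B n) (λ x → [ fixesLast n x ]ᵢ ℤ.+ neg x) ≡⟨ ∑-+ (B n) (λ x → [ fixesLast n x ]ᵢ) neg ⟩
    ∑ (B n) (λ x → [ fixesLast n x ]ᵢ) ℤ.+ ∑ (B n) neg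
      ≡⟨ cong (ℤ._+_ (∑ (B n) (λ x → [ fixesLast n x ]ᵢ))) (trans (∑-cong (B n) flip)
          (∑-B-relabel n ℤ.-_ id ℤₚ.∣-i∣≡∣i∣ (λ {v} _ → ℤₚ.neg-involutive v) id (λ _ → refl)
              (λ x → [ fixesLast n x ]ᵢ))) ⟩
    ∑ (B n) (λ x → [ fixesLast n x ]ᵢ) ℤ.+ ∑ (B n) (λ x → [ fixesLast n x ]ᵢ)
      ≡⟨ cong₂ ℤ._+_ (sym (length-filterᵇ (fixesLast n) (B n))) (sym (length-filterᵇ (fixesLast n) (B n))) ⟩
    + subgroupOrder n ℤ.+ + subgroupOrder n ≡⟨ arith (+ subgroupOrder n) ⟩
    + 2 ℤ.* + subgroupOrder n ∎
    where
    open ≡-Reasoning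
    neg : List ℤ → ℤ
    neg x = [ barred (at x n) ∧ (absMap x n ≡ᵇ n) ]ᵢ
    arith : ∀ a → a ℤ.+ a ≡ + 2 ℤ.* a
    arith = solve-∀
    split : ∀ x → [ absMap x n ≡ᵇ n ]ᵢ ≡ [ fixesLast n x ]ᵢ ℤ.+ neg x
    split x with barred (at x n)
    ... | true  = sym (+-identityˡ _)
    ... | false = sym (ℤₚ.+-identityʳ _)
    flipℤ : ∀ v → 1 ≤ ∣ v ∣ → barred v ∧ (∣ v ∣ ≡ᵇ n) ≡ not (barred (ℤ.- v)) ∧ (∣ ℤ.- v ∣ ≡ᵇ n)
    flipℤ (+ suc k) _ = refl
    flipℤ -[1+ k ]  _ = refl
    flip : ∀ {x} → x ∈ B n → neg x ≡ [ fixesLast n (map ℤ.-_ x) ]ᵢ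
    flip {x} x∈ = cong [_]ᵢ (trans (flipℤ (at x n) (proj₁ (∈-range1⁻ (absMap-∈ {n} x∈ n∈))))
      (sym (cong (λ v → not (barred v) ∧ (∣ v ∣ ≡ᵇ n)) (at-relabel ℤ.-_ x∈))))

  ∑-last : ∀ (p : ℕ → Bool) → ∑ (B n) (λ x → [ p (absMap x n) ]ᵢ) ≡
    + length (filterᵇ p (range1 n)) ℤ.* (+ 2 ℤ.* + subgroupOrder n)
  ∑-last p = begin
    ∑ (B n) (λ x → [ p (absMap x n) ]ᵢ)
      ≡⟨ ∑-cong (B n) (λ {x} x∈ → ∑-delta (absMap x n) (λ c → [ p c ]ᵢ) (range1-unique n) (absMap-∈ {n} x∈ n∈)) ⟨
    ∑ (B n) (λ x → ∑ (range1 n) (λ c → if absMap x n ≡ᵇ c then [ p c ]ᵢ else + 0))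
      ≡⟨ ∑-swap (B n) (range1 n) (λ x c → if absMap x n ≡ᵇ c then [ p c ]ᵢ else + 0) ⟩
    ∑ (range1 n) (λ c → ∑ (B n) (λ x → if absMap x n ≡ᵇ c then [ p c ]ᵢ else + 0))
      ≡⟨ ∑-cong (range1 n) inner ⟩
    ∑ (range1 n) (λ c → [ p c ]ᵢ ℤ.* (+ 2 ℤ.* + subgroupOrder n))
      ≡⟨ ∑-*ʳ (+ 2 ℤ.* + subgroupOrder n) (range1 n) (λ c → [ p c ]ᵢ) ⟩
    ∑ (range1 n) (λ c → [ p c ]ᵢ) ℤ.* (+ 2 ℤ.* + subgroupOrder n)
      ≡⟨ cong (ℤ._* (+ 2 ℤ.* + subgroupOrder n)) (length-filterᵇ p (range1 n)) ⟨
    + length (filterᵇ p (range1 n)) ℤ.* (+ 2 ℤ.* + subgroupOrder n) ∎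
    where
    open ≡-Reasoning
    pull : ∀ b z → (if b then z else + 0) ≡ z ℤ.* [ b ]ᵢ
    pull true  z = sym (*-identityʳ z)
    pull false z = sym (*-zeroʳ z)
    inner : ∀ {c} → c ∈ range1 n → ∑ (B n) (λ x → if absMap x n ≡ᵇ c then [ p c ]ᵢ else + 0) ≡ [ p c ]ᵢ ℤ.*
        (+ 2 ℤ.* + subgroupOrder n)
    inner {c} c∈ = trans (∑-cong (B n) (λ {x} _ → pull (absMap x n ≡ᵇ c) [ p c ]ᵢ))
      (trans (∑-*ˡ [ p c ]ᵢ (B n) (λ x → [ absMap x n ≡ᵇ c ]ᵢ))
        (cong ([ p c ]ᵢ ℤ.*_) (trans (∑-last-transpose c∈) ∑-last-n)))

-- The comparison is made after doubling: the 2 is absorbed by the traces on one side and supplied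
-- by the two signs of x(n) on the other.
inducedScaled-cycles : ∀ n {g Cs} → 1 ≤ n → g ∈ B n → All (Cycle (absMap g)) Cs → concat Cs ↭ range1 n →
  inducedScaled n g ≡ + subgroupOrder n ℤ.*
    (+ length (filterᵇ (fixesPos g) (range1 n)) ℤ.* ∏ Cs (λ C → + 1 ℤ.+ cycleFactor (signOf ∘ at g) C))
inducedScaled-cycles n {g} {Cs} 1≤n g∈ cs p = ℤₚ.*-cancelˡ-≡ (+ 2) _ _ (begin
  + 2 ℤ.* inducedScaled n g ≡⟨ ∑-*ˡ (+ 2) (B n) (λ x → extChar⁰ n (conj n x g)) ⟨
  ∑ (B n) (λ x → + 2 ℤ.* extChar⁰ n (conj n x g)) ≡⟨ ∑-cong (B n) (λ x∈ → Induced.extChar⁰-conj {n} 1≤n x∈ g∈ cs p) ⟩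
  ∑ (B n) (λ x → P ℤ.* [ fixesPos g (absMap x n) ]ᵢ) ≡⟨ ∑-*ˡ P (B n) (λ x → [ fixesPos g (absMap x n) ]ᵢ) ⟩
  P ℤ.* ∑ (B n) (λ x → [ fixesPos g (absMap x n) ]ᵢ) ≡⟨ cong (P ℤ.*_) (LastCount.∑-last n (∈-range1⁺ 1≤n ≤-refl)
      (fixesPos g)) ⟩
  P ℤ.* (M ℤ.* (+ 2 ℤ.* N)) ≡⟨ arith P M N ⟩
  + 2 ℤ.* (N ℤ.* (M ℤ.* P)) ∎)
  where
  open ≡-Reasoning
  P = ∏ Cs (λ C → + 1 ℤ.+ cycleFactor (signOf ∘ at g) C)
  M = + length (filterᵇ (fixesPos g) (range1 n))
  N = + subgroupOrder n
  arith : ∀ P M N → P ℤ.* (M ℤ.* (+ 2 ℤ.* N)) ≡ + 2 ℤ.* (N ℤ.* (M ℤ.* P))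
  arith = solve-∀

-- The cycle decomposition

iter-+ : ∀ {f : A → A} j k a → iter f (j + k) a ≡ iter f j (iter f k a)
iter-+ zero k a = refl
iter-+ {f = f} (suc j) k a = cong f (iter-+ j k a)

-- `cycLen` unfolds to this search over `range1 n`. The default 0 is not reached once some element
-- passes the test.
first : (ℕ → Bool) → List ℕ → ℕ
first p = foldr (λ k acc → if p k then k else acc) 0

first-spec : ∀ p {L k} → AllPairs _<_ L → k ∈ L → T (p k) → first p L ∈ L × T (p (first p L)) × first p L ≤ k
first-spec p {x ∷ L} (x< ∷ s) k∈ t with p x in e
... | true = here refl , ≡⇒T e , le k∈
  where
  le : ∀ {k} → k ∈ x ∷ L → x ≤ k
  le (here refl) = ≤-refl
  le (there q) = <⇒≤ (All.lookup x< q)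
first-spec p {x ∷ L} (x< ∷ s) (here refl) t | false = ⊥-elim (subst T e t)
first-spec p {x ∷ L} (x< ∷ s) (there q) t | false with first-spec p s q t
... | a , b , c = there a , b , c

list-min : ∀ (x : ℕ) xs → ∃ λ m → m ∈ x ∷ xs × (∀ {j} → j ∈ x ∷ xs → m ≤ j)
list-min x [] = x , here refl , λ { (here refl) → ≤-refl }
list-min x (y ∷ ys) with list-min y ys
... | m , m∈ , le with ≤-total x m
...   | inj₁ x≤m = x , here refl , λ { (here refl) → ≤-refl ; (there j∈) → ≤-trans x≤m (le j∈) }
...   | inj₂ m≤x = m , there m∈ , λ { (here refl) → m≤x ; (there j∈) → le j∈ }

-- F stands for k ↦ fᵏ(i) and is left general because the induction passes from F to `F ∘ suc`.
orbit-chain : ∀ {f : ℕ → ℕ} (F : ℕ → ℕ) {d} j → (∀ k → F (suc k) ≡ f (F k)) → F (suc j) ≡ d →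
  Chain f d (F 0) (applyUpTo (F ∘ suc) j)
orbit-chain F zero h e = end (trans (sym (h 0)) e)
orbit-chain F (suc j) h e = step (sym (h 0)) (orbit-chain (F ∘ suc) j (h ∘ suc) e)

partFactor : ℕ → Bool → ℤ
partFactor k b = + 1 ℤ.+ signB b ℤ.* minusOnePow (k ∸ 1)

typeFactor : SignedComposition → ℤ
typeFactor γ = ∏ γ (λ (k , b) → partFactor k b)

Positive : SignedComposition → Set
Positive γ = All (λ p → 0 < proj₁ p) γ

total : SignedComposition → ℕ
total γ = sum (map proj₁ γ)

module Cycles {n g} (g∈ : g ∈ B n) where

  f : ℕ → ℕ
  f = absMap g

  c : ℕ → ℕ
  c = cycLen n g

  it : ℕ → ℕ → ℕ
  it = iter f

  it-∈ : ∀ k {i} → i ∈ range1 n → it k i ∈ range1 n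
  it-∈ zero i∈ = i∈
  it-∈ (suc k) i∈ = absMap-∈ {n} g∈ (it-∈ k i∈)

  it-injective : ∀ k {i j} → i ∈ range1 n → j ∈ range1 n → it k i ≡ it k j → i ≡ j
  it-injective zero i∈ j∈ e = e
  it-injective (suc k) i∈ j∈ e = it-injective k i∈ j∈ (absMap-injective {n} g∈ (it-∈ k i∈) (it-∈ k j∈) e)

  return : ∀ {i a b} → i ∈ range1 n → a ≤ b → it a i ≡ it b i → it (b ∸ a) i ≡ i
  return {i} {a} {b} i∈ a≤b e = sym (it-injective a i∈ (it-∈ (b ∸ a) i∈)
    (trans e (trans (cong (λ k → it k i) (sym (m+[n∸m]≡n a≤b))) (iter-+ a (b ∸ a) i))))

  -- If none of the first n iterates returned to i, then i and these iterates would be n + 1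
  -- distinct elements of a set of size n, as f can be cancelled from an equality of two iterates.
  period : ∀ {i} → i ∈ range1 n → ∃ λ k → k ∈ range1 n × it k i ≡ i
  period {i} i∈ with any (λ k → it k i ≡ᵇ i) (range1 n) in e
  ... | true with any-⁻ (λ k → it k i ≡ᵇ i) (range1 n) (≡⇒T e)
  ...   | k , k∈ , t = k , k∈ , ≡ᵇ⇒≡ _ _ t
  period {i} i∈ | false = contradiction
    (trans (sym (Listₚ.length-applyUpTo (λ k → it k i) (suc n))) (trans (↭-length L↭) (length-range1 n)))
    ℕₚ.1+n≢n
    where
    L↭ : applyUpTo (λ k → it k i) (suc n) ↭ range1 n
    L↭ = unique-⊆-↭
      (Uniqueₚ.applyUpTo⁺₁ (λ k → it k i) (suc n) λ {a} {b} a<b b<n eq →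
        subst T e (any-⁺ (λ k → it k i ≡ᵇ i)
          (∈-range1⁺ (ℕₚ.m<n⇒0<n∸m a<b) (≤-trans (m∸n≤m b a) (≤-pred b<n)))
          (≡⇒≡ᵇ _ _ (return i∈ (<⇒≤ a<b) eq))))
      (λ x∈ → let k , _ , eq = ∈ₚ.∈-applyUpTo⁻ (λ k → it k i) x∈ in subst (_∈ range1 n) (sym eq) (it-∈ k i∈))
      (≤-trans (≤-reflexive (length-range1 n))
          (≤-trans (n≤1+n n) (≤-reflexive (sym (Listₚ.length-applyUpTo (λ k → it k i) (suc n))))))

  cycLen-spec : ∀ {i k} → k ∈ range1 n → it k i ≡ i → c i ∈ range1 n × it (c i) i ≡ i × c i ≤ k
  cycLen-spec {i} {k} k∈ e with first-spec (λ k → it k i ≡ᵇ i) (range1-sorted n) k∈ (≡⇒≡ᵇ _ _ e)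
  ... | p , q , r = p , ≡ᵇ⇒≡ _ _ q , r

  module _ {i} (i∈ : i ∈ range1 n) where
    private
      spec = cycLen-spec {i} (proj₁ (proj₂ (period i∈))) (proj₂ (proj₂ (period i∈)))

    cycLen≥1 : 1 ≤ c i
    cycLen≥1 = proj₁ (∈-range1⁻ (proj₁ spec))

    it-cycLen : it (c i) i ≡ i
    it-cycLen = proj₁ (proj₂ spec)

    cycLen-min : ∀ {k} → 1 ≤ k → it k i ≡ i → c i ≤ k
    cycLen-min {k} 1≤k e with ≤-total k n
    ... | inj₁ k≤n = proj₂ (proj₂ (cycLen-spec (∈-range1⁺ 1≤k k≤n) e))
    ... | inj₂ n≤k = ≤-trans (proj₂ (∈-range1⁻ (proj₁ spec))) n≤k

    orbit-applyUpTo : orbit n g i ≡ applyUpTo (λ k → it k i) (c i)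
    orbit-applyUpTo = Listₚ.map-upTo (λ k → it k i) (c i)

    length-orbit : length (orbit n g i) ≡ c i
    length-orbit = trans (cong length orbit-applyUpTo) (Listₚ.length-applyUpTo (λ k → it k i) (c i))

    orbit-cycle : Cycle f (orbit n g i)
    orbit-cycle = subst (Cycle f) (sym orbit-applyUpTo) (go (c i) cycLen≥1 it-cycLen)
      where
      go : ∀ l → 1 ≤ l → it l i ≡ i → Cycle f (applyUpTo (λ k → it k i) l)
      go (suc l) _ e = cycle (orbit-chain (λ k → it k i) l (λ _ → refl) e)

    orbit-unique : Unique (orbit n g i)
    orbit-unique = subst Unique (sym orbit-applyUpTo) (Uniqueₚ.applyUpTo⁺₁ (λ k → it k i) (c i)
      λ {a} {b} a<b b<c e → <⇒≱ b<c
        (≤-trans (cycLen-min (ℕₚ.m<n⇒0<n∸m a<b) (return i∈ (<⇒≤ a<b) e)) (m∸n≤m b a)))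

    it-orbit : ∀ k → it k i ∈ orbit n g i
    it-orbit zero = subst (i ∈_) (sym orbit-applyUpTo) (∈ₚ.∈-applyUpTo⁺ (λ k → it k i) cycLen≥1)
    it-orbit (suc k) = Stable.into (cycle-stable orbit-cycle) (it-orbit k)

    orbit-⁻ : ∀ {j} → j ∈ orbit n g i → ∃ λ k → k < c i × j ≡ it k i
    orbit-⁻ j∈ = ∈ₚ.∈-applyUpTo⁻ (λ k → it k i) (subst (_ ∈_) orbit-applyUpTo j∈)

    orbit-∈ : ∀ {j} → j ∈ orbit n g i → j ∈ range1 n
    orbit-∈ j∈ = let k , _ , e = orbit-⁻ j∈ in subst (_∈ range1 n) (sym e) (it-∈ k i∈)

  orbit-sym : ∀ {i j} → i ∈ range1 n → j ∈ orbit n g i → i ∈ orbit n g j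
  orbit-sym {i} {j} i∈ j∈ with orbit-⁻ i∈ j∈
  ... | k , k<c , refl = subst (_∈ orbit n g (it k i)) back (it-orbit (it-∈ k i∈) (c i ∸ k))
    where
    back : it (c i ∸ k) (it k i) ≡ i
    back = trans (sym (iter-+ (c i ∸ k) k i)) (trans (cong (λ l → it l i) (m∸n+n≡m (<⇒≤ k<c))) (it-cycLen i∈))

  orbit-trans : ∀ {i j l} → i ∈ range1 n → j ∈ orbit n g i → l ∈ orbit n g j → l ∈ orbit n g i
  orbit-trans {i} i∈ j∈ l∈ with orbit-⁻ i∈ j∈
  ... | k , _ , refl with orbit-⁻ (it-∈ k i∈) l∈
  ...   | k′ , _ , refl = subst (_∈ orbit n g i) (iter-+ k′ k i) (it-orbit i∈ (k′ + k))

  mins : List ℕ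
  mins = filterᵇ (isCycleMin n g) (range1 n)

  min-⁻ : ∀ {i j} → i ∈ mins → j ∈ orbit n g i → i ≤ j
  min-⁻ {i} i∈ j∈ = ≤ᵇ⇒≤ _ _ (all-⁻ (λ j → i ≤ᵇ j) (orbit n g i)
      (proj₂ (∈-filterᵇ⁻ {p = isCycleMin n g} {xs = range1 n} i∈)) j∈)

  mins-∈ : ∀ {i} → i ∈ mins → i ∈ range1 n
  mins-∈ i∈ = proj₁ (∈-filterᵇ⁻ {p = isCycleMin n g} {xs = range1 n} i∈)

  cover : ∀ {y} → y ∈ range1 n → ∃ λ i → i ∈ mins × y ∈ orbit n g i
  cover {y} y∈ = i , ∈-filterᵇ⁺ {p = isCycleMin n g} i∈R
      (all-⁺ (λ j → i ≤ᵇ j) (orbit n g i) (λ j∈ → ≤⇒≤ᵇ (i≤ (there (orbit-trans y∈ i∈ j∈))))) , orbit-sym y∈ i∈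
    where
    -- y already lies in its orbit; it is put in front only to make the list visibly nonempty.
    m = list-min y (orbit n g y)
    i = proj₁ m
    i≤ : ∀ {j} → j ∈ y ∷ orbit n g y → i ≤ j
    i≤ = proj₂ (proj₂ m)
    tail : ∀ {j} → j ∈ y ∷ orbit n g y → j ∈ orbit n g y
    tail (here refl) = it-orbit y∈ 0
    tail (there j∈) = j∈
    i∈ : i ∈ orbit n g y
    i∈ = tail (proj₁ (proj₂ m))
    i∈R : i ∈ range1 n
    i∈R = orbit-∈ y∈ i∈

  cycles : List (List ℕ)
  cycles = map (orbit n g) mins

  cycles-cycle : All (Cycle f) cycles
  cycles-cycle = Allₚ.map⁺ (All.tabulate (orbit-cycle ∘ mins-∈))

  cycles-cover : concat cycles ↭ range1 n
  cycles-cover = unique-↭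
    (concatMap-unique (Uniqueₚ.filter⁺ (T? ∘ isCycleMin n g) (range1-unique n)) (orbit-unique ∘ mins-∈)
      (λ a∈ b∈ p q → ≤-antisym (min-⁻ a∈ (orbit-trans (mins-∈ a∈) p (orbit-sym (mins-∈ b∈) q)))
                                   (min-⁻ b∈ (orbit-trans (mins-∈ b∈) q (orbit-sym (mins-∈ a∈) p)))))
    (range1-unique n)
    (λ y∈ → let i , i∈ , p = find (∈-concatMap⁻ (orbit n g) {mins} y∈) in orbit-∈ (mins-∈ i∈) p)
    (λ y∈ → let i , i∈ , p = cover y∈ in ∈-concatMap⁺ (orbit n g) {mins} (lose i∈ p))

  ∣iter-applyS∣ : ∀ k i → ∣ iter (applyS g) k (+ i) ∣ ≡ it k i
  ∣iter-applyS∣ zero i = refl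
  ∣iter-applyS∣ (suc k) i = trans (∣applyS∣ g (iter (applyS g) k (+ i))) (cong f (∣iter-applyS∣ k i))

  -- Following the signed letter multiplies up the signs met on the way. After a full turn this
  -- identifies the test `cycleNeg` with the product of the signs over the cycle.
  signOf-iter : ∀ k {i} → i ∈ range1 n →
    signOf (iter (applyS g) k (+ i)) ≡ ∏ (applyUpTo (λ t → it t i) k) (signOf ∘ at g)
  signOf-iter zero i∈ = refl
  signOf-iter (suc k) {i} i∈ = begin
    signOf (applyS g v) ≡⟨ signOf-applyS g v (subst (λ j → 1 ≤ f j) (sym (∣iter-applyS∣ k i))
        (proj₁ (∈-range1⁻ (it-∈ (suc k) i∈)))) ⟩
    signOf v ℤ.* signOf (at g ∣ v ∣) ≡⟨ cong₂ ℤ._*_ (signOf-iter k i∈) (cong (signOf ∘ at g) (∣iter-applyS∣ k i)) ⟩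
    ∏ (applyUpTo F k) s ℤ.* s (it k i) ≡⟨ cong (∏ (applyUpTo F k) s ℤ.*_) (*-identityʳ (s (it k i))) ⟨
    ∏ (applyUpTo F k) s ℤ.* ∏ [ it k i ] s ≡⟨ ∏-++ (applyUpTo F k) s ⟨
    ∏ (applyUpTo F k ++ [ it k i ]) s ≡⟨ cong (λ l → ∏ l s) (Listₚ.applyUpTo-∷ʳ F k) ⟩
    ∏ (applyUpTo F (suc k)) s ∎
    where
    open ≡-Reasoning
    v = iter (applyS g) k (+ i)
    s = signOf ∘ at g
    F = λ t → it t i

  cycleFactor-orbit : ∀ {i} → i ∈ range1 n →
    + 1 ℤ.+ cycleFactor (signOf ∘ at g) (orbit n g i) ≡ partFactor (c i) (cycleNeg n g i)
  cycleFactor-orbit {i} i∈ = cong (ℤ._+_ (+ 1)) (cong₂ ℤ._*_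
    (trans (cong (λ l → ∏ l (signOf ∘ at g)) (orbit-applyUpTo i∈)) (sym (signOf-iter (c i) i∈)))
    (cong (λ k → minusOnePow (k ∸ 1)) (length-orbit i∈)))

  ∏-filter-split : ∀ (p q : ℕ → Bool) xs (F : ℕ → ℤ) →
    ∏ (filterᵇ p xs) F ≡ ∏ (filterᵇ (λ i → p i ∧ not (q i)) xs) F ℤ.* ∏ (filterᵇ (λ i → p i ∧ q i) xs) F
  ∏-filter-split p q [] F = refl
  ∏-filter-split p q (x ∷ xs) F with p x | q x
  ... | false | _     = ∏-filter-split p q xs F
  ... | true  | false = trans (cong (F x ℤ.*_) (∏-filter-split p q xs F)) (sym (ℤₚ.*-assoc (F x) _ _))
  ... | true  | true  = trans (cong (F x ℤ.*_) (∏-filter-split p q xs F))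
    (swap-* (F x) (∏ (filterᵇ (λ i → p i ∧ not (q i)) xs) F) (∏ (filterᵇ (λ i → p i ∧ q i) xs) F))

  ∏-cycles : ∏ cycles (λ C → + 1 ℤ.+ cycleFactor (signOf ∘ at g) C) ≡
    ∏ (posCycleLengths n g) (λ k → partFactor k false) ℤ.* ∏ (negCycleLengths n g) (λ k → partFactor k true)
  ∏-cycles = begin
    ∏ cycles (λ C → + 1 ℤ.+ cycleFactor (signOf ∘ at g) C) ≡⟨ ∏-map (orbit n g) mins _ ⟩
    ∏ mins (λ i → + 1 ℤ.+ cycleFactor (signOf ∘ at g) (orbit n g i)) ≡⟨ ∏-cong mins (cycleFactor-orbit ∘ mins-∈) ⟩
    ∏ mins (λ i → partFactor (c i) (cycleNeg n g i))
      ≡⟨ ∏-filter-split (isCycleMin n g) (cycleNeg n g) (range1 n) (λ i → partFactor (c i) (cycleNeg n g i)) ⟩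
    ∏ pos (λ i → partFactor (c i) (cycleNeg n g i)) ℤ.* ∏ neg (λ i → partFactor (c i) (cycleNeg n g i))
      ≡⟨ cong₂ ℤ._*_
           (∏-cong pos (λ {i} i∈ → cong (partFactor (c i))
               (not-T (proj₂ (∧-⁻ {isCycleMin n g i}
                   (proj₂ (∈-filterᵇ⁻ {p = λ i → isCycleMin n g i ∧ not (cycleNeg n g i)} {xs = range1 n} i∈)))))))
           (∏-cong neg (λ {i} i∈ → cong (partFactor (c i))
               (T⇒≡ (proj₂ (∧-⁻ {isCycleMin n g i} (proj₂ (∈-filterᵇ⁻ {p = λ i → isCycleMin n g i ∧ cycleNeg n g i}
                   {xs = range1 n} i∈))))))) ⟩
    ∏ pos (λ i → partFactor (c i) false) ℤ.* ∏ neg (λ i → partFactor (c i) true)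
      ≡⟨ cong₂ ℤ._*_ (∏-map c pos (λ k → partFactor k false)) (∏-map c neg (λ k → partFactor k true)) ⟨
    ∏ (posCycleLengths n g) (λ k → partFactor k false) ℤ.* ∏ (negCycleLengths n g) (λ k → partFactor k true) ∎
    where
    open ≡-Reasoning
    pos = filterᵇ (λ i → isCycleMin n g i ∧ not (cycleNeg n g i)) (range1 n)
    neg = filterᵇ (λ i → isCycleMin n g i ∧ cycleNeg n g i) (range1 n)

  -- The right side begins with the filter defining `posCycleLengths`, so counting positive fixed
  -- points becomes counting the entries 1 of that list.
  fixesPos-cycle : ∀ {i} → i ∈ range1 n →
    fixesPos g i ≡ (isCycleMin n g i ∧ not (cycleNeg n g i)) ∧ (1 ≡ᵇ c i)
  fixesPos-cycle {i} i∈ = T-ext to from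
    where
    to : T (fixesPos g i) → T ((isCycleMin n g i ∧ not (cycleNeg n g i)) ∧ (1 ≡ᵇ c i))
    to t = ∧-⁺ (∧-⁺ (all-⁺ (λ j → i ≤ᵇ j) (orbit n g i) (λ j∈ → ≤⇒≤ᵇ (≤-reflexive (lone j∈))))
                    (subst (λ k → T (not (barred (iter (applyS g) k (+ i))))) (sym c≡1)
                        (subst (T ∘ not) (sym (fixesPos-sign g i t)) tt)))
               (≡⇒≡ᵇ _ _ (sym c≡1))
      where
      c≡1 : c i ≡ 1
      c≡1 = ≤-antisym (cycLen-min i∈ ≤-refl (fixesPos-∣∣ g i t)) (cycLen≥1 i∈)
      lone : ∀ {j} → j ∈ orbit n g i → i ≡ j
      lone j∈ with orbit-⁻ i∈ j∈
      ... | k , k<c , e with subst (k <_) c≡1 k<c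
      lone j∈ | zero , k<c , e | _ = sym e
      lone j∈ | suc k , k<c , e | s≤s ()
    from : T ((isCycleMin n g i ∧ not (cycleNeg n g i)) ∧ (1 ≡ᵇ c i)) → T (fixesPos g i)
    from t = fixesPos-intro g i
        (trans (cong (λ k → barred (iter (applyS g) k (+ i))) c≡1) (not-T (proj₂ (∧-⁻ {isCycleMin n g i} (proj₁ t′)))))
        (trans (cong (λ k → it k i) c≡1) (it-cycLen i∈))
      where
      t′ = ∧-⁻ {isCycleMin n g i ∧ not (cycleNeg n g i)} t
      c≡1 : 1 ≡ c i
      c≡1 = ≡ᵇ⇒≡ _ _ (proj₂ t′)

  count-fixesPos : + length (filterᵇ (fixesPos g) (range1 n)) ≡ + countᵇ 1 (posCycleLengths n g)
  count-fixesPos = begin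
    + length (filterᵇ (fixesPos g) (range1 n)) ≡⟨ length-filterᵇ (fixesPos g) (range1 n) ⟩
    ∑ (range1 n) (λ i → [ fixesPos g i ]ᵢ) ≡⟨ ∑-cong (range1 n) (λ {i} i∈ → trans (cong [_]ᵢ (fixesPos-cycle i∈))
        (and-if (q i) (1 ≡ᵇ c i))) ⟩
    ∑ (range1 n) (λ i → if q i then [ 1 ≡ᵇ c i ]ᵢ else + 0) ≡⟨ ∑-filterᵇ q (range1 n) (λ i → [ 1 ≡ᵇ c i ]ᵢ) ⟨
    ∑ (filterᵇ q (range1 n)) (λ i → [ 1 ≡ᵇ c i ]ᵢ) ≡⟨ ∑-map c (filterᵇ q (range1 n)) (λ k → [ 1 ≡ᵇ k ]ᵢ) ⟨
    ∑ (posCycleLengths n g) (λ k → [ 1 ≡ᵇ k ]ᵢ) ≡⟨ length-filterᵇ (1 ≡ᵇ_) (posCycleLengths n g) ⟨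
    + countᵇ 1 (posCycleLengths n g) ∎
    where
    open ≡-Reasoning
    q : ℕ → Bool
    q i = isCycleMin n g i ∧ not (cycleNeg n g i)
    and-if : ∀ a b → [ a ∧ b ]ᵢ ≡ (if a then [ b ]ᵢ else + 0)
    and-if true  b = refl
    and-if false b = refl

∏-parts : ∀ γ → typeFactor γ ≡
  ∏ (unbarredParts γ) (λ k → partFactor k false) ℤ.* ∏ (barredParts γ) (λ k → partFactor k true)
∏-parts [] = refl
∏-parts ((k , false) ∷ γ) = trans (cong (partFactor k false ℤ.*_) (∏-parts γ))
    (sym (ℤₚ.*-assoc (partFactor k false) _ _))
∏-parts ((k , true) ∷ γ) = trans (cong (partFactor k true ℤ.*_) (∏-parts γ))
  (swap-* (partFactor k true) (∏ (unbarredParts γ) (λ k → partFactor k false))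
      (∏ (barredParts γ) (λ k → partFactor k true)))

inducedScaled-type : ∀ n γ {g} → 1 ≤ n → g ∈ B n →
  unbarredParts γ ↭ posCycleLengths n g → barredParts γ ↭ negCycleLengths n g →
  inducedScaled n g ≡ + subgroupOrder n ℤ.* (+ countᵇ 1 (unbarredParts γ) ℤ.* typeFactor γ)
inducedScaled-type n γ {g} 1≤n g∈ pos neg = trans (inducedScaled-cycles n 1≤n g∈ cycles-cycle cycles-cover)
  (cong (+ subgroupOrder n ℤ.*_) (cong₂ ℤ._*_
    (trans count-fixesPos (cong +_ (sym (countᵇ-↭ 1 pos))))
    (trans ∏-cycles (sym (trans (∏-parts γ) (cong₂ ℤ._*_ (∏-↭ (λ k → partFactor k false) pos)
        (∏-↭ (λ k → partFactor k true) neg)))))))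
  where open Cycles {n} g∈

-- Block weights

eqBool-⁻ : ∀ {a b} → T (eqBool a b) → a ≡ b
eqBool-⁻ {true}  {true}  _ = refl
eqBool-⁻ {false} {false} _ = refl

eqBool-⁺ : ∀ {a b} → a ≡ b → T (eqBool a b)
eqBool-⁺ {true}  refl = tt
eqBool-⁺ {false} refl = tt

-- The initial-segment test of `blockOK` with positions counted from the start of the block. The
-- last position k is left out, since a block end is never an inner descent.
isInitial : (ℕ → Bool) → ℕ → Bool
isInitial d k = any (λ t → all (λ j → eqBool (d j) (j ≤ᵇ t)) (range1 (k ∸ 1))) (upTo (suc (k ∸ 1)))

-- The unsigned weight of a block of size k whose inner descents are given by d, with positions counted from the start of the block.
blockValue : (ℕ → Bool) → ℕ → ℤ
blockValue d k = if isInitial d k then minusOnePow (length (filterᵇ d (range1 (k ∸ 1)))) else + 0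

filterᵇ-cong : ∀ {p q : A → Bool} xs → (∀ {x} → x ∈ xs → p x ≡ q x) → filterᵇ p xs ≡ filterᵇ q xs
filterᵇ-cong [] h = refl
filterᵇ-cong {p = p} {q} (x ∷ xs) h with p x | q x | h (here refl)
... | true  | _ | refl = cong (x ∷_) (filterᵇ-cong xs (h ∘ there))
... | false | _ | refl = filterᵇ-cong xs (h ∘ there)

all-cong : ∀ {p q : A → Bool} xs → (∀ {x} → x ∈ xs → p x ≡ q x) → all p xs ≡ all q xs
all-cong [] h = refl
all-cong (x ∷ xs) h = cong₂ _∧_ (h (here refl)) (all-cong xs (h ∘ there))

any-cong : ∀ {p q : A → Bool} xs → (∀ {x} → x ∈ xs → p x ≡ q x) → any p xs ≡ any q xs
any-cong [] h = refl
any-cong (x ∷ xs) h = cong₂ _∨_ (h (here refl)) (any-cong xs (h ∘ there))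

blockValue-cong : ∀ {d d′ : ℕ → Bool} k → (∀ {j} → j ∈ range1 (k ∸ 1) → d j ≡ d′ j) → blockValue d k ≡ blockValue d′ k
blockValue-cong k h = cong₂ (λ b l → if b then minusOnePow (length l) else + 0)
  (any-cong (upTo (suc (k ∸ 1))) (λ {t} _ → all-cong (range1 (k ∸ 1)) (λ {j} j∈ → cong (λ b → eqBool b (j ≤ᵇ t))
      (h j∈))))
  (filterᵇ-cong (range1 (k ∸ 1)) h)

range1-∷ʳ : ∀ m → range1 (suc m) ≡ range1 m ++ [ suc m ]
range1-∷ʳ m = trans (cong (map suc) (sym (Listₚ.applyUpTo-∷ʳ id m))) (map-++ suc (upTo m) [ m ])

count-initial : ∀ m t → t ≤ m → length (filterᵇ (_≤ᵇ t) (range1 m)) ≡ t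
count-initial m t t≤m = trans (↭-length p) (length-range1 t)
  where
  p : filterᵇ (_≤ᵇ t) (range1 m) ↭ range1 t
  p = unique-↭ (Uniqueₚ.filter⁺ (T? ∘ (_≤ᵇ t)) (range1-unique m)) (range1-unique t)
    (λ {x} x∈ → let y∈ , le = ∈-filterᵇ⁻ {p = _≤ᵇ t} {xs = range1 m} x∈ in ∈-range1⁺ (proj₁ (∈-range1⁻ y∈)) (≤ᵇ⇒≤ x t le))
    (λ x∈ → let l , r = ∈-range1⁻ x∈ in ∈-filterᵇ⁺ {p = _≤ᵇ t} (∈-range1⁺ l (≤-trans r t≤m)) (≤⇒≤ᵇ r))

blockValue-initial : ∀ {d} k t → t ≤ k ∸ 1 → (∀ {j} → j ∈ range1 (k ∸ 1) → d j ≡ (j ≤ᵇ t)) → blockValue d k ≡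
    minusOnePow t
blockValue-initial {d} k t t≤ h
  rewrite T⇒≡ {isInitial d k} (any-⁺ (λ t → all (λ j → eqBool (d j) (j ≤ᵇ t)) (range1 (k ∸ 1))) (∈-upTo⁺ (s≤s t≤))
    (all-⁺ (λ j → eqBool (d j) (j ≤ᵇ t)) (range1 (k ∸ 1)) (λ j∈ → eqBool-⁺ (h j∈))))
  | filterᵇ-cong {p = d} {_≤ᵇ t} (range1 (k ∸ 1)) h = cong minusOnePow (count-initial (k ∸ 1) t t≤)

blockValue-gap : ∀ {d} k i j → i ∈ range1 (k ∸ 1) → j ∈ range1 (k ∸ 1) → i < j → d i ≡ false → d j ≡ true →
    blockValue d k ≡ + 0
blockValue-gap {d} k i j i∈ j∈ i<j di dj =
  cong (λ b → if b then minusOnePow (length (filterᵇ d (range1 (k ∸ 1)))) else + 0) (¬T⇒≡ {isInitial d k} notInitial)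
  where
  notInitial : ¬ T (isInitial d k)
  notInitial t with any-⁻ (λ t → all (λ j → eqBool (d j) (j ≤ᵇ t)) (range1 (k ∸ 1))) (upTo (suc (k ∸ 1))) t
  ... | s , _ , q = ⊥-elim (subst T di (subst T (sym (eqBool-⁻ {d i} (test i∈)))
      (≤⇒≤ᵇ (≤-trans (<⇒≤ i<j) (≤ᵇ⇒≤ j s (subst T (eqBool-⁻ {d j} (test j∈)) (≡⇒T dj)))))))
    where
    test : ∀ {x} → x ∈ range1 (k ∸ 1) → T (eqBool (d x) (x ≤ᵇ s))
    test = all-⁻ (λ j → eqBool (d j) (j ≤ᵇ s)) (range1 (k ∸ 1)) q

-- q is the position of the letter n, counted from the start of the block (so it may be 0 or exceed k).
-- In an unbarred block the only possible inner descent is at q, in a barred one the only possible inner ascent is at q - 1.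
descents : Bool → ℕ → ℕ → Bool
descents false q t = t ≡ᵇ q
descents true  q t = not (suc t ≡ᵇ q)

-- There is no inner descent. The case q = k belongs here because a descent at the end of the block
-- is not inner.
valF-out : ∀ k q → q ≡ 0 ⊎ k ≤ q → blockValue (descents false q) k ≡ + 1
valF-out k q h = blockValue-initial k 0 z≤n λ {j} j∈ → trans
    (≢⇒≡ᵇ-false (λ e → [ (λ z → <⇒≢ (proj₁ (∈-range1⁻ j∈)) (sym (trans e z)))
                          , (λ k≤q → <⇒≱ (inner<k j∈) (subst (k ≤_) (sym e) k≤q)) ]′ h))
    (sym (¬T⇒≡ (λ t → <⇒≱ (proj₁ (∈-range1⁻ j∈)) (≤ᵇ⇒≤ j 0 t))))
  where
  inner<k : ∀ {j} → j ∈ range1 (k ∸ 1) → j < k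
  inner<k j∈ = go k (∈-range1⁻ j∈)
    where
    go : ∀ k {j} → 1 ≤ j × j ≤ k ∸ 1 → j < k
    go zero (s≤s _ , ())
    go (suc k) (_ , le) = s≤s le

-- The single descent at position 1 is an initial segment of length 1. For a larger q inside the
-- block, as in `valF-mid`, position 1 is no descent and the segment is not initial.
valF-first : ∀ k → blockValue (descents false 1) (suc (suc k)) ≡ ℤ.- (+ 1)
valF-first k = blockValue-initial {descents false 1} (suc (suc k)) 1 (s≤s z≤n) λ { {suc zero} _ → refl ; {suc (suc j)} _ → refl ; {zero} j∈ → ⊥-elim (<⇒≱ (proj₁ (∈-range1⁻ j∈)) z≤n) }

valF-mid : ∀ k q → 1 < q → q < k → blockValue (descents false q) k ≡ + 0
valF-mid (suc k) q 1<q (s≤s q≤k) = blockValue-gap (suc k) 1 q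
  (∈-range1⁺ ≤-refl (≤-trans (<⇒≤ 1<q) q≤k)) (∈-range1⁺ (<⇒≤ 1<q) q≤k) 1<q
  (≢⇒≡ᵇ-false (<⇒≢ 1<q)) (≡ᵇ-refl q)

-- For q = 1 the ascent at q - 1 falls just before the block, so all k inner positions are descents.
valT-out : ∀ k q → q ≤ 1 ⊎ suc k < q → blockValue (descents true q) (suc k) ≡ minusOnePow k
valT-out k q h = blockValue-initial (suc k) k ≤-refl λ {j} j∈ → trans
    (cong not (≢⇒≡ᵇ-false {suc j} {q} λ { refl →
      [ (λ { (s≤s j≤0) → <⇒≱ (proj₁ (∈-range1⁻ j∈)) j≤0 }) , (λ { (s≤s k<j) → <⇒≱ k<j (proj₂ (∈-range1⁻ j∈)) }) ]′ h }))
    (sym (T⇒≡ (≤⇒≤ᵇ (proj₂ (∈-range1⁻ j∈)))))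

-- The ascent takes the last inner position k + 1, and the k descents before it still form an
-- initial segment. An earlier ascent, as in `valT-mid`, is followed by a descent and gives 0.
valT-last : ∀ k → blockValue (descents true (suc (suc k))) (suc (suc k)) ≡ minusOnePow k
valT-last k = blockValue-initial {descents true (suc (suc k))} (suc (suc k)) k (n≤1+n k) λ {j} j∈ → T-ext
    (λ t → ≤⇒≤ᵇ (≤-pred (≤∧≢⇒< (proj₂ (∈-range1⁻ j∈)) (λ e → subst (T ∘ not) (T⇒≡ (≡⇒≡ᵇ j (suc k) e)) t))))
    (λ t → subst (T ∘ not) (sym (≢⇒≡ᵇ-false (<⇒≢ (s≤s (≤ᵇ⇒≤ j k t))))) tt)

valT-mid : ∀ k q → 1 < q → q < suc k → blockValue (descents true q) (suc k) ≡ + 0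
valT-mid k (suc q) (s≤s 1≤q) (s≤s q<k) = blockValue-gap (suc k) q k
  (∈-range1⁺ 1≤q (<⇒≤ q<k)) (∈-range1⁺ (≤-trans 1≤q (<⇒≤ q<k)) ≤-refl) q<k
  (cong not (≡ᵇ-refl q)) (cong not (≢⇒≡ᵇ-false (<⇒≢ q<k ∘ sym)))

blockWeight : ℕ → Bool → Bool → ℕ → ℤ
blockWeight k b e q = signB (b ∧ e) ℤ.* blockValue (descents e q) k

blockTotal : ℕ → Bool → ℕ → ℤ
blockTotal k b q = blockWeight k b true q ℤ.+ blockWeight k b false q

private
  total-arith : ∀ s x y → s ℤ.* x ℤ.+ + 1 ℤ.* y ≡ y ℤ.+ s ℤ.* x
  total-arith = solve-∀

blockTotal-def : ∀ k b q → blockTotal k b q ≡ blockValue (descents false q) k ℤ.+ signB b ℤ.* blockValue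
    (descents true q) k
blockTotal-def k true  q = total-arith (ℤ.- (+ 1)) (blockValue (descents true q) k) (blockValue (descents false q) k)
blockTotal-def k false q = total-arith (+ 1) (blockValue (descents true q) k) (blockValue (descents false q) k)

blockTotal-out : ∀ k b q → 1 ≤ k → q ≡ 0 ⊎ k < q → blockTotal k b q ≡ partFactor k b
blockTotal-out (suc k) b q _ h = trans (blockTotal-def (suc k) b q) (cong₂ (λ x y → x ℤ.+ signB b ℤ.* y)
  (valF-out (suc k) q ([ inj₁ , inj₂ ∘ <⇒≤ ]′ h))
  (valT-out k q ([ (λ { refl → inj₁ z≤n }) , inj₂ ]′ h)))

-- For k at least 2 and s the sign of b, q = 1 gives -(1 + s(-1)^k), q = k gives 1 + s(-1)^k, and
-- all q in between give 0. For k = 1 the total is `partFactor 1 b`, which vanishes when the part is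
-- barred.
∑-blockTotal : ∀ k b → 1 ≤ k → ∑ (range1 k) (blockTotal k b) ≡ [ (1 ≡ᵇ k) ∧ not b ]ᵢ ℤ.* partFactor k b
∑-blockTotal (suc zero) true  _ = refl
∑-blockTotal (suc zero) false _ = refl
∑-blockTotal (suc (suc k)) b _ = begin
  ∑ (range1 K) (blockTotal K b) ≡⟨ cong (λ l → ∑ l (blockTotal K b)) (trans (range1-∷ʳ (suc k))
      (cong (_++ [ K ]) (range1-∷ k))) ⟩
  blockTotal K b 1 ℤ.+ ∑ (map suc (range1 k) ++ [ K ]) (blockTotal K b)
    ≡⟨ cong (ℤ._+_ (blockTotal K b 1)) (∑-++ (map suc (range1 k)) (blockTotal K b)) ⟩
  blockTotal K b 1 ℤ.+ (∑ (map suc (range1 k)) (blockTotal K b) ℤ.+ (blockTotal K b K ℤ.+ + 0))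
    ≡⟨ cong₂ ℤ._+_ firstTotal (cong₂ (λ x y → x ℤ.+ (y ℤ.+ + 0)) (∑-0 (map suc (range1 k)) middle) lastTotal) ⟩
  (ℤ.- (+ 1) ℤ.+ signB b ℤ.* (ℤ.- minusOnePow k)) ℤ.+ (+ 0 ℤ.+ ((+ 1 ℤ.+ signB b ℤ.* minusOnePow k) ℤ.+ + 0))
    ≡⟨ arith (signB b) (minusOnePow k) ⟩
  + 0 ∎
  where
  open ≡-Reasoning
  K = suc (suc k)
  arith : ∀ s m → (ℤ.- (+ 1) ℤ.+ s ℤ.* (ℤ.- m)) ℤ.+ (+ 0 ℤ.+ ((+ 1 ℤ.+ s ℤ.* m) ℤ.+ + 0)) ≡ + 0
  arith = solve-∀
  firstTotal : blockTotal K b 1 ≡ ℤ.- (+ 1) ℤ.+ signB b ℤ.* (ℤ.- minusOnePow k)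
  firstTotal = trans (blockTotal-def K b 1) (cong₂ (λ x y → x ℤ.+ signB b ℤ.* y) (valF-first k)
    (trans (valT-out (suc k) 1 (inj₁ ≤-refl)) (minusOnePow-suc k)))
  lastTotal : blockTotal K b K ≡ + 1 ℤ.+ signB b ℤ.* minusOnePow k
  lastTotal = trans (blockTotal-def K b K) (cong₂ (λ x y → x ℤ.+ signB b ℤ.* y) (valF-out K K (inj₂ ≤-refl))
      (valT-last k))
  middle : ∀ {q} → q ∈ map suc (range1 k) → blockTotal K b q ≡ + 0
  middle {q} q∈ with ∈-map⁻ suc q∈
  ... | r , r∈ , refl with ∈-range1⁻ r∈
  ...   | 1≤r , r≤k = trans (blockTotal-def K b (suc r))
    (trans (cong₂ (λ x y → x ℤ.+ signB b ℤ.* y) (valF-mid K (suc r) (s≤s 1≤r) (s≤s (s≤s r≤k)))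
        (valT-mid (suc k) (suc r) (s≤s 1≤r) (s≤s (s≤s r≤k))))
      (trans (+-identityˡ _) (*-zeroʳ (signB b))))

-- Summation over sign words and over the position of n

bools : List Bool
bools = true ∷ false ∷ []

∑-words-++ : ∀ (xs : List A) k l (Φ : List A → ℤ) →
  ∑ (words xs (k + l)) Φ ≡ ∑ (words xs k) (λ u → ∑ (words xs l) (λ v → Φ (u ++ v)))
∑-words-++ xs zero l Φ = sym (ℤₚ.+-identityʳ _)
∑-words-++ xs (suc k) l Φ = begin
  ∑ (words xs (suc k + l)) Φ ≡⟨ ∑-words-∷ (k + l) Φ ⟩
  ∑ xs (λ a → ∑ (words xs (k + l)) (Φ ∘ (a ∷_))) ≡⟨ ∑-cong xs (λ {a} _ → ∑-words-++ xs k l (Φ ∘ (a ∷_))) ⟩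
  ∑ xs (λ a → ∑ (words xs k) (λ u → ∑ (words xs l) (λ v → Φ (a ∷ u ++ v)))) ≡⟨ ∑-words-∷ k
      (λ u → ∑ (words xs l) (λ v → Φ (u ++ v))) ⟨
  ∑ (words xs (suc k)) (λ u → ∑ (words xs l) (λ v → Φ (u ++ v))) ∎
  where
  open ≡-Reasoning
  ∑-words-∷ : ∀ k Φ → ∑ (words xs (suc k)) Φ ≡ ∑ xs (λ a → ∑ (words xs k) (Φ ∘ (a ∷_)))
  ∑-words-∷ k Φ = trans (∑-concatMap (λ a → map (a ∷_) (words xs k)) xs Φ)
      (∑-cong xs (λ {a} _ → ∑-map (a ∷_) (words xs k) Φ))

constant : List Bool → Bool
constant []      = true
constant (e ∷ v) = all (λ c → eqBool c e) (e ∷ v)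

first-sign : List Bool → Bool
first-sign []      = false
first-sign (e ∷ _) = e

localWeight : ℕ → Bool → List Bool → ℕ → ℤ
localWeight k b v q = if constant v then blockWeight k b (first-sign v) q else + 0

∑-constant : ∀ k e z → ∑ (words bools k) (λ v → if all (λ c → eqBool c e) v then z else + 0) ≡ z
∑-constant zero e z = ℤₚ.+-identityʳ z
∑-constant (suc k) e z = begin
  ∑ (words bools (suc k)) Φ ≡⟨ ∑-concatMap (λ a → map (a ∷_) (words bools k)) bools Φ ⟩
  ∑ (map (true ∷_) (words bools k)) Φ ℤ.+ (∑ (map (false ∷_) (words bools k)) Φ ℤ.+ + 0)
    ≡⟨ cong₂ (λ x y → x ℤ.+ (y ℤ.+ + 0)) (∑-map (true ∷_) (words bools k) Φ) (∑-map (false ∷_) (words bools k) Φ) ⟩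
  ∑ (words bools k) (Φ ∘ (true ∷_)) ℤ.+ (∑ (words bools k) (Φ ∘ (false ∷_)) ℤ.+ + 0) ≡⟨ split e ⟩
  z ∎
  where
  open ≡-Reasoning
  Φ : List Bool → ℤ
  Φ v = if all (λ c → eqBool c e) v then z else + 0
  split : ∀ e → ∑ (words bools k) (λ v → if eqBool true e ∧ all (λ c → eqBool c e) v then z else + 0)
    ℤ.+ (∑ (words bools k) (λ v → if eqBool false e ∧ all (λ c → eqBool c e) v then z else + 0) ℤ.+ + 0) ≡ z
  split true  = trans (cong₂ (λ x y → x ℤ.+ (y ℤ.+ + 0)) (∑-constant k true z) (∑-0 (words bools k) (λ _ → refl)))
      (ℤₚ.+-identityʳ z)
  split false = trans (cong₂ (λ x y → x ℤ.+ (y ℤ.+ + 0)) (∑-0 (words bools k) (λ _ → refl)) (∑-constant k false z))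
    (trans (+-identityˡ _) (ℤₚ.+-identityʳ z))

∑-localWeight : ∀ k b q → 1 ≤ k → ∑ (words bools k) (λ v → localWeight k b v q) ≡ blockTotal k b q
∑-localWeight (suc k) b q _ = begin
  ∑ (words bools (suc k)) Φ ≡⟨ ∑-concatMap (λ a → map (a ∷_) (words bools k)) bools Φ ⟩
  ∑ (map (true ∷_) (words bools k)) Φ ℤ.+ (∑ (map (false ∷_) (words bools k)) Φ ℤ.+ + 0)
    ≡⟨ cong₂ (λ x y → x ℤ.+ (y ℤ.+ + 0)) (∑-map (true ∷_) (words bools k) Φ) (∑-map (false ∷_) (words bools k) Φ) ⟩
  ∑ (words bools k) (Φ ∘ (true ∷_)) ℤ.+ (∑ (words bools k) (Φ ∘ (false ∷_)) ℤ.+ + 0)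
    ≡⟨ cong₂ (λ x y → x ℤ.+ (y ℤ.+ + 0)) (∑-constant k true (blockWeight (suc k) b true q))
        (∑-constant k false (blockWeight (suc k) b false q)) ⟩
  blockWeight (suc k) b true q ℤ.+ (blockWeight (suc k) b false q ℤ.+ + 0) ≡⟨ cong
      (ℤ._+_ (blockWeight (suc k) b true q)) (ℤₚ.+-identityʳ (blockWeight (suc k) b false q)) ⟩
  blockTotal (suc k) b q ∎
  where
  open ≡-Reasoning
  Φ : List Bool → ℤ
  Φ v = localWeight (suc k) b v q

-- The truncation in `q ∸ k` is deliberate: once the letter n has been passed, all later blocks
-- receive the position 0, which they treat as lying outside.
wordWeight : SignedComposition → List Bool → ℕ → ℤ
wordWeight []            u q = + 1
wordWeight ((k , b) ∷ γ) u q = localWeight k b (take k u) q ℤ.* wordWeight γ (drop k u) (q ∸ k)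

totalWeight : SignedComposition → ℕ → ℤ
totalWeight []            q = + 1
totalWeight ((k , b) ∷ γ) q = blockTotal k b q ℤ.* totalWeight γ (q ∸ k)

wordWeight-++ : ∀ {k} b γ u v q → length u ≡ k →
  wordWeight ((k , b) ∷ γ) (u ++ v) q ≡ localWeight k b u q ℤ.* wordWeight γ v (q ∸ k)
wordWeight-++ {k} b γ u v q refl =
  cong₂ (λ x y → localWeight k b x q ℤ.* wordWeight γ y (q ∸ k)) (take-length-++ u) (drop-length-++ u)
  where
  take-length-++ : ∀ u → take (length u) (u ++ v) ≡ u
  take-length-++ [] = refl
  take-length-++ (x ∷ u) = cong (x ∷_) (take-length-++ u)
  drop-length-++ : ∀ u → drop (length u) (u ++ v) ≡ v
  drop-length-++ [] = refl
  drop-length-++ (x ∷ u) = drop-length-++ u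

∑-wordWeight : ∀ γ q → Positive γ →
  ∑ (words bools (total γ)) (λ u → wordWeight γ u q) ≡ totalWeight γ q
∑-wordWeight [] q [] = refl
∑-wordWeight ((k , b) ∷ γ) q (0<k ∷ pos) = begin
  ∑ (words bools (k + N)) (λ u → wordWeight ((k , b) ∷ γ) u q) ≡⟨ ∑-words-++ bools k N
      (λ u → wordWeight ((k , b) ∷ γ) u q) ⟩
  ∑ (words bools k) (λ u → ∑ (words bools N) (λ v → wordWeight ((k , b) ∷ γ) (u ++ v) q))
    ≡⟨ ∑-cong (words bools k) (λ {u} u∈ → ∑-cong (words bools N) (λ {v} _ → wordWeight-++ b γ u v q
        (proj₁ (∈-words⁻ k u∈)))) ⟩
  ∑ (words bools k) (λ u → ∑ (words bools N) (λ v → localWeight k b u q ℤ.* wordWeight γ v (q ∸ k)))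
    ≡⟨ ∑-cong (words bools k) (λ {u} _ → trans (∑-*ˡ (localWeight k b u q) (words bools N)
        (λ v → wordWeight γ v (q ∸ k)))
         (cong (localWeight k b u q ℤ.*_) (∑-wordWeight γ (q ∸ k) pos))) ⟩
  ∑ (words bools k) (λ u → localWeight k b u q ℤ.* totalWeight γ (q ∸ k)) ≡⟨ ∑-*ʳ (totalWeight γ (q ∸ k))
      (words bools k) (λ u → localWeight k b u q) ⟩
  ∑ (words bools k) (λ u → localWeight k b u q) ℤ.* totalWeight γ (q ∸ k) ≡⟨ cong (ℤ._* totalWeight γ (q ∸ k))
      (∑-localWeight k b q 0<k) ⟩
  blockTotal k b q ℤ.* totalWeight γ (q ∸ k) ∎
  where
  open ≡-Reasoning
  N = total γ

totalWeight-0 : ∀ γ → Positive γ → totalWeight γ 0 ≡ typeFactor γ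
totalWeight-0 [] [] = refl
totalWeight-0 ((k , b) ∷ γ) (0<k ∷ pos) rewrite ℕₚ.0∸n≡0 k = cong₂ ℤ._*_ (blockTotal-out k b 0 0<k (inj₁ refl)) (totalWeight-0 γ pos)

range1-+ : ∀ k l → range1 (k + l) ≡ range1 k ++ map (λ t → k + t) (range1 l)
range1-+ k zero = trans (cong range1 (+-identityʳ k)) (sym (Listₚ.++-identityʳ _))
range1-+ k (suc l) = begin
  range1 (k + suc l) ≡⟨ cong range1 (+-suc k l) ⟩
  range1 (suc (k + l)) ≡⟨ range1-∷ʳ (k + l) ⟩
  range1 (k + l) ++ [ suc (k + l) ] ≡⟨ cong₂ (λ x y → x ++ [ y ]) (range1-+ k l) (sym (+-suc k l)) ⟩
  (range1 k ++ map (λ t → k + t) (range1 l)) ++ [ k + suc l ] ≡⟨ Listₚ.++-assoc (range1 k) _ _ ⟩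
  range1 k ++ (map (λ t → k + t) (range1 l) ++ [ k + suc l ]) ≡⟨ cong (range1 k ++_) (map-++ (λ t → k + t)
      (range1 l) [ suc l ]) ⟨
  range1 k ++ map (λ t → k + t) (range1 l ++ [ suc l ]) ≡⟨ cong (λ z → range1 k ++ map (λ t → k + t) z) (range1-∷ʳ l) ⟨
  range1 k ++ map (λ t → k + t) (range1 (suc l)) ∎
  where open ≡-Reasoning

-- Either q lies in the first block, and all remaining blocks contribute their standard factor, or
-- it lies further on and the first block does. Each unbarred part 1 thereby yields the full product
-- once.
∑-totalWeight : ∀ γ → Positive γ →
  ∑ (range1 (total γ)) (totalWeight γ) ≡ + countᵇ 1 (unbarredParts γ) ℤ.* typeFactor γ
∑-totalWeight [] [] = refl
∑-totalWeight ((k , b) ∷ γ) (0<k ∷ pos) = begin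
  ∑ (range1 (k + N)) W ≡⟨ cong (λ l → ∑ l W) (range1-+ k N) ⟩
  ∑ (range1 k ++ map (λ t → k + t) (range1 N)) W ≡⟨ ∑-++ (range1 k) W ⟩
  ∑ (range1 k) W ℤ.+ ∑ (map (λ t → k + t) (range1 N)) W ≡⟨ cong₂ ℤ._+_ head tail ⟩
  [ (1 ≡ᵇ k) ∧ not b ]ᵢ ℤ.* partFactor k b ℤ.* P ℤ.+ partFactor k b ℤ.* (+ countᵇ 1 (unbarredParts γ) ℤ.* P)
    ≡⟨ arith [ (1 ≡ᵇ k) ∧ not b ]ᵢ (partFactor k b) P (+ countᵇ 1 (unbarredParts γ)) ⟩
  ([ (1 ≡ᵇ k) ∧ not b ]ᵢ ℤ.+ + countᵇ 1 (unbarredParts γ)) ℤ.* (partFactor k b ℤ.* P)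
    ≡⟨ cong (ℤ._* (partFactor k b ℤ.* P)) (count b) ⟨
  + countᵇ 1 (unbarredParts ((k , b) ∷ γ)) ℤ.* (partFactor k b ℤ.* P) ∎
  where
  open ≡-Reasoning
  N = total γ
  W = totalWeight ((k , b) ∷ γ)
  P = typeFactor γ
  arith : ∀ i f p c → i ℤ.* f ℤ.* p ℤ.+ f ℤ.* (c ℤ.* p) ≡ (i ℤ.+ c) ℤ.* (f ℤ.* p)
  arith = solve-∀
  count : ∀ b → + countᵇ 1 (unbarredParts ((k , b) ∷ γ)) ≡ [ (1 ≡ᵇ k) ∧ not b ]ᵢ ℤ.+ + countᵇ 1 (unbarredParts γ)
  count b with 1 ≡ᵇ k in e
  count true  | true  = sym (+-identityˡ _)
  count true  | false = sym (+-identityˡ _)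
  count false | true  rewrite e = refl
  count false | false rewrite e = sym (+-identityˡ _)
  head : ∑ (range1 k) W ≡ [ (1 ≡ᵇ k) ∧ not b ]ᵢ ℤ.* partFactor k b ℤ.* P
  head = begin
    ∑ (range1 k) W ≡⟨ ∑-cong (range1 k) (λ {q} q∈ → cong (blockTotal k b q ℤ.*_)
        (trans (cong (totalWeight γ) (ℕₚ.m≤n⇒m∸n≡0 (proj₂ (∈-range1⁻ q∈)))) (totalWeight-0 γ pos))) ⟩
    ∑ (range1 k) (λ q → blockTotal k b q ℤ.* P) ≡⟨ ∑-*ʳ P (range1 k) (blockTotal k b) ⟩
    ∑ (range1 k) (blockTotal k b) ℤ.* P ≡⟨ cong (ℤ._* P) (∑-blockTotal k b 0<k) ⟩
    [ (1 ≡ᵇ k) ∧ not b ]ᵢ ℤ.* partFactor k b ℤ.* P ∎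
  tail : ∑ (map (λ t → k + t) (range1 N)) W ≡ partFactor k b ℤ.* (+ countᵇ 1 (unbarredParts γ) ℤ.* P)
  tail = begin
    ∑ (map (λ t → k + t) (range1 N)) W ≡⟨ ∑-map (λ t → k + t) (range1 N) W ⟩
    ∑ (range1 N) (λ t → W (k + t)) ≡⟨ ∑-cong (range1 N) (λ {t} t∈ → cong₂ ℤ._*_
        (blockTotal-out k b (k + t) 0<k (inj₂ (m<m+n k (proj₁ (∈-range1⁻ t∈)))))
            (cong (totalWeight γ) (m+n∸m≡n k t))) ⟩
    ∑ (range1 N) (λ t → partFactor k b ℤ.* totalWeight γ t) ≡⟨ ∑-*ˡ (partFactor k b) (range1 N) (totalWeight γ) ⟩
    partFactor k b ℤ.* ∑ (range1 N) (totalWeight γ) ≡⟨ cong (partFactor k b ℤ.*_) (∑-totalWeight γ pos) ⟩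
    partFactor k b ℤ.* (+ countᵇ 1 (unbarredParts γ) ℤ.* P) ∎

-- The signed descent set of an arc permutation

-- All that the descent set needs to know of an arc permutation about neighbouring entries. Nothing
-- is demanded at a change of sign, where a descent is automatic.
record Adjacent (n : ℕ) (v v′ : ℤ) : Set where
  constructor mkAdjacent
  field
    up   : barred v ≡ false → barred v′ ≡ false → ∣ v′ ∣ ≡ succMod n ∣ v ∣
    down : barred v ≡ true  → barred v′ ≡ true  → ∣ v′ ∣ ≡ predMod n ∣ v ∣

descentTest : ℕ → ℤ → ℤ → Bool
descentTest n v v′ = (rank n v′ <ᵇ rank n v) ∨ (barred v ∧ not (barred v′))

-- From unbarred to barred the rank drops, as every barred letter precedes every unbarred one; from
-- barred to unbarred the second clause of the definition applies.
descentTest-change : ∀ n v v′ → ∣ v′ ∣ ≤ n → 1 ≤ ∣ v ∣ → barred v ≢ barred v′ → descentTest n v v′ ≡ true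
descentTest-change n (+ k) (+ k′) _ _ ne = ⊥-elim (ne refl)
descentTest-change n -[1+ k ] -[1+ k′ ] _ _ ne = ⊥-elim (ne refl)
descentTest-change n (+ k) -[1+ k′ ] le 1≤k _ =
  cong (_∨ false) (T⇒≡ (<⇒<ᵇ (≤-<-trans le (m<m+n n 1≤k))))
descentTest-change n -[1+ k ] (+ k′) _ _ _ = T⇒≡ (∨-true (rank n (+ k′) <ᵇ rank n -[1+ k ]))
  where
  ∨-true : ∀ b → T (b ∨ true)
  ∨-true true  = tt
  ∨-true false = tt

-- Adding 1 raises the rank except at the wrap from n to 1, where 2 ≤ n makes it drop strictly. The
-- descent thus sits at the letter n itself.
descentTest-up : ∀ n v v′ → 2 ≤ n → Adjacent n v v′ → barred v ≡ false → barred v′ ≡ false →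
  descentTest n v v′ ≡ (∣ v ∣ ≡ᵇ n)
descentTest-up n (+ k) (+ k′) 2≤n adj _ _ rewrite Adjacent.up adj refl refl with k ≡ᵇ n in e
... | true rewrite ≡ᵇ⇒≡ k n (≡⇒T e) = cong (_∨ false) (T⇒≡ (<⇒<ᵇ (+-monoʳ-< n 2≤n)))
... | false = cong (_∨ false) (¬T⇒≡ λ t → <-asym (n<1+n k) (+-cancelˡ-< n (suc k) k
    (<ᵇ⇒< (n + suc k) (n + k) t)))

-- Subtracting 1 lowers the rank except at the wrap from 1 to n. The ascent sits one position before
-- the letter n, whence the `suc t` in `descents true`.
descentTest-down : ∀ n v v′ → ∣ v ∣ ≤ n → Adjacent n v v′ → barred v ≡ true → barred v′ ≡ true →
  descentTest n v v′ ≡ not (∣ v′ ∣ ≡ᵇ n)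
descentTest-down n -[1+ zero ] -[1+ k′ ] le adj _ _ with refl ← Adjacent.down adj refl refl =
  cong not (sym (≡ᵇ-refl n))
descentTest-down n -[1+ suc k ] -[1+ k′ ] le adj _ _ with refl ← Adjacent.down adj refl refl =
  trans (cong (_∨ false) (T⇒≡ (<⇒<ᵇ (n<1+n k)))) (cong not (sym (≢⇒≡ᵇ-false {suc k} {n} (<⇒≢ le))))

tilde : (ℕ → Bool) → List ℕ → ℕ → Bool
tilde e L j = foldr (λ p acc → if j ≤ᵇ proj₁ p then proj₂ p else acc) false (map (λ s → s , e s) L)

tilde-hit : ∀ e {L j} → AllPairs _<_ L → j ∈ L → tilde e L j ≡ e j
tilde-hit e {s ∷ L} s< (here refl) rewrite T⇒≡ (≤⇒≤ᵇ {s} ≤-refl) = refl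
tilde-hit e {s ∷ L} {j} (s< ∷ sorted) (there j∈)
  rewrite ¬T⇒≡ {j ≤ᵇ s} (λ t → <⇒≱ (All.lookup s< j∈) (≤ᵇ⇒≤ j s t)) = tilde-hit e sorted j∈

tilde-skip : ∀ e L {j} → j ∉ L → tilde e L j ≡ tilde e L (suc j)
tilde-skip e [] j∉ = refl
tilde-skip e (s ∷ L) {j} j∉ = cong₂ (λ b acc → if b then e s else acc)
  (T-ext (λ t → ≤⇒≤ᵇ (≤∧≢⇒< (≤ᵇ⇒≤ j s t) (j∉ ∘ here)))
         (λ t → ≤⇒≤ᵇ (<⇒≤ (≤ᵇ⇒≤ (suc j) s t))))
  (tilde-skip e L (j∉ ∘ there))

segment-map : ∀ r m → segment r m ≡ map (λ t → r + t) (range1 m)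
segment-map r m = map-∘ (upTo m)

all-map : ∀ (p : C → Bool) (f : A → C) xs → all p (map f xs) ≡ all (p ∘ f) xs
all-map p f [] = refl
all-map p f (x ∷ xs) = cong (p (f x) ∧_) (all-map p f xs)

length-filterᵇ-map : ∀ (p : C → Bool) (f : A → C) xs → length (filterᵇ p (map f xs)) ≡ length (filterᵇ (p ∘ f) xs)
length-filterᵇ-map p f [] = refl
length-filterᵇ-map p f (x ∷ xs) with p (f x)
... | true  = cong suc (length-filterᵇ-map p f xs)
... | false = length-filterᵇ-map p f xs

length-filterᵇ-filterᵇ : ∀ (p q : A → Bool) xs → length (filterᵇ p (filterᵇ q xs)) ≡ length
    (filterᵇ (λ x → q x ∧ p x) xs)
length-filterᵇ-filterᵇ p q [] = refl
length-filterᵇ-filterᵇ p q (x ∷ xs) with q x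
... | false = length-filterᵇ-filterᵇ p q xs
... | true with p x
...   | true  = cong suc (length-filterᵇ-filterᵇ p q xs)
...   | false = length-filterᵇ-filterᵇ p q xs

length-filterᵇ-++ : ∀ (p : A → Bool) xs ys → length (filterᵇ p (xs ++ ys)) ≡ length (filterᵇ p xs) + length
    (filterᵇ p ys)
length-filterᵇ-++ p xs ys = trans (cong length (Listₚ.filter-++ (T? ∘ p) xs ys)) (Listₚ.length-++ (filterᵇ p xs))

boolToℕ : Bool → ℕ
boolToℕ b = if b then 1 else 0

signB-pow : ∀ b → minusOnePow (boolToℕ b) ≡ signB b
signB-pow true  = refl
signB-pow false = refl

length-filterᵇ-∷ : ∀ (p : A → Bool) x xs → length (filterᵇ p (x ∷ xs)) ≡ boolToℕ (p x) + length (filterᵇ p xs)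
length-filterᵇ-∷ p x xs with p x
... | true  = refl
... | false = refl

ends : ℕ → SignedComposition → List ℕ
ends r γ = map (proj₁ ∘ proj₂) (blocksFrom r γ)

ends-> : ∀ r γ → Positive γ → ∀ {s} → s ∈ ends r γ → r < s
ends-> r ((k , b) ∷ γ) (0<k ∷ pos) (here refl) = m<m+n r 0<k
ends-> r ((k , b) ∷ γ) (0<k ∷ pos) (there s∈) = ℕₚ.<-trans (m<m+n r 0<k) (ends-> (r + k) γ pos s∈)

-- When q ≤ r the difference truncates to 0, which a position t ≥ 1 never equals, so both tests fail
-- together.
shift-≡ᵇ : ∀ r t q → 1 ≤ t → (r + t ≡ᵇ q) ≡ (t ≡ᵇ q ∸ r)
shift-≡ᵇ r t q 1≤t = T-ext
  (λ p → ≡⇒≡ᵇ t (q ∸ r) (sym (trans (cong (_∸ r) (sym (≡ᵇ⇒≡ (r + t) q p))) (m+n∸m≡n r t))))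
  (λ p → ≡⇒≡ᵇ (r + t) q (back (≡ᵇ⇒≡ t (q ∸ r) p)))
  where
  back : t ≡ q ∸ r → r + t ≡ q
  back e with ≤-total r q
  ... | inj₁ r≤q = trans (cong (λ z → r + z) e) (m+[n∸m]≡n r≤q)
  ... | inj₂ q≤r = contradiction (trans e (ℕₚ.m≤n⇒m∸n≡0 q≤r)) (λ t≡0 → <⇒≢ 1≤t (sym t≡0))

if-∧ : ∀ p q x y → (if p ∧ q then x ℤ.* y else + 0) ≡ (if p then x else + 0) ℤ.* (if q then y else + 0)
if-∧ true  true  x y = refl
if-∧ true  false x y = sym (*-zeroʳ x)
if-∧ false q     x y = refl

module SDes {n w q} (2≤n : 2 ≤ n) (w∈ : w ∈ B n)
  (adj : ∀ {s} → 1 ≤ s → s < n → Adjacent n (at w s) (at w (suc s)))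
  (q∈ : q ∈ range1 n) (wq : absMap w q ≡ n) where

  e D : ℕ → Bool
  e s = barred (at w s)
  D s = inDes n w s

  D-def : ∀ {s} → s < n → D s ≡ descentTest n (at w s) (at w (suc s))
  D-def {s} s<n = cong (_∨ descentTest n (at w s) (at w (suc s))) (≢⇒≡ᵇ-false (<⇒≢ s<n))

  D-n : D n ≡ true
  D-n = cong (_∨ descentTest n (at w n) (at w (suc n))) (≡ᵇ-refl n)

  abs-n : ∀ {s} → s ∈ range1 n → (absMap w s ≡ᵇ n) ≡ (s ≡ᵇ q)
  abs-n {s} s∈ = T-ext
    (λ t → ≡⇒≡ᵇ s q (absMap-injective {n} w∈ s∈ q∈ (trans (≡ᵇ⇒≡ (absMap w s) n t) (sym wq))))
    (λ t → ≡⇒≡ᵇ (absMap w s) n (trans (cong (absMap w) (≡ᵇ⇒≡ s q t)) wq))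

  module _ {s} (1≤s : 1 ≤ s) (s<n : s < n) where
    private
      s∈ : s ∈ range1 n
      s∈ = ∈-range1⁺ 1≤s (<⇒≤ s<n)
      s⁺∈ : suc s ∈ range1 n
      s⁺∈ = ∈-range1⁺ (s≤s z≤n) s<n

    D-change : e s ≢ e (suc s) → D s ≡ true
    D-change ne = trans (D-def s<n) (descentTest-change n (at w s) (at w (suc s))
      (proj₂ (∈-range1⁻ (absMap-∈ {n} w∈ s⁺∈))) (proj₁ (∈-range1⁻ (absMap-∈ {n} w∈ s∈))) ne)

    D-same : ∀ b → e s ≡ b → e (suc s) ≡ b → D s ≡ descents b q s
    D-same false h h′ = trans (D-def s<n) (trans (descentTest-up n _ _ 2≤n (adj 1≤s s<n) h h′) (abs-n s∈))
    D-same true  h h′ = trans (D-def s<n) (trans (descentTest-down n (at w s) (at w (suc s))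
        (proj₂ (∈-range1⁻ (absMap-∈ {n} w∈ s∈))) (adj 1≤s s<n) h h′)
      (cong not (abs-n s⁺∈)))

  σ : SignedSet
  σ = sDes n w

  memS-D : ∀ {j} → j ∈ range1 n → memS σ j ≡ D j
  memS-D {j} j∈ = T-ext to from
    where
    to : T (memS σ j) → T (D j)
    to t with any-⁻ (λ p → proj₁ p ≡ᵇ j) σ t
    ... | p , p∈ , r with ∈-map⁻ (λ s → s , e s) p∈
    ...   | s , s∈ , refl = subst (T ∘ D) (≡ᵇ⇒≡ s j r) (proj₂ (∈-filterᵇ⁻ {p = D} {xs = range1 n} s∈))
    from : T (D j) → T (memS σ j)
    from t = any-⁺ (λ p → proj₁ p ≡ᵇ j) (∈-map⁺ (λ s → s , e s) (∈-filterᵇ⁺ {p = D} j∈ t)) (≡⇒≡ᵇ j j refl)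

  Ds : List ℕ
  Ds = filterᵇ D (range1 n)

  Ds-sorted : AllPairs _<_ Ds
  Ds-sorted = AllPairsₚ.filter⁺ (T? ∘ D) (range1-sorted n)

  -- Downwards from n, with m the distance to n: a position outside S has the same sign as its right
  -- neighbour, since every change of sign is a descent. Hence ε̃ is just the sign of each entry.
  tildeEps-e : ∀ m {j} → j + m ≡ n → 1 ≤ j → tildeEps σ j ≡ e j
  tildeEps-e zero {j} eq 1≤j = tilde-hit e Ds-sorted (∈-filterᵇ⁺ {p = D}
    (∈-range1⁺ 1≤j (≤-reflexive j≡n)) (≡⇒T (trans (cong D j≡n) D-n)))
    where
    j≡n : j ≡ n
    j≡n = trans (sym (+-identityʳ j)) eq
  tildeEps-e (suc m) {j} eq 1≤j = case-D (D j) refl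
    where
    j<n : j < n
    j<n = subst (j <_) eq (m<m+n j (s≤s z≤n))
    same : ∀ a b → (a ≢ b → D j ≡ true) → D j ≡ false → b ≡ a
    same true  true  _ _ = refl
    same false false _ _ = refl
    same true  false h d = contradiction (trans (sym d) (h λ ())) λ ()
    same false true  h d = contradiction (trans (sym d) (h λ ())) λ ()
    case-D : ∀ b → D j ≡ b → tildeEps σ j ≡ e j
    case-D true  d = tilde-hit e Ds-sorted (∈-filterᵇ⁺ {p = D} (∈-range1⁺ 1≤j (<⇒≤ j<n)) (≡⇒T d))
    case-D false d = trans (tilde-skip e Ds (λ j∈ → subst T d (proj₂ (∈-filterᵇ⁻ {p = D} {xs = range1 n} j∈))))
      (trans (tildeEps-e m (trans (sym (+-suc j m)) eq) (s≤s z≤n))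
        (same (e j) (e (suc j)) (D-change 1≤j j<n) d))

  tildeEps-range : ∀ {j} → j ∈ range1 n → tildeEps σ j ≡ e j
  tildeEps-range {j} j∈ = let l , r = ∈-range1⁻ j∈ in tildeEps-e (n ∸ j) (m+[n∸m]≡n r) l

  block-∈ : ∀ {r k j} → r + k ≤ n → j ∈ range1 k → r + j ∈ range1 n
  block-∈ {r} le j∈ = let l , h = ∈-range1⁻ j∈ in
    ∈-range1⁺ (≤-trans l (m≤n+m _ r)) (≤-trans (+-monoʳ-≤ r h) le)

  inner-⊆ : ∀ {k j} → j ∈ range1 (k ∸ 1) → j ∈ range1 k
  inner-⊆ {k} j∈ = let l , h = ∈-range1⁻ j∈ in ∈-range1⁺ l (≤-trans h (m∸n≤m k 1))

  blockOK-rel : ∀ r k b → 1 ≤ k → r + k ≤ n →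
    blockOK σ (r , r + k , b) ≡ isInitial (λ t → D (r + t)) k ∧ constant (map (λ t → e (r + t)) (range1 k))
  blockOK-rel r k b 1≤k le rewrite m+n∸m≡n r k | segment-map r (k ∸ 1) | segment-map r k
    | length-map (λ t → r + t) (range1 (k ∸ 1)) | length-range1 (k ∸ 1) =
    cong₂ _∧_
      (any-cong (upTo (suc (k ∸ 1))) λ {t} _ → trans (all-map _ (λ t → r + t) (range1 (k ∸ 1)))
        (all-cong (range1 (k ∸ 1)) λ {j} j∈ → cong₂ eqBool (memS-D (block-∈ le (inner-⊆ {k} j∈))) (shift-≤ᵇ j t)))
      (trans (all-map _ (λ t → r + t) (range1 k)) (constant-map k 1≤k le))
    where
    shift-≤ᵇ : ∀ j t → (r + j ≤ᵇ r + t) ≡ (j ≤ᵇ t)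
    shift-≤ᵇ j t = T-ext (λ p → ≤⇒≤ᵇ (ℕₚ.+-cancelˡ-≤ r j t (≤ᵇ⇒≤ (r + j) (r + t) p)))
      (λ p → ≤⇒≤ᵇ (+-monoʳ-≤ r (≤ᵇ⇒≤ j t p)))
    constant-map : ∀ k → 1 ≤ k → r + k ≤ n → all (λ j → eqBool (tildeEps σ (r + j)) (tildeEps σ (suc r))) (range1 k)
      ≡ constant (map (λ t → e (r + t)) (range1 k))
    constant-map (suc k) _ le = trans
      (all-cong (range1 (suc k)) λ {j} j∈ → cong₂ eqBool (tildeEps-range (block-∈ le j∈))
        (trans (cong (tildeEps σ) (+-comm 1 r)) (tildeEps-range (block-∈ le (∈-range1⁺ ≤-refl (s≤s z≤n))))))
      (sym (all-map (λ c → eqBool c (e (r + 1))) (λ t → e (r + t)) (range1 (suc k))))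

  -- The share of one block in the weight. A constant sign brings the inner descents into the form
  -- `descents`, with the position of n counted from the block start by `q ∸ r`.
  localWeight-block : ∀ r k b → 1 ≤ k → r + k ≤ n →
    (if blockOK σ (r , r + k , b)
     then minusOnePow (length (filterᵇ (λ t → D (r + t)) (range1 (k ∸ 1))) + boolToℕ (b ∧ tildeEps σ (suc r))) else + 0)
    ≡ localWeight k b (map (λ t → e (r + t)) (range1 k)) (q ∸ r)
  localWeight-block r k b 1≤k le rewrite blockOK-rel r k b 1≤k le | tildeEps-range {suc r} (subst (_∈ range1 n) (+-comm r 1) (block-∈ le (∈-range1⁺ ≤-refl 1≤k)))
    = finish (constant v) refl
    where
    v = map (λ t → e (r + t)) (range1 k)
    d : ℕ → Bool
    d t = D (r + t)
    c = length (filterᵇ d (range1 (k ∸ 1)))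
    head-v : ∀ k → 1 ≤ k → first-sign (map (λ t → e (r + t)) (range1 k)) ≡ e (suc r)
    head-v (suc k) _ = cong e (+-comm r 1)
    const : ∀ k → T (constant (map (λ t → e (r + t)) (range1 k))) → ∀ {j} → j ∈ range1 k → e (r + j) ≡ e (suc r)
    const (suc k) t {j} j∈ = trans
        (eqBool-⁻ (all-⁻ (λ c → eqBool c (e (r + 1))) (map (λ t → e (r + t)) (range1 (suc k))) t
            (∈-map⁺ (λ t → e (r + t)) j∈)))
      (cong e (+-comm r 1))
    d-descents : T (constant v) → ∀ {j} → j ∈ range1 (k ∸ 1) → d j ≡ descents (e (suc r)) (q ∸ r) j
    d-descents t {j} j∈ = trans
        (D-same (proj₁ (∈-range1⁻ (block-∈ le j∈k))) (<-≤-trans (+-monoʳ-< r j<k) le) (e (suc r)) (const k t j∈k)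
          (trans (cong e (sym (+-suc r j))) (const k t (∈-range1⁺ (s≤s z≤n) j<k))))
        (shift (e (suc r)))
      where
      j∈k : j ∈ range1 k
      j∈k = inner-⊆ {k} j∈
      j<k : j < k
      j<k = subst (suc j ≤_) (suc-pred k ⦃ ℕ.>-nonZero 1≤k ⦄) (s≤s (proj₂ (∈-range1⁻ j∈)))
      shift : ∀ b → descents b q (r + j) ≡ descents b (q ∸ r) j
      shift false = shift-≡ᵇ r j q (proj₁ (∈-range1⁻ j∈))
      shift true  = cong not (trans (cong (_≡ᵇ q) (sym (+-suc r j))) (shift-≡ᵇ r (suc j) q (s≤s z≤n)))
    pull : ∀ i → (if i ∧ true then minusOnePow (c + boolToℕ (b ∧ e (suc r))) else + 0) ≡
      signB (b ∧ e (suc r)) ℤ.* (if i then minusOnePow c else + 0)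
    pull true  = trans (minusOnePow-+ c _) (trans (cong (minusOnePow c ℤ.*_) (signB-pow (b ∧ e (suc r))))
        (ℤₚ.*-comm (minusOnePow c) (signB (b ∧ e (suc r)))))
    pull false = sym (*-zeroʳ (signB (b ∧ e (suc r))))
    ∧-false : ∀ i → i ∧ false ≡ false
    ∧-false true  = refl
    ∧-false false = refl
    finish : ∀ z → constant v ≡ z →
      (if isInitial d k ∧ z then minusOnePow (c + boolToℕ (b ∧ e (suc r))) else + 0) ≡ (if z then blockWeight k b
          (first-sign v) (q ∸ r) else + 0)
    finish false _ = cong (λ z → if z then minusOnePow (c + boolToℕ (b ∧ e (suc r))) else + 0) (∧-false (isInitial d k))
    finish true  h = trans (pull (isInitial d k))
      (trans (cong (signB (b ∧ e (suc r)) ℤ.*_) (blockValue-cong k (d-descents (≡⇒T h))))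
        (cong (λ z → blockWeight k b z (q ∸ r)) (sym (head-v k 1≤k))))

  outside : List ℕ → ℕ → Bool
  outside E s = D s ∧ not (elemᵇ s E)

  signTest : ℕ × ℕ × Bool → Bool
  signTest blk = proj₂ (proj₂ blk) ∧ tildeEps σ (suc (proj₁ blk))

  -- The weight restricted to the blocks after position r, counting only descents in that stretch,
  -- so that blocks can be split off one at a time.
  wtFrom : ℕ → SignedComposition → ℤ
  wtFrom r γ = if all (blockOK σ) (blocksFrom r γ)
    then minusOnePow (length (filterᵇ (outside (ends r γ)) (segment r (total γ))) + length
        (filterᵇ signTest (blocksFrom r γ)))
    else + 0

  wt-wtFrom : ∀ γ → total γ ≡ n → wt γ σ ≡ wtFrom 0 γ
  wt-wtFrom γ eq = cong (λ l → if all (blockOK σ) (blocks γ) then minusOnePow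
      (l + length (filterᵇ signTest (blocks γ))) else + 0)
    (trans (length-filterᵇ-map (λ p → not (elemᵇ (proj₁ p) (Sγ γ))) (λ s → s , e s) Ds)
      (trans (length-filterᵇ-filterᵇ (λ s → not (elemᵇ s (Sγ γ))) D (range1 n))
        (cong (λ m → length (filterᵇ (outside (Sγ γ)) (range1 m))) (sym eq))))

  -- Later block ends lie beyond r + k and exclude none of the inner positions of the first block;
  -- its own end is excluded, and this end does not occur in the later stretch.
  outside-count : ∀ r k b γ → 1 ≤ k → Positive γ → let N = total γ in
    length (filterᵇ (outside (ends r ((k , b) ∷ γ))) (segment r (k + N))) ≡
      length (filterᵇ (λ t → D (r + t)) (range1 (k ∸ 1))) + length (filterᵇ (outside (ends (r + k) γ))
          (segment (r + k) N))
  outside-count r k b γ 1≤k pos = begin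
    length (filterᵇ P (segment r (k + N))) ≡⟨ cong (λ l → length (filterᵇ P l)) split ⟩
    length (filterᵇ P (segment r (k ∸ 1) ++ (r + k) ∷ segment (r + k) N)) ≡⟨ length-filterᵇ-++ P (segment r (k ∸ 1)) _ ⟩
    length (filterᵇ P (segment r (k ∸ 1))) + length (filterᵇ P ((r + k) ∷ segment (r + k) N))
      ≡⟨ cong₂ _+_ inner (trans (length-filterᵇ-∷ P (r + k) (segment (r + k) N)) (cong₂ _+_ (cong boolToℕ endpoint)
          (cong length (filterᵇ-cong (segment (r + k) N) rest)))) ⟩
    length (filterᵇ (λ t → D (r + t)) (range1 (k ∸ 1))) + length (filterᵇ (outside (ends (r + k) γ))
        (segment (r + k) N)) ∎
    where
    open ≡-Reasoning
    N = total γ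
    P = outside (ends r ((k , b) ∷ γ))
    split : segment r (k + N) ≡ segment r (k ∸ 1) ++ (r + k) ∷ segment (r + k) N
    split = begin
      segment r (k + N) ≡⟨ segment-map r (k + N) ⟩
      map (λ t → r + t) (range1 (k + N)) ≡⟨ cong (map (λ t → r + t)) (range1-+ k N) ⟩
      map (λ t → r + t) (range1 k ++ map (λ t → k + t) (range1 N)) ≡⟨ map-++ (λ t → r + t) (range1 k) _ ⟩
      map (λ t → r + t) (range1 k) ++ map (λ t → r + t) (map (λ t → k + t) (range1 N))
        ≡⟨ cong₂ _++_ (snoc k 1≤k) (trans (sym (map-∘ (range1 N)))
            (trans (Listₚ.map-cong (λ t → sym (+-assoc r k t)) (range1 N)) (sym (segment-map (r + k) N)))) ⟩
      (segment r (k ∸ 1) ++ [ r + k ]) ++ segment (r + k) N ≡⟨ Listₚ.++-assoc (segment r (k ∸ 1)) [ r + k ] _ ⟩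
      segment r (k ∸ 1) ++ (r + k) ∷ segment (r + k) N ∎
      where
      snoc : ∀ k → 1 ≤ k → map (λ t → r + t) (range1 k) ≡ segment r (k ∸ 1) ++ [ r + k ]
      snoc (suc k) _ = trans (cong (map (λ t → r + t)) (range1-∷ʳ k))
          (trans (map-++ (λ t → r + t) (range1 k) [ suc k ])
        (cong (_++ [ r + suc k ]) (sym (segment-map r k))))
    not-end : ∀ {s} → s < r + k → s ∉ ends r ((k , b) ∷ γ)
    not-end s< (here refl) = ℕₚ.<-irrefl refl s<
    not-end s< (there s∈) = <-asym s< (ends-> (r + k) γ pos s∈)
    inner : length (filterᵇ P (segment r (k ∸ 1))) ≡ length (filterᵇ (λ t → D (r + t)) (range1 (k ∸ 1)))
    inner = trans (cong (λ l → length (filterᵇ P l)) (segment-map r (k ∸ 1)))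
      (trans (length-filterᵇ-map P (λ t → r + t) (range1 (k ∸ 1)))
        (cong length (filterᵇ-cong (range1 (k ∸ 1)) λ {t} t∈ →
          drop-not (D (r + t)) (¬T⇒≡ λ m → not-end
              (+-monoʳ-< r (subst (suc t ≤_) (suc-pred k ⦃ ℕ.>-nonZero 1≤k ⦄) (s≤s (proj₂ (∈-range1⁻ t∈)))))
            (elem-⁻ (ends r ((k , b) ∷ γ)) m)))))
      where
      drop-not : ∀ x {y} → y ≡ false → x ∧ not y ≡ x
      drop-not true  refl = refl
      drop-not false refl = refl
    endpoint : P (r + k) ≡ false
    endpoint = drop-yes (D (r + k)) (T⇒≡ (elem-⁺ {r + k} {ends r ((k , b) ∷ γ)} (here refl)))
      where
      drop-yes : ∀ x {y} → y ≡ true → x ∧ not y ≡ false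
      drop-yes true  refl = refl
      drop-yes false refl = refl
    rest : ∀ {s} → s ∈ segment (r + k) N → P s ≡ outside (ends (r + k) γ) s
    rest {s} s∈ = cong (λ z → D s ∧ not z) (cong (_∨ elemᵇ s (ends (r + k) γ)) (≢⇒≡ᵇ-false s≢))
      where
      s≢ : s ≢ r + k
      s≢ refl with ∈-map⁻ (λ t → r + k + suc t) s∈
      ... | t , _ , eq = <⇒≢ (m<m+n (r + k) (s≤s z≤n)) eq

  wtFrom-wordWeight : ∀ r γ → Positive γ → r + total γ ≡ n →
    wtFrom r γ ≡ wordWeight γ (map (λ t → e (r + t)) (range1 (total γ))) (q ∸ r)
  wtFrom-wordWeight r [] [] eq = refl
  wtFrom-wordWeight r ((k , b) ∷ γ) (1≤k ∷ pos) eq = begin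
    wtFrom r ((k , b) ∷ γ) ≡⟨ cong (λ m → if blockOK σ blk ∧ rest then minusOnePow m else + 0) exponent ⟩
    (if blockOK σ blk ∧ rest then minusOnePow ((c₁ + s₁) + (c₂ + s₂)) else + 0)
      ≡⟨ cong (λ z → if blockOK σ blk ∧ rest then z else + 0) (minusOnePow-+ (c₁ + s₁) (c₂ + s₂)) ⟩
    (if blockOK σ blk ∧ rest then minusOnePow (c₁ + s₁) ℤ.* minusOnePow (c₂ + s₂) else + 0)
      ≡⟨ if-∧ (blockOK σ blk) rest (minusOnePow (c₁ + s₁)) (minusOnePow (c₂ + s₂)) ⟩
    (if blockOK σ blk then minusOnePow (c₁ + s₁) else + 0) ℤ.* wtFrom (r + k) γ
      ≡⟨ cong₂ ℤ._*_ (localWeight-block r k b 1≤k (subst (r + k ≤_) eq′ (m≤m+n (r + k) N)))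
          (wtFrom-wordWeight (r + k) γ pos eq′) ⟩
    localWeight k b v (q ∸ r) ℤ.* wordWeight γ v′ (q ∸ (r + k)) ≡⟨ cong (λ z → localWeight k b v (q ∸ r) ℤ.*
        wordWeight γ v′ z) (ℕₚ.∸-+-assoc q r k) ⟨
    localWeight k b v (q ∸ r) ℤ.* wordWeight γ v′ (q ∸ r ∸ k)
      ≡⟨ wordWeight-++ b γ v v′ (q ∸ r) (trans (length-map (λ t → e (r + t)) (range1 k)) (length-range1 k)) ⟨
    wordWeight ((k , b) ∷ γ) (v ++ v′) (q ∸ r) ≡⟨ cong (λ z → wordWeight ((k , b) ∷ γ) z (q ∸ r)) glue ⟩
    wordWeight ((k , b) ∷ γ) (map (λ t → e (r + t)) (range1 (k + N))) (q ∸ r) ∎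
    where
    open ≡-Reasoning
    N = total γ
    blk : ℕ × ℕ × Bool
    blk = r , r + k , b
    rest = all (blockOK σ) (blocksFrom (r + k) γ)
    c₁ = length (filterᵇ (λ t → D (r + t)) (range1 (k ∸ 1)))
    s₁ = boolToℕ (signTest blk)
    c₂ = length (filterᵇ (outside (ends (r + k) γ)) (segment (r + k) N))
    s₂ = length (filterᵇ signTest (blocksFrom (r + k) γ))
    v = map (λ t → e (r + t)) (range1 k)
    v′ = map (λ t → e (r + k + t)) (range1 N)
    eq′ : r + k + N ≡ n
    eq′ = trans (+-assoc r k N) eq
    exponent : length (filterᵇ (outside (ends r ((k , b) ∷ γ))) (segment r (k + N))) + length
        (filterᵇ signTest (blocksFrom r ((k , b) ∷ γ)))
      ≡ (c₁ + s₁) + (c₂ + s₂)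
    exponent = trans (cong₂ _+_ (outside-count r k b γ 1≤k pos) (length-filterᵇ-∷ signTest blk
        (blocksFrom (r + k) γ))) (inter-+ℕ c₁ c₂ s₁ s₂)
    glue : v ++ v′ ≡ map (λ t → e (r + t)) (range1 (k + N))
    glue = sym (trans (cong (map (λ t → e (r + t))) (range1-+ k N))
      (trans (map-++ (λ t → e (r + t)) (range1 k) (map (λ t → k + t) (range1 N)))
        (cong (v ++_) (trans (sym (map-∘ (range1 N))) (Listₚ.map-cong (λ t → cong e (sym (+-assoc r k t)))
            (range1 N))))))

  wt-wordWeight : ∀ γ → Positive γ → total γ ≡ n → wt γ σ ≡ wordWeight γ (map barred w) q
  wt-wordWeight γ pos eq = trans (wt-wtFrom γ eq) (trans (wtFrom-wordWeight 0 γ pos eq)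
    (cong (λ l → wordWeight γ l q) (begin
      map e (range1 (total γ)) ≡⟨ cong (map e ∘ range1) (trans eq (sym (B-length {n} w∈))) ⟩
      map e (range1 (length w)) ≡⟨ map-∘ (range1 (length w)) ⟩
      map barred (map (at w) (range1 (length w))) ≡⟨ cong (map barred) (map-at w) ⟩
      map barred w ∎)))
    where open ≡-Reasoning

-- Arc permutations

module Residues (n : ℕ) .⦃ n≢0 : NonZero n ⦄ where

  -- ℕ parametrises ℤ_n (with representatives 1..n) starting from 0 ↦ 1.
  val : ℕ → ℕ
  val t = suc (t % n)

  val-∈ : ∀ t → val t ∈ range1 n
  val-∈ t = ∈-range1⁺ (s≤s z≤n) (m%n<n t n)

  val-+n : ∀ t → val (t + n) ≡ val t
  val-+n t = cong suc ([m+n]%n≡m%n t n)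

  val-small : ∀ {a} → a < n → val a ≡ suc a
  val-small a<n = cong suc (m<n⇒m%n≡m a<n)

  %-+ : ∀ t d → (t + d) % n ≡ (t % n + d) % n
  %-+ t d = begin
    (t + d) % n ≡⟨ cong (λ z → (z + d) % n) (m≡m%n+[m/n]*n t n) ⟩
    (t % n + t / n * n + d) % n ≡⟨ cong (_% n) (swap-last-+ℕ (t % n) (t / n * n) d) ⟩
    (t % n + d + t / n * n) % n ≡⟨ [m+kn]%n≡m%n (t % n + d) (t / n) n ⟩
    (t % n + d) % n ∎
    where
    open ≡-Reasoning

  -- Write t′ = t + d with d < n and add d to the remainder of t. Without a wrap, equality forces d
  -- = 0; with one wrap, the new remainder is strictly smaller than the old one.
  val-distinct : ∀ {t t′} → t < t′ → t′ < t + n → val t ≢ val t′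
  val-distinct {t} {t′} t<t′ t′< e with m≤n⇒∃[o]m+o≡n (<⇒≤ t<t′)
  ... | d , refl with t % n + d ℕ.<? n
  ...   | yes lt = <⇒≢ 0<d (sym d≡0)
    where
    0<d : 0 < d
    0<d = +-cancelˡ-< t 0 d (subst (_< t + d) (sym (+-identityʳ t)) t<t′)
    d≡0 : d ≡ 0
    d≡0 = ℕₚ.+-cancelˡ-≡ (t % n) d 0
      (trans (sym (m<n⇒m%n≡m lt)) (trans (sym (%-+ t d)) (trans (sym (suc-injective e))
          (sym (+-identityʳ (t % n))))))
  ...   | no ge with m≤n⇒∃[o]m+o≡n (≮⇒≥ ge)
  ...     | o , n+o≡ = <⇒≢ o<r (trans (sym (m<n⇒m%n≡m (ℕₚ.<-trans o<r (m%n<n t n))))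
      (trans o%n (sym (suc-injective e))))
    where
    d<n : d < n
    d<n = +-cancelˡ-< t d n t′<
    o<r : o < t % n
    o<r = +-cancelˡ-< n o (t % n) (subst (_< n + t % n) (sym n+o≡) (subst (t % n + d <_) (+-comm (t % n) n)
        (+-monoʳ-< (t % n) d<n)))
    o%n : o % n ≡ (t + d) % n
    o%n = trans (sym ([m+n]%n≡m%n o n)) (trans (cong (_% n) (trans (+-comm o n) n+o≡)) (sym (%-+ t d)))

  suc-% : ∀ t → suc t % n ≡ suc (t % n) % n
  suc-% t = trans (cong (_% n) (+-comm 1 t)) (trans (%-+ t 1) (cong (_% n) (+-comm (t % n) 1)))

  val-suc : ∀ t → succMod n (val t) ≡ val (suc t)
  val-suc t with val t ≡ᵇ n in e
  ... | true = cong suc (sym (trans (suc-% t) (trans (cong (_% n) (≡ᵇ⇒≡ (val t) n (≡⇒T e))) (n%n≡0 n))))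
  ... | false = cong suc
      (sym (trans (suc-% t) (m<n⇒m%n≡m (≤∧≢⇒< (m%n<n t n) (λ eq → subst T e (≡⇒≡ᵇ (val t) n eq))))))

  predMod-succMod : ∀ {c} → c ∈ range1 n → predMod n (succMod n c) ≡ c
  predMod-succMod {c} c∈ with c ≡ᵇ n in e
  ... | true = sym (≡ᵇ⇒≡ c n (≡⇒T e))
  ... | false rewrite ≢⇒≡ᵇ-false {c} {0} (λ z → <⇒≢ (proj₁ (∈-range1⁻ c∈)) (sym z)) = refl

  val-pred : ∀ t → predMod n (val (suc t)) ≡ val t
  val-pred t = trans (cong (predMod n) (sym (val-suc t))) (predMod-succMod (val-∈ t))

  val-pred′ : ∀ {t} → 1 ≤ t → predMod n (val t) ≡ val (t ∸ 1)
  val-pred′ {suc t} _ = val-pred t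

  iter-succMod : ∀ t a → iter (succMod n) t (val a) ≡ val (t + a)
  iter-succMod zero a = refl
  iter-succMod (suc t) a = trans (cong (succMod n) (iter-succMod t a)) (val-suc (t + a))

  -- Moving the range up by one loses only the number m, which m + n replaces.
  representative : ∀ m {c} → c ∈ range1 n → ∃ λ x → m ≤ x × x < m + n × c ≡ val x
  representative zero {c} c∈ with ∈-range1⁻ c∈
  representative zero {suc c} c∈ | _ , c<n = c , z≤n , c<n , sym (val-small c<n)
  representative (suc m) c∈ with representative m c∈
  ... | x , m≤x , x< , e with m≤n⇒m<n∨m≡n m≤x
  ...   | inj₁ m<x = x , m<x , m<n⇒m<1+n x< , e
  ...   | inj₂ refl = m + n , m<m+n m (ℕ.>-nonZero⁻¹ n) , ≤-refl , trans e (sym (val-+n m))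

  -- Cyclic intervals lifted to stretches of natural numbers

  record InWindow (lo hi c : ℕ) : Set where
    constructor inWindow
    field
      point : ℕ
      lower : lo ≤ point
      upper : point ≤ hi
      value : c ≡ val point

  -- With this lift an interval grows by lo - 1 or hi + 1 at its two ends, and wrapping around is
  -- confined to `val`.
  record IsWindow (lo hi : ℕ) (P : List ℕ) : Set where
    constructor mkWindow
    field
      sound    : ∀ {c} → c ∈ P → InWindow lo hi c
      complete : ∀ {x} → lo ≤ x → x ≤ hi → val x ∈ P

  open IsWindow

  window-singleton : ∀ t → IsWindow t t [ val t ]
  window-singleton t = mkWindow (λ { (here refl) → inWindow t ≤-refl ≤-refl refl })
    (λ l u → here (cong val (≤-antisym u l)))

  window-down : ∀ {lo hi P} → 1 ≤ lo → lo ≤ hi → IsWindow lo hi P → IsWindow (lo ∸ 1) hi (P ++ [ val (lo ∸ 1) ])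
  window-down {suc lo} {hi} {P} _ le W = mkWindow
    (λ c∈ → [ (λ c∈ → let inWindow x l u e = sound W c∈ in inWindow x (<⇒≤ l) u e)
            , (λ { (here refl) → inWindow lo ≤-refl (<⇒≤ le) refl }) ]′ (∈-++⁻ P c∈))
    (λ {x} l u → [ (λ lo<x → ∈-++⁺ˡ (complete W lo<x u)) , (λ { refl → ∈-++⁺ʳ P (here refl) }) ]′ (m≤n⇒m<n∨m≡n l))

  window-up : ∀ {lo hi P} → lo ≤ hi → IsWindow lo hi P → IsWindow lo (suc hi) (P ++ [ val (suc hi) ])
  window-up {lo} {hi} {P} le W = mkWindow
    (λ c∈ → [ (λ c∈ → let inWindow x l u e = sound W c∈ in inWindow x l (m≤n⇒m≤1+n u) e)
            , (λ { (here refl) → inWindow (suc hi) (m≤n⇒m≤1+n le) ≤-refl refl }) ]′ (∈-++⁻ P c∈))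
    (λ {x} l u → [ (λ { (s≤s x≤hi) → ∈-++⁺ˡ (complete W l x≤hi) }) , (λ { refl → ∈-++⁺ʳ P (here refl) }) ]′ (m≤n⇒m<n∨m≡n u))

  beyond-window : ∀ {lo hi y} → hi < y → y < lo + n → ¬ InWindow lo hi (val y)
  beyond-window hi<y y< (inWindow x l u e) =
    val-distinct (≤-<-trans u hi<y) (<-≤-trans y< (+-monoˡ-≤ n l)) (sym e)

  before-window : ∀ {lo hi y} → y < lo → hi < y + n → ¬ InWindow lo hi (val y)
  before-window y<lo hi< (inWindow x l u e) = val-distinct (<-≤-trans y<lo l) (≤-<-trans u hi<) e

  isInterval-⁺ : ∀ {lo hi P} → IsWindow lo hi P → lo ≤ hi → hi < lo + n → T (isInterval n P)
  isInterval-⁺ {lo} {hi} {P} W le hi< = any-⁺ _ (val-∈ lo) (any-⁺ _ (∈-upTo⁺ (s≤s ℓ≤n))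
      (∧-⁺ (all-⁺ (λ x → elemᵇ x P) win (λ c∈ → elem-⁺ (inP c∈))) (all-⁺ (λ y → elemᵇ y win) P
          (λ c∈ → elem-⁺ (inWin c∈)))))
    where
    ℓ = suc (hi ∸ lo)
    win = window n (val lo) ℓ
    ℓ≤n : ℓ ≤ n
    ℓ≤n = ℕₚ.+-cancelˡ-≤ lo ℓ n
        (subst (_≤ lo + n) (sym (trans (+-suc lo (hi ∸ lo)) (cong suc (m+[n∸m]≡n le)))) hi<)
    inP : ∀ {c} → c ∈ win → c ∈ P
    inP c∈ with ∈-map⁻ (λ t → iter (succMod n) t (val lo)) c∈
    ... | t , t∈ , refl with ∈-upTo⁻ t∈
    ...   | s≤s t≤ = subst (_∈ P) (sym (iter-succMod t lo)) (complete W (m≤n+m lo t)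
      (≤-trans (+-monoˡ-≤ lo t≤) (≤-reflexive (m∸n+n≡m le))))
    inWin : ∀ {c} → c ∈ P → c ∈ win
    inWin c∈ with sound W c∈
    ... | inWindow x l u refl = subst (_∈ win) (trans (iter-succMod (x ∸ lo) lo) (cong val (m∸n+n≡m l)))
      (∈-map⁺ (λ t → iter (succMod n) t (val lo)) (∈-upTo⁺ (s≤s (ℕₚ.∸-monoˡ-≤ lo u))))

  window-end : ∀ a ℓ {y} → y ∈ window n a ℓ → succMod n y ∉ window n a ℓ → y ≡ iter (succMod n) (ℓ ∸ 1) a
  window-end a ℓ y∈ s∉ with ∈-map⁻ (λ t → iter (succMod n) t a) y∈
  ... | t , t∈ , refl with m≤n⇒m<n∨m≡n (∈-upTo⁻ t∈)
  ...   | inj₁ t⁺<ℓ = contradiction (∈-map⁺ (λ t → iter (succMod n) t a) (∈-upTo⁺ t⁺<ℓ)) s∉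
  ...   | inj₂ refl = refl

  -- Only the last element of a cyclic window can have its successor outside the window. This is the
  -- consequence of the interval condition that determines arc permutations.
  isInterval-end : ∀ P → T (isInterval n P) → ∀ {y z} → y ∈ P → z ∈ P → succMod n y ∉ P → succMod n z ∉ P → y ≡ z
  isInterval-end P t {y} {z} y∈ z∈ sy sz
    with any-⁻ (λ a → any (λ ℓ → sameSet (window n a ℓ) P) (upTo (suc n))) (range1 n) t
  ... | a , _ , t′ with any-⁻ (λ ℓ → sameSet (window n a ℓ) P) (upTo (suc n)) t′
  ...   | ℓ , _ , t″ with ∧-⁻ {all (λ x → elemᵇ x P) (window n a ℓ)} t″
  ...     | p , q = trans (window-end a ℓ (toWin y∈) (sy ∘ toP)) (sym (window-end a ℓ (toWin z∈) (sz ∘ toP)))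
    where
    toP : ∀ {x} → x ∈ window n a ℓ → x ∈ P
    toP x∈ = elem-⁻ P (all-⁻ (λ x → elemᵇ x P) (window n a ℓ) p x∈)
    toWin : ∀ {x} → x ∈ P → x ∈ window n a ℓ
    toWin x∈ = elem-⁻ (window n a ℓ) (all-⁻ (λ y → elemᵇ y (window n a ℓ)) P q x∈)

  -- The letters chosen so far fill lo..hi. By the sign rule a barred letter goes immediately below
  -- this stretch and an unbarred one immediately above it, so the signs determine the rest.
  arcTail : ℕ → ℕ → List Bool → List ℤ
  arcTail lo hi []          = []
  arcTail lo hi (true  ∷ u) = withSign true (val (lo ∸ 1)) ∷ arcTail (lo ∸ 1) hi u
  arcTail lo hi (false ∷ u) = withSign false (val (suc hi)) ∷ arcTail lo (suc hi) u

  arc : ℕ → List Bool → List ℤ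
  arc t []      = []
  arc t (e ∷ u) = withSign e (val t) ∷ arcTail t t u

  barred-arcTail : ∀ lo hi u → map barred (arcTail lo hi u) ≡ u
  barred-arcTail lo hi []          = refl
  barred-arcTail lo hi (true  ∷ u) = cong (true ∷_) (barred-arcTail (lo ∸ 1) hi u)
  barred-arcTail lo hi (false ∷ u) = cong (false ∷_) (barred-arcTail lo (suc hi) u)

  barred-arc : ∀ t u → map barred (arc t u) ≡ u
  barred-arc t []      = refl
  barred-arc t (e ∷ u) = cong₂ _∷_ (barred-withSign e (s≤s z≤n)) (barred-arcTail t t u)

  pred-≤ : ∀ {l lo} → suc l ≤ lo → l ≤ lo ∸ 1
  pred-≤ (s≤s h) = h

  -- A letter outside the stretch but at distance at most l from it; the bounds are written as sums
  -- to avoid truncated subtraction.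
  record Beyond (lo hi l c : ℕ) : Set where
    constructor beyond
    field
      point   : ℕ
      value   : c ≡ val point
      outside : point < lo ⊎ hi < point
      lower   : lo ≤ point + l
      upper   : point ≤ hi + l

  arcTail-beyond : ∀ lo hi u → length u ≤ lo → lo ≤ hi → ∀ {c} → c ∈ map ∣_∣ (arcTail lo hi u) → Beyond lo hi
      (length u) c
  arcTail-beyond (suc lo) hi (true ∷ u) (s≤s h) le (here refl) =
    beyond lo (∣withSign∣ true (val lo)) (inj₁ ≤-refl) (≤-trans (s≤s (m≤m+n lo (length u)))
        (≤-reflexive (sym (+-suc lo (length u)))))
      (≤-trans (<⇒≤ le) (m≤m+n hi _))
  arcTail-beyond (suc lo) hi (true ∷ u) (s≤s h) le (there c∈) with arcTail-beyond lo hi u h (<⇒≤ le) c∈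
  ... | beyond y e o l p = beyond y e ([ inj₁ ∘ m<n⇒m<1+n , inj₂ ]′ o)
      (≤-trans (s≤s l) (≤-reflexive (sym (+-suc y (length u)))))
    (≤-trans p (+-monoʳ-≤ hi (n≤1+n _)))
  arcTail-beyond lo hi (false ∷ u) h le (here refl) = beyond (suc hi) refl (inj₂ ≤-refl)
    (≤-trans (m≤n⇒m≤1+n le) (m≤m+n (suc hi) _)) (≤-trans (s≤s (m≤m+n hi (length u)))
        (≤-reflexive (sym (+-suc hi (length u)))))
  arcTail-beyond lo hi (false ∷ u) h le (there c∈) with arcTail-beyond lo (suc hi) u (<⇒≤ h) (m≤n⇒m≤1+n le) c∈
  ... | beyond y e o l p = beyond y e ([ inj₁ , inj₂ ∘ <⇒≤ ]′ o) (≤-trans l (+-monoʳ-≤ y (n≤1+n _)))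
    (≤-trans p (≤-reflexive (sym (+-suc hi (length u)))))

  -- The later letters stay so near the stretch that, measured against any of its points, they
  -- remain within one period. Different parameters then mean different residues.
  arcTail-fresh : ∀ lo hi u → length u ≤ lo → lo ≤ hi → hi + length u < lo + n →
    ∀ {c} → c ∈ map ∣_∣ (arcTail lo hi u) → ¬ InWindow lo hi c
  arcTail-fresh lo hi u h le size c∈ with arcTail-beyond lo hi u h le c∈
  ... | beyond y refl (inj₁ y<lo) l p = before-window y<lo
    (ℕₚ.+-cancelʳ-< (length u) hi (y + n)
        (<-≤-trans size (≤-trans (+-monoˡ-≤ n l) (≤-reflexive (swap-last-+ℕ y (length u) n)))))
  ... | beyond y refl (inj₂ hi<y) l p = beyond-window hi<y (≤-<-trans p size)

  arcTail-unique : ∀ lo hi u → length u ≤ lo → lo ≤ hi → hi + length u < lo + n → Unique (map ∣_∣ (arcTail lo hi u))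
  arcTail-unique lo hi [] h le size = []
  arcTail-unique (suc lo) hi (true ∷ u) (s≤s h) le size = ∷-Unique
      (λ c∈ → arcTail-fresh lo hi u h (<⇒≤ le) size′ (subst (_∈ map ∣_∣ (arcTail lo hi u))
          (∣withSign∣ true (val lo)) c∈) (inWindow lo ≤-refl (<⇒≤ le) refl))
      (arcTail-unique lo hi u h (<⇒≤ le) size′)
    where
    size′ : hi + length u < lo + n
    size′ = ≤-pred (subst (_< suc (lo + n)) (+-suc hi (length u)) size)
  arcTail-unique lo hi (false ∷ u) h le size = ∷-Unique
      (λ c∈ → arcTail-fresh lo (suc hi) u (<⇒≤ h) (m≤n⇒m≤1+n le) size′ c∈
          (inWindow (suc hi) (m≤n⇒m≤1+n le) ≤-refl refl))
      (arcTail-unique lo (suc hi) u (<⇒≤ h) (m≤n⇒m≤1+n le) size′)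
    where
    size′ : suc hi + length u < lo + n
    size′ = subst (_< lo + n) (+-suc hi (length u)) size

  arcTail-range : ∀ lo hi u {c} → c ∈ map ∣_∣ (arcTail lo hi u) → c ∈ range1 n
  arcTail-range lo hi (true ∷ u) (here refl) = subst (_∈ range1 n) (sym (∣withSign∣ true (val (lo ∸ 1))))
      (val-∈ (lo ∸ 1))
  arcTail-range lo hi (true ∷ u) (there c∈) = arcTail-range (lo ∸ 1) hi u c∈
  arcTail-range lo hi (false ∷ u) (here refl) = val-∈ (suc hi)
  arcTail-range lo hi (false ∷ u) (there c∈) = arcTail-range lo (suc hi) u c∈

  -- The bound n ≤ t keeps all n - 1 possible decrements clear of truncation. Each letter is fresh,
  -- and n distinct letters fill the range.
  arc-∈B : ∀ {t u} → n ≤ t → length u ≡ n → arc t u ∈ B n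
  arc-∈B {t} {[]} n≤t len = contradiction (sym len) (ℕ.≢-nonZero⁻¹ n)
  arc-∈B {t} {e ∷ u} n≤t len = B-⁺ {n} (unique-⊆-↭ uniq ⊆range
      (≤-reflexive (trans (length-range1 n) (trans (sym len) (trans (cong length (sym (barred-arc t (e ∷ u))))
          (trans (length-map barred (arc t (e ∷ u))) (sym (length-map ∣_∣ (arc t (e ∷ u))))))))))
    where
    h : length u ≤ t
    h = ≤-trans (≤-trans (n≤1+n _) (≤-reflexive len)) n≤t
    size : t + length u < t + n
    size = +-monoʳ-< t (≤-reflexive len)
    uniq : Unique (map ∣_∣ (arc t (e ∷ u)))
    uniq = ∷-Unique (λ c∈ → arcTail-fresh t t u h ≤-refl size c∈ (inWindow t ≤-refl ≤-refl
        (∣withSign∣ e (val t))))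
      (arcTail-unique t t u h ≤-refl size)
    ⊆range : ∀ {c} → c ∈ map ∣_∣ (arc t (e ∷ u)) → c ∈ range1 n
    ⊆range (here refl) = subst (_∈ range1 n) (sym (∣withSign∣ e (val t))) (val-∈ t)
    ⊆range (there c∈) = arcTail-range t t u c∈

  -- The end of the stretch at which a letter of the given sign was last attached; a next letter of
  -- the same sign moves that same end by one.
  edge : Bool → ℕ → ℕ → ℕ
  edge true  lo hi = lo
  edge false lo hi = hi

  arcTail-adjacent : ∀ lo hi u e {v} → length u ≤ lo → v ≡ withSign e (val (edge e lo hi)) →
    ∀ {s} → 1 ≤ s → s ≤ length u → Adjacent n (at (v ∷ arcTail lo hi u) s) (at (v ∷ arcTail lo hi u) (suc s))
  arcTail-adjacent lo hi (true ∷ u) true {v} h refl {suc zero} _ _ =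
    mkAdjacent (λ ()) (λ _ _ → trans (∣withSign∣ true (val (lo ∸ 1)))
        (trans (sym (val-pred′ (≤-trans (s≤s z≤n) h))) (cong (predMod n) (sym (∣withSign∣ true (val lo))))))
  arcTail-adjacent lo hi (true ∷ u) false {v} h refl {suc zero} _ _ = mkAdjacent (λ _ ()) (λ ())
  arcTail-adjacent lo hi (false ∷ u) true {v} h refl {suc zero} _ _ = mkAdjacent (λ ()) (λ _ ())
  arcTail-adjacent lo hi (false ∷ u) false {v} h refl {suc zero} _ _ = mkAdjacent (λ _ _ → sym (val-suc hi)) (λ ())
  arcTail-adjacent lo hi (true ∷ u) e h _ {suc (suc s)} _ (s≤s le) = arcTail-adjacent (lo ∸ 1) hi u true (pred-≤ h)
      refl (s≤s z≤n) le
  arcTail-adjacent lo hi (false ∷ u) e h _ {suc (suc s)} _ (s≤s le) = arcTail-adjacent lo (suc hi) u false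
      (<⇒≤ h) refl (s≤s z≤n) le

  arc-adjacent : ∀ {t u} → n ≤ t → length u ≡ n → ∀ {s} → 1 ≤ s → s < n → Adjacent n (at (arc t u) s)
      (at (arc t u) (suc s))
  arc-adjacent {t} {[]} n≤t len = contradiction (sym len) (ℕ.≢-nonZero⁻¹ n)
  arc-adjacent {t} {e ∷ u} n≤t len 1≤s s<n = arcTail-adjacent t t u e
    (≤-trans (≤-trans (n≤1+n _) (≤-reflexive len)) n≤t) (cong (λ z → withSign e (val z))
        (sym (edge-diag e)))
    1≤s (≤-pred (subst (_ <_) (sym len) s<n))
    where
    edge-diag : ∀ e → edge e t t ≡ t
    edge-diag true  = refl
    edge-diag false = refl

  -- Only the signs steer the recursion, so translating the initial stretch translates every letter.
  -- The common parameter x is exhibited because `val` forgets it.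
  arcTail-shift : ∀ lo hi δ u → length u ≤ lo → ∀ {j} → j ∈ range1 (length u) →
    ∃ λ x → absMap (arcTail lo hi u) j ≡ val x × absMap (arcTail (lo + δ) (hi + δ) u) j ≡ val (x + δ)
  arcTail-shift lo hi δ u h {zero} j∈ = contradiction (proj₁ (∈-range1⁻ j∈)) λ ()
  arcTail-shift (suc lo) hi δ (true ∷ u) h {suc zero} j∈ = lo , ∣withSign∣ true (val lo) , ∣withSign∣ true
      (val (lo + δ))
  arcTail-shift lo hi δ (false ∷ u) h {suc zero} j∈ = suc hi , refl , refl
  arcTail-shift (suc lo) hi δ (true ∷ u) (s≤s h) {suc (suc j)} j∈ =
    arcTail-shift lo hi δ u h (∈-range1⁺ (s≤s z≤n) (≤-pred (proj₂ (∈-range1⁻ j∈))))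
  arcTail-shift lo hi δ (false ∷ u) h {suc (suc j)} j∈ =
    arcTail-shift lo (suc hi) δ u (<⇒≤ h) (∈-range1⁺ (s≤s z≤n) (≤-pred (proj₂ (∈-range1⁻ j∈))))

  arc-shift : ∀ t δ u → length u ≤ t → ∀ {j} → j ∈ range1 (length u) →
    ∃ λ x → absMap (arc t u) j ≡ val x × absMap (arc (t + δ) u) j ≡ val (x + δ)
  arc-shift t δ u h {zero} j∈ = contradiction (proj₁ (∈-range1⁻ j∈)) λ ()
  arc-shift t δ [] h {suc j} j∈ = contradiction (proj₂ (∈-range1⁻ j∈)) λ ()
  arc-shift t δ (e ∷ u) h {suc zero} j∈ = t , ∣withSign∣ e (val t) , ∣withSign∣ e (val (t + δ))
  arc-shift t δ (e ∷ u) h {suc (suc j)} j∈ = arcTail-shift t t δ u (<⇒≤ h)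
      (∈-range1⁺ (s≤s z≤n) (≤-pred (proj₂ (∈-range1⁻ j∈))))

-- The arc condition at a single position

arcTest : ℕ → List ℕ → ℤ → Bool
arcTest n P v = isInterval n P
  ∧ (not (elemᵇ (predMod n ∣ v ∣) P) ∨ not (barred v))
  ∧ (not (elemᵇ (succMod n ∣ v ∣) P) ∨ barred v)

at-++ : ∀ pre {rest i} → i ∈ range1 (length pre) → at (pre ++ rest) i ≡ at pre i
at-++ pre {i = zero} i∈ = contradiction (proj₁ (∈-range1⁻ i∈)) λ ()
at-++ [] {i = suc i} i∈ = contradiction (proj₂ (∈-range1⁻ i∈)) λ ()
at-++ (x ∷ pre) {i = suc zero} i∈ = refl
at-++ (x ∷ pre) {i = suc (suc i)} i∈ = at-++ pre (∈-range1⁺ (s≤s z≤n) (≤-pred (proj₂ (∈-range1⁻ i∈))))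

at-mid : ∀ pre {v post} → at (pre ++ v ∷ post) (suc (length pre)) ≡ v
at-mid [] = refl
at-mid (x ∷ pre) = at-mid pre

map-cong-on : ∀ {f g : A → C} xs → (∀ {x} → x ∈ xs → f x ≡ g x) → map f xs ≡ map g xs
map-cong-on [] h = refl
map-cong-on (x ∷ xs) h = cong₂ _∷_ (h (here refl)) (map-cong-on xs (h ∘ there))

absMap-prefix : ∀ pre {rest} → map (absMap (pre ++ rest)) (range1 (length pre)) ≡ map ∣_∣ pre
absMap-prefix pre {rest} = trans (map-cong-on (range1 (length pre)) (λ i∈ → cong ∣_∣ (at-++ pre i∈)))
  (trans (map-∘ (range1 (length pre))) (cong (map ∣_∣) (map-at pre)))

arcCond-split : ∀ n pre v post → arcCond n (pre ++ v ∷ post) (suc (length pre)) ≡ arcTest n (map ∣_∣ pre) v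
arcCond-split n pre v post = cong₂ (arcTest n) (absMap-prefix pre) (at-mid pre)

split-at : ∀ (w : List A) {i} → i < length w → ∃ λ pre → ∃₂ λ v post → w ≡ pre ++ v ∷ post × length pre ≡ i
split-at (x ∷ w) {zero} _ = [] , x , w , refl , refl
split-at (x ∷ w) {suc i} (s≤s h) with split-at w h
... | pre , v , post , e , l = x ∷ pre , v , post , cong (x ∷_) e , cong suc l

-- The two bounds say that v stands at one of the positions 2..n-1; the condition is not imposed on
-- the first and the last entry.
isArc-⁻ : ∀ n pre v post → T (isArc n (pre ++ v ∷ post)) → 1 ≤ length pre → length pre + 2 ≤ n → T
    (arcTest n (map ∣_∣ pre) v)
isArc-⁻ n pre v post t 1≤ le = subst T (arcCond-split n pre v post)
  (all-⁻ (arcCond n (pre ++ v ∷ post)) (filterᵇ (2 ≤ᵇ_) (range1 (n ∸ 1))) t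
    (∈-filterᵇ⁺ {p = 2 ≤ᵇ_} (∈-range1⁺ (s≤s z≤n) (ℕₚ.<⇒≤pred (subst (_≤ n) (+-comm (length pre) 2) le)))
        (≤⇒≤ᵇ (s≤s 1≤))))

isArc-⁺ : ∀ n w → length w ≡ n →
  (∀ pre v post → w ≡ pre ++ v ∷ post → 1 ≤ length pre → length pre + 2 ≤ n → T (arcTest n (map ∣_∣ pre) v)) → T
      (isArc n w)
isArc-⁺ n w len h = all-⁺ (arcCond n w) (filterᵇ (2 ≤ᵇ_) (range1 (n ∸ 1))) λ {i} i∈ →
  let i∈′ , t = ∈-filterᵇ⁻ {p = 2 ≤ᵇ_} {xs = range1 (n ∸ 1)} i∈ in go i (≤ᵇ⇒≤ 2 i t) (proj₂ (∈-range1⁻ i∈′))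
  where
  suc-≤ : ∀ {i} n → 1 ≤ i → i ≤ n ∸ 1 → suc i ≤ n
  suc-≤ zero 1≤i i≤ = contradiction (≤-trans 1≤i i≤) λ ()
  suc-≤ (suc n) _ i≤ = s≤s i≤
  go : ∀ i → 2 ≤ i → i ≤ n ∸ 1 → T (arcCond n w i)
  go (suc i) (s≤s 1≤i) i≤ with split-at w {i} (subst (i <_) (sym len) (<⇒≤ (suc-≤ n (s≤s z≤n) i≤)))
  ... | pre , v , post , refl , refl = subst T (sym (arcCond-split n pre v post))
    (h pre v post refl 1≤i (subst (_≤ n) (+-comm 2 (length pre)) (suc-≤ n (s≤s z≤n) i≤)))

∨-intro : ∀ a {b} → (T a → T b) → T (not a ∨ b)
∨-intro true  h = h tt
∨-intro false h = tt

∨-elim : ∀ {a b} → T (not a ∨ b) → T a → T b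
∨-elim {true} t _ = t

module Arcs (n : ℕ) .⦃ n≢0 : NonZero n ⦄ (2≤n : 2 ≤ n) where
  open Residues n
  open IsWindow

  -- l is the number of elements of lo..hi, expressed without truncated subtraction.
  record Size (lo hi l : ℕ) : Set where
    constructor mkSize
    field size : suc hi ≡ lo + l
  open Size

  size-≤ : ∀ {lo hi l} → 1 ≤ l → Size lo hi l → lo ≤ hi
  size-≤ {lo} {hi} {l} 1≤l (mkSize e) = ≤-pred (subst (suc lo ≤_) (sym e) (subst (_≤ lo + l) (+-comm lo 1)
      (+-monoʳ-≤ lo 1≤l)))

  size-< : ∀ {lo hi l} k → Size lo hi l → l + k ≤ n → hi + k < lo + n
  size-< {lo} {hi} {l} k (mkSize e) le = subst (_≤ lo + n) (sym (trans (cong (_+ k) e) (+-assoc lo l k)))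
      (+-monoʳ-≤ lo le)

  size-down : ∀ {lo hi l} → 1 ≤ lo → Size lo hi l → Size (lo ∸ 1) hi (suc l)
  size-down {suc lo} {hi} {l} _ (mkSize e) = mkSize (trans e (sym (+-suc lo l)))

  size-up : ∀ {lo hi l} → Size lo hi l → Size lo (suc hi) (suc l)
  size-up {lo} {hi} {l} (mkSize e) = mkSize (trans (cong suc e) (sym (+-suc lo l)))

  arcTest-interval : ∀ P v → T (arcTest n P v) → T (isInterval n P)
  arcTest-interval P v t = proj₁ (∧-⁻ {isInterval n P} t)

  arcTest-unbarred : ∀ P v → T (arcTest n P v) → predMod n ∣ v ∣ ∈ P → barred v ≡ false
  arcTest-unbarred P v t p∈ = not-T (∨-elim {elemᵇ (predMod n ∣ v ∣) P}
    (proj₁ (∧-⁻ {not (elemᵇ (predMod n ∣ v ∣) P) ∨ not (barred v)} (proj₂ (∧-⁻ {isInterval n P} t)))) (elem-⁺ p∈))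

  arcTest-barred : ∀ P v → T (arcTest n P v) → succMod n ∣ v ∣ ∈ P → barred v ≡ true
  arcTest-barred P v t s∈ = T⇒≡ (∨-elim {elemᵇ (succMod n ∣ v ∣) P}
    (proj₂ (∧-⁻ {not (elemᵇ (predMod n ∣ v ∣) P) ∨ not (barred v)} (proj₂ (∧-⁻ {isInterval n P} t)))) (elem-⁺ s∈))

  arcTest-⁺ : ∀ P v → T (isInterval n P) → (predMod n ∣ v ∣ ∈ P → barred v ≡ false) → (succMod n ∣ v ∣ ∈ P → barred
      v ≡ true) →
    T (arcTest n P v)
  arcTest-⁺ P v i p s = ∧-⁺ i (∧-⁺
    (∨-intro (elemᵇ (predMod n ∣ v ∣) P) (λ t → subst (T ∘ not) (sym (p (elem-⁻ P t))) tt))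
    (∨-intro (elemᵇ (succMod n ∣ v ∣) P) (λ t → ≡⇒T (s (elem-⁻ P t)))))

  -- At least two residues are missing from P because l + 2 ≤ n. Hence lo - 2 is missing as well,
  -- and lo - 1 touches P from below only; `arcTest-up` is the mirror image.
  arcTest-down : ∀ {lo hi l P} → IsWindow lo hi P → Size lo hi l → 1 ≤ l → l + 2 ≤ n → 2 ≤ lo →
    T (arcTest n P (withSign true (val (lo ∸ 1))))
  arcTest-down {suc (suc lo)} {hi} {l} {P} W sz 1≤l le (s≤s (s≤s _)) = arcTest-⁺ P (withSign true (val (suc lo)))
    (isInterval-⁺ W (size-≤ 1≤l sz) (≤-<-trans (m≤m+n hi 2) (size-< 2 sz le)))
    (λ p∈ → contradiction (sound W (subst (_∈ P) (val-pred lo) p∈))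
      (before-window (n<1+n _ |> m<n⇒m<1+n)
          (≤-pred (≤-pred (subst (_< suc (suc (lo + n))) (+-comm hi 2) (size-< 2 sz le))))))
    (λ _ → refl)

  arcTest-up : ∀ {lo hi l P} → IsWindow lo hi P → Size lo hi l → 1 ≤ l → l + 2 ≤ n →
    T (arcTest n P (withSign false (val (suc hi))))
  arcTest-up {lo} {hi} {l} {P} W sz 1≤l le = arcTest-⁺ P (withSign false (val (suc hi)))
    (isInterval-⁺ W (size-≤ 1≤l sz) (≤-<-trans (m≤m+n hi 2) (size-< 2 sz le)))
    (λ _ → refl)
    (λ s∈ → contradiction (sound W (subst (_∈ P) (val-suc (suc hi)) s∈))
      (beyond-window (m<n⇒m<1+n (n<1+n hi)) (subst (_< lo + n) (+-comm hi 2) (size-< 2 sz le))))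

  map-∷ʳ : ∀ pre x → map ∣_∣ (pre ++ [ x ]) ≡ map ∣_∣ pre ++ [ ∣ x ∣ ]
  map-∷ʳ pre x = map-++ ∣_∣ pre [ x ]

  extend-down : ∀ {lo hi} pre x → 1 ≤ lo → lo ≤ hi → ∣ x ∣ ≡ val (lo ∸ 1) → IsWindow lo hi (map ∣_∣ pre) →
    IsWindow (lo ∸ 1) hi (map ∣_∣ (pre ++ [ x ]))
  extend-down {lo} {hi} pre x 1≤lo le e W = subst (IsWindow (lo ∸ 1) hi)
    (sym (trans (map-∷ʳ pre x) (cong (λ c → map ∣_∣ pre ++ [ c ]) e))) (window-down 1≤lo le W)

  extend-up : ∀ {lo hi} pre x → lo ≤ hi → ∣ x ∣ ≡ val (suc hi) → IsWindow lo hi (map ∣_∣ pre) →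
    IsWindow lo (suc hi) (map ∣_∣ (pre ++ [ x ]))
  extend-up {lo} {hi} pre x le e W = subst (IsWindow lo (suc hi))
    (sym (trans (map-∷ʳ pre x) (cong (λ c → map ∣_∣ pre ++ [ c ]) e))) (window-up le W)

  length-∷ʳ : ∀ (pre : List ℤ) x → length (pre ++ [ x ]) ≡ suc (length pre)
  length-∷ʳ pre x = trans (Listₚ.length-++ pre) (+-comm (length pre) 1)

  arcTail-arcTest : ∀ u lo hi pre → IsWindow lo hi (map ∣_∣ pre) → Size lo hi (length pre) → 1 ≤ length pre → suc
      (length u) ≤ lo →
    ∀ pre′ v post → arcTail lo hi u ≡ pre′ ++ v ∷ post → length pre + length pre′ + 2 ≤ n → T
        (arcTest n (map ∣_∣ (pre ++ pre′)) v)
  arcTail-arcTest (true ∷ u) lo hi pre W sz 1≤ h [] v post refl le rewrite Listₚ.++-identityʳ pre =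
    arcTest-down W sz 1≤ (subst (λ z → z + 2 ≤ n) (+-identityʳ (length pre)) le) (≤-trans (s≤s (s≤s z≤n)) h)
  arcTail-arcTest (false ∷ u) lo hi pre W sz 1≤ h [] v post refl le rewrite Listₚ.++-identityʳ pre =
    arcTest-up W sz 1≤ (subst (λ z → z + 2 ≤ n) (+-identityʳ (length pre)) le)
  arcTail-arcTest (true ∷ u) lo hi pre W sz 1≤ h (x ∷ pre′) v post eq le with refl ← Listₚ.∷-injectiveˡ eq =
    subst (λ l → T (arcTest n (map ∣_∣ l) v)) (Listₚ.++-assoc pre [ x ] pre′)
      (arcTail-arcTest u (lo ∸ 1) hi (pre ++ [ x ])
        (extend-down pre x 1≤lo (size-≤ 1≤ sz) (∣withSign∣ true (val (lo ∸ 1))) W)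
        (subst (Size (lo ∸ 1) hi) (sym (length-∷ʳ pre x)) (size-down 1≤lo sz))
        (subst (1 ≤_) (sym (length-∷ʳ pre x)) (s≤s z≤n)) (pred-≤ h) pre′ v post (Listₚ.∷-injectiveʳ eq)
        (subst (λ z → z + 2 ≤ n) (trans (+-suc (length pre) (length pre′))
            (cong (_+ length pre′) (sym (length-∷ʳ pre x)))) le))
    where
    1≤lo : 1 ≤ lo
    1≤lo = ≤-trans (s≤s z≤n) h
  arcTail-arcTest (false ∷ u) lo hi pre W sz 1≤ h (x ∷ pre′) v post eq le with refl ← Listₚ.∷-injectiveˡ eq =
    subst (λ l → T (arcTest n (map ∣_∣ l) v)) (Listₚ.++-assoc pre [ x ] pre′)
      (arcTail-arcTest u lo (suc hi) (pre ++ [ x ])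
        (extend-up pre x (size-≤ 1≤ sz) refl W)
        (subst (Size lo (suc hi)) (sym (length-∷ʳ pre x)) (size-up sz))
        (subst (1 ≤_) (sym (length-∷ʳ pre x)) (s≤s z≤n)) (<⇒≤ h) pre′ v post (Listₚ.∷-injectiveʳ eq)
        (subst (λ z → z + 2 ≤ n) (trans (+-suc (length pre) (length pre′))
            (cong (_+ length pre′) (sym (length-∷ʳ pre x)))) le))
  arcTail-arcTest [] lo hi pre W sz 1≤ h [] v post () le
  arcTail-arcTest [] lo hi pre W sz 1≤ h (x ∷ pre′) v post () le

  size-start : ∀ t → Size t t 1
  size-start t = mkSize (+-comm 1 t)

  arc-start : ∀ {t} v → ∣ v ∣ ≡ val t → IsWindow t t (map ∣_∣ [ v ])
  arc-start {t} v e = subst (λ c → IsWindow t t [ c ]) (sym e) (window-singleton t)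

  arc-isArc : ∀ {t u} → n ≤ t → length u ≡ n → T (isArc n (arc t u))
  arc-isArc {t} {[]} n≤t len = contradiction (sym len) (ℕ.≢-nonZero⁻¹ n)
  arc-isArc {t} {e ∷ u} n≤t len = isArc-⁺ n (arc t (e ∷ u)) (B-length {n} (arc-∈B {t} {e ∷ u} n≤t len)) test
    where
    test : ∀ pre v post → arc t (e ∷ u) ≡ pre ++ v ∷ post → 1 ≤ length pre → length pre + 2 ≤ n → T
        (arcTest n (map ∣_∣ pre) v)
    test (x ∷ pre) v post eq _ le with refl ← Listₚ.∷-injectiveˡ eq = arcTail-arcTest u t t [ x ] (arc-start x (∣withSign∣ e (val t))) (size-start t) ≤-refl
      (≤-trans (≤-reflexive len) n≤t) pre v post (Listₚ.∷-injectiveʳ eq) le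

  -- In any other case hi and x would be two elements of the next interval whose successors lie outside it.
  next-value : ∀ {lo hi} pre v rest → IsWindow lo hi (map ∣_∣ pre) → Size lo hi (length pre) → 1 ≤ length pre →
    length pre + suc (length rest) ≡ n → T (isArc n (pre ++ v ∷ rest)) →
    ∀ {x} → ∣ v ∣ ≡ val x → hi < x → x < lo + n → x ≡ suc hi ⊎ suc x ≡ lo + n
  -- With at most one entry after v no interval condition follows, but then only one or two residues
  -- are left, and these are the neighbours of the stretch.
  next-value {lo} {hi} pre v [] W sz 1≤ len t {x} _ hi<x x< = inj₁
      (≤-antisym (≤-pred (≤-trans x< (≤-reflexive top))) hi<x)
    where
    top : lo + n ≡ suc (suc hi)
    top = trans (cong (λ z → lo + z) (sym len)) (trans (sym (+-assoc lo (length pre) 1))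
        (trans (cong (_+ 1) (sym (size sz))) (+-comm (suc hi) 1)))
  next-value {lo} {hi} pre v (_ ∷ []) W sz 1≤ len t {x} _ hi<x x< with m≤n⇒m<n∨m≡n hi<x
  ... | inj₂ e = inj₁ (sym e)
  ... | inj₁ lt = inj₂ (≤-antisym x< (≤-trans (≤-reflexive top) (s≤s lt)))
    where
    top : lo + n ≡ suc (suc (suc hi))
    top = trans (cong (λ z → lo + z) (sym len)) (trans (sym (+-assoc lo (length pre) 2))
        (trans (cong (_+ 2) (sym (size sz))) (+-comm (suc hi) 2)))
  next-value {lo} {hi} pre v (v₂ ∷ v₃ ∷ rest) W sz 1≤ len t {x} e hi<x x< with x ℕ.≟ suc hi | suc x ℕ.≟ lo + n
  ... | yes p | _ = inj₁ p
  ... | no _ | yes p = inj₂ p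
  ... | no x≢ | no x⁺≢ = contradiction (isInterval-end Q interval hi∈ x∈ hi⁺∉ x⁺∉)
      (val-distinct hi<x (<-≤-trans x< (+-monoˡ-≤ n (size-≤ 1≤ sz))))
    where
    Q = map ∣_∣ (pre ++ [ v ])
    Q≡ : Q ≡ map ∣_∣ pre ++ [ ∣ v ∣ ]
    Q≡ = map-∷ʳ pre v
    interval : T (isInterval n Q)
    interval = arcTest-interval Q v₂ (isArc-⁻ n (pre ++ [ v ]) v₂ (v₃ ∷ rest)
      (subst (T ∘ isArc n) (sym (Listₚ.++-assoc pre [ v ] (v₂ ∷ v₃ ∷ rest))) t)
      (subst (1 ≤_) (sym (length-∷ʳ pre v)) (s≤s z≤n))
      (subst (_≤ n) (cong (_+ 2) (sym (length-∷ʳ pre v)))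
        (subst₂ _≤_ (+-suc (length pre) 2) len (+-monoʳ-≤ (length pre) (s≤s (s≤s (s≤s z≤n)))))))
    hi∈ : val hi ∈ Q
    hi∈ = subst (val hi ∈_) (sym Q≡) (∈-++⁺ˡ (complete W (size-≤ 1≤ sz) ≤-refl))
    x∈ : val x ∈ Q
    x∈ = subst (val x ∈_) (sym Q≡) (∈-++⁺ʳ (map ∣_∣ pre) (here (sym e)))
    Q⁻ : ∀ {c} → c ∈ Q → InWindow lo hi c ⊎ c ≡ val x
    Q⁻ c∈ with ∈-++⁻ (map ∣_∣ pre) (subst (_ ∈_) Q≡ c∈)
    ... | inj₁ p = inj₁ (sound W p)
    ... | inj₂ (here p) = inj₂ (trans p e)
    hi⁺∉ : succMod n (val hi) ∉ Q
    hi⁺∉ c∈ with Q⁻ (subst (_∈ Q) (val-suc hi) c∈)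
    ... | inj₁ p = beyond-window ≤-refl (≤-<-trans hi<x x<) p
    ... | inj₂ p = val-distinct (≤∧≢⇒< hi<x (x≢ ∘ sym))
        (<-≤-trans x< (+-monoˡ-≤ n (m≤n⇒m≤1+n (size-≤ 1≤ sz)))) p
    x⁺∉ : succMod n (val x) ∉ Q
    x⁺∉ c∈ with Q⁻ (subst (_∈ Q) (val-suc x) c∈)
    ... | inj₁ p = beyond-window (m<n⇒m<1+n hi<x) (≤∧≢⇒< x< x⁺≢) p
    ... | inj₂ p = val-distinct (n<1+n x) (subst (_≤ x + n) (+-comm x 2) (+-monoʳ-≤ x 2≤n)) (sym p)

  nextVal : Bool → ℕ → ℕ → ℕ
  nextVal true  lo hi = val (lo ∸ 1)
  nextVal false lo hi = val (suc hi)

  val-wrap : ∀ {lo x} → 1 ≤ lo → suc x ≡ lo + n → val x ≡ val (lo ∸ 1)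
  val-wrap {suc lo} _ e = trans (cong val (suc-injective e)) (val-+n lo)

  -- The new letter adjoins the stretch from above or from below. Before the last position the arc
  -- condition then dictates its sign; at the last position lo - 1 and hi + 1 agree modulo n, so
  -- either sign is consistent.
  next-entry : ∀ {lo hi} pre v rest → IsWindow lo hi (map ∣_∣ pre) → Size lo hi (length pre) → 1 ≤ length pre → 1 ≤ lo →
    pre ++ v ∷ rest ∈ B n → T (isArc n (pre ++ v ∷ rest)) → ∣ v ∣ ≡ nextVal (barred v) lo hi
  next-entry {lo} {hi} pre v rest W sz 1≤ 1≤lo w∈ t
    with representative (suc hi) {∣ v ∣} (∈-resp-↭ (B-⁻ {n} w∈) (∈-map⁺ ∣_∣ (∈ₚ.∈-insert pre)))
  ... | x , hi<x , x<′ , e = finish (next-value pre v rest W sz 1≤ len t e hi<x x<)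
    where
    len : length pre + suc (length rest) ≡ n
    len = trans (sym (Listₚ.length-++ pre)) (B-length {n} w∈)
    v∉ : ∣ v ∣ ∉ map ∣_∣ pre
    v∉ p = proj₂ (proj₂ (Unique-++⁻ (map ∣_∣ pre) (subst Unique (map-++ ∣_∣ pre (v ∷ rest))
        (Unique-↭ (↭-sym (B-⁻ {n} w∈)) (range1-unique n))))) p (here refl)
    -- A representative from lo + n on would be a residue of the stretch itself, so v would repeat a
    -- letter of `pre`.
    x< : x < lo + n
    x< with x ℕ.<? lo + n
    ... | yes p = p
    ... | no ge with m≤n⇒∃[o]m+o≡n (≮⇒≥ ge)
    ...   | o , refl = contradiction
        (subst (_∈ map ∣_∣ pre) (sym (trans e (trans (cong val (swap-last-+ℕ lo n o)) (val-+n (lo + o)))))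
        (complete W (m≤m+n lo o)
            (≤-pred (ℕₚ.+-cancelʳ-< n (lo + o) (suc hi) (subst (_< suc hi + n) (swap-last-+ℕ lo n o) x<′))))) v∉
    last-eq : length rest ≡ 0 → suc (suc hi) ≡ lo + n
    last-eq z = trans (cong suc (size sz)) (trans (sym (+-suc lo (length pre)))
      (cong (λ z → lo + z) (trans (+-comm 1 (length pre)) (trans (cong (λ z → length pre + suc z) (sym z)) len))))
    test : length rest ≢ 0 → T (arcTest n (map ∣_∣ pre) v)
    test z = isArc-⁻ n pre v rest t 1≤ (subst (length pre + 2 ≤_) len (+-monoʳ-≤ (length pre) (s≤s (ℕₚ.n≢0⇒n>0 z))))
    finish : x ≡ suc hi ⊎ suc x ≡ lo + n → ∣ v ∣ ≡ nextVal (barred v) lo hi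
    finish (inj₁ refl) with length rest ℕ.≟ 0
    ... | yes z = trans e (both (barred v))
      where
      both : ∀ b → val (suc hi) ≡ nextVal b lo hi
      both true  = val-wrap 1≤lo (last-eq z)
      both false = refl
    ... | no z = trans e (cong (λ b → nextVal b lo hi) (sym (arcTest-unbarred (map ∣_∣ pre) v (test z)
      (subst (_∈ map ∣_∣ pre) (sym (trans (cong (predMod n) e) (val-pred hi))) (complete W (size-≤ 1≤ sz) ≤-refl)))))
    finish (inj₂ p) with length rest ℕ.≟ 0
    ... | yes z = trans e (both (barred v))
      where
      both : ∀ b → val x ≡ nextVal b lo hi
      both true  = val-wrap 1≤lo p
      both false = cong val (suc-injective (trans p (sym (last-eq z))))
    ... | no z = trans (trans e (val-wrap 1≤lo p)) (cong (λ b → nextVal b lo hi)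
        (sym (arcTest-barred (map ∣_∣ pre) v (test z)
      (subst (_∈ map ∣_∣ pre) (sym (trans (cong (succMod n) e) (trans (val-suc x) (trans (cong val p) (val-+n lo)))))
        (complete W ≤-refl (size-≤ 1≤ sz))))))

  isArc-tail : ∀ {lo hi} pre rest → IsWindow lo hi (map ∣_∣ pre) → Size lo hi (length pre) → 1 ≤ length pre →
      length rest ≤ lo →
    pre ++ rest ∈ B n → T (isArc n (pre ++ rest)) → rest ≡ arcTail lo hi (map barred rest)
  isArc-tail pre [] W sz 1≤ h w∈ t = refl
  isArc-tail {lo} {hi} pre (v ∷ rest) W sz 1≤ h w∈ t = go (barred v) refl
    where
    1≤lo : 1 ≤ lo
    1≤lo = ≤-trans (s≤s z≤n) h
    abs-v : ∣ v ∣ ≡ nextVal (barred v) lo hi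
    abs-v = next-entry pre v rest W sz 1≤ 1≤lo w∈ t
    assoc : (pre ++ [ v ]) ++ rest ≡ pre ++ v ∷ rest
    assoc = Listₚ.++-assoc pre [ v ] rest
    go : ∀ b → barred v ≡ b → v ∷ rest ≡ arcTail lo hi (b ∷ map barred rest)
    go true  e = cong₂ _∷_ (trans (sym (withSign-barred v))
        (cong₂ withSign e (trans abs-v (cong (λ b → nextVal b lo hi) e))))
      (isArc-tail (pre ++ [ v ]) rest (extend-down pre v 1≤lo (size-≤ 1≤ sz)
          (trans abs-v (cong (λ b → nextVal b lo hi) e)) W)
        (subst (Size (lo ∸ 1) hi) (sym (length-∷ʳ pre v)) (size-down 1≤lo sz))
            (subst (1 ≤_) (sym (length-∷ʳ pre v)) (s≤s z≤n)) (pred-≤ h)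
        (subst (_∈ B n) (sym assoc) w∈) (subst (T ∘ isArc n) (sym assoc) t))
    go false e = cong₂ _∷_ (trans (sym (withSign-barred v))
        (cong₂ withSign e (trans abs-v (cong (λ b → nextVal b lo hi) e))))
      (isArc-tail (pre ++ [ v ]) rest (extend-up pre v (size-≤ 1≤ sz) (trans abs-v (cong (λ b → nextVal b lo hi) e)) W)
        (subst (Size lo (suc hi)) (sym (length-∷ʳ pre v)) (size-up sz)) (subst (1 ≤_) (sym (length-∷ʳ pre v))
            (s≤s z≤n)) (<⇒≤ h)
        (subst (_∈ B n) (sym assoc) w∈) (subst (T ∘ isArc n) (sym assoc) t))

  -- The start n + a has residue a + 1, so a runs over all first letters, and the summand n leaves
  -- room for the decrements.
  arcList : List (List ℤ)
  arcList = concatMap (λ a → map (arc (n + a)) (words bools n)) (upTo n)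

  val-start : ∀ {a} → a < n → val (n + a) ≡ suc a
  val-start {a} a<n = trans (cong val (+-comm n a)) (trans (val-+n a) (val-small a<n))

  arcPerms-⊆ : ∀ {w} → w ∈ arcPerms n → w ∈ arcList
  arcPerms-⊆ {w} w∈ = go w (proj₁ w∈′) (proj₂ w∈′)
    where
    w∈′ = ∈-filterᵇ⁻ {p = isArc n} {xs = B n} w∈
    ∈bools : ∀ b → b ∈ bools
    ∈bools true  = here refl
    ∈bools false = there (here refl)
    go : ∀ w → w ∈ B n → T (isArc n w) → w ∈ arcList
    go [] w∈ t = contradiction (sym (B-length {n} w∈)) (ℕ.≢-nonZero⁻¹ n)
    go (v ∷ rest) w∈ t with ∣ v ∣ in eq | ∈-resp-↭ (B-⁻ {n} w∈) (here {xs = map ∣_∣ rest} (refl {x = ∣ v ∣}))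
    ... | c | c∈ with ∈-range1⁻ c∈
    go (v ∷ rest) w∈ t | suc a | c∈ | _ , a<n = ∈-concatMap⁺ (λ a → map (arc (n + a)) (words bools n))
        (lose (∈-upTo⁺ a<n) (subst (_∈ map (arc (n + a)) (words bools n)) (sym form)
          (∈-map⁺ (arc (n + a)) (subst (λ k → map barred (v ∷ rest) ∈ words bools k)
              (trans (length-map barred (v ∷ rest)) (B-length {n} w∈))
            (∈-words⁺ (λ {b} _ → ∈bools b))))))
      where
      abs-v : ∣ v ∣ ≡ val (n + a)
      abs-v = trans eq (sym (val-start a<n))
      form : v ∷ rest ≡ arc (n + a) (map barred (v ∷ rest))
      form = cong₂ _∷_ (trans (sym (withSign-barred v)) (cong (withSign (barred v)) abs-v))
        (isArc-tail [ v ] rest (arc-start v abs-v) (size-start (n + a)) ≤-refl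
          (≤-trans (n≤1+n _) (≤-trans (≤-reflexive (B-length {n} w∈)) (m≤m+n n a))) w∈ t)

  ⊆-arcPerms : ∀ {w} → w ∈ arcList → w ∈ arcPerms n
  ⊆-arcPerms w∈ with find (∈-concatMap⁻ (λ a → map (arc (n + a)) (words bools n)) {upTo n} w∈)
  ... | a , _ , p with ∈-map⁻ (arc (n + a)) p
  ...   | u , u∈ , refl = ∈-filterᵇ⁺ {p = isArc n} {xs = B n} (arc-∈B {n + a} {u} (m≤m+n n a) len)
      (arc-isArc {n + a} {u} (m≤m+n n a) len)
    where
    len : length u ≡ n
    len = proj₁ (∈-words⁻ n u∈)

  absMap-first : ∀ t {u} → length u ≡ n → absMap (arc t u) 1 ≡ val t
  absMap-first t {[]} len = contradiction (sym len) (ℕ.≢-nonZero⁻¹ n)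
  absMap-first t {e ∷ u} len = ∣withSign∣ e (val t)

  arcList-unique : Unique arcList
  arcList-unique = concatMap-unique (Uniqueₚ.upTo⁺ n)
    (λ {a} _ → Uniqueₚ.map⁺ (λ {u} {u′} e → trans (sym (barred-arc (n + a) u)) (trans (cong (map barred) e)
        (barred-arc (n + a) u′)))
      (words-unique n (((λ ()) ∷ []) ∷ [] ∷ [])))
    (λ {a} {b} a∈ b∈ p q → let u , u∈ , e = ∈-map⁻ (arc (n + a)) p ; u′ , u′∈ , e′ = ∈-map⁻ (arc (n + b)) q in
      suc-injective (trans (sym (val-start (∈-upTo⁻ a∈)))
          (trans (sym (absMap-first (n + a) {u} (proj₁ (∈-words⁻ n u∈))))
        (trans (cong (λ w → absMap w 1) (trans (sym e) e′))
            (trans (absMap-first (n + b) {u′} (proj₁ (∈-words⁻ n u′∈))) (val-start (∈-upTo⁻ b∈)))))))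

  arcPerms-↭ : arcPerms n ↭ arcList
  arcPerms-↭ = unique-↭ (Uniqueₚ.filter⁺ (T? ∘ isArc n) (B-unique n)) arcList-unique arcPerms-⊆ ⊆-arcPerms

  -- The position of the letter n

  position : List Bool → ℕ → ℕ
  position u a = first (λ s → absMap (arc (n + a) u) s ≡ᵇ n) (range1 n)

  module _ {u : List Bool} (len : length u ≡ n) where

    position-spec : ∀ a → position u a ∈ range1 n × absMap (arc (n + a) u) (position u a) ≡ n
    position-spec a with absMap-surjective {n} (arc-∈B {n + a} {u} (m≤m+n n a) len) (∈-range1⁺ (ℕ.>-nonZero⁻¹ n) ≤-refl)
    ... | i , i∈ , e with first-spec (λ s → absMap (arc (n + a) u) s ≡ᵇ n) (range1-sorted n) i∈ (≡⇒≡ᵇ _ n e)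
    ...   | p∈ , t , _ = p∈ , ≡ᵇ⇒≡ _ n t

    -- Passing from a to b adds δ = b - a to the parameter of the letter at every position. As 0 < δ
    -- < n the residue changes, so no position holds the letter n both times.
    position-distinct : ∀ {a b} → a < b → b < n → position u a ≢ position u b
    position-distinct {a} {b} a<b b<n e with m≤n⇒∃[o]m+o≡n (<⇒≤ a<b)
    ... | δ , refl with arc-shift (n + a) δ u (≤-trans (≤-reflexive len) (m≤m+n n a))
                         {position u a} (subst (λ k → position u a ∈ range1 k) (sym len) (proj₁ (position-spec a)))
    ...   | x , e₁ , e₂ = val-distinct (m<m+n x 0<δ) (+-monoʳ-< x (≤-<-trans (m≤n+m δ a) b<n))
          (trans (sym e₁) (trans (proj₂ (position-spec a)) (trans (sym (proj₂ (position-spec (a + δ))))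
            (trans (cong (absMap (arc (n + (a + δ)) u)) (sym e))
                (trans (cong (λ t → absMap (arc t u) (position u a)) (sym (+-assoc n a δ))) e₂)))))
      where
      0<δ : 0 < δ
      0<δ = +-cancelˡ-< a 0 δ (subst (_< a + δ) (sym (+-identityʳ a)) a<b)

    position-↭ : map (position u) (upTo n) ↭ range1 n
    position-↭ = unique-⊆-↭ (map-unique inj (Uniqueₚ.upTo⁺ n))
      (λ q∈ → let a , _ , e = ∈-map⁻ (position u) q∈ in subst (_∈ range1 n) (sym e) (proj₁ (position-spec a)))
      (≤-reflexive (trans (length-range1 n) (sym (trans (length-map (position u) (upTo n))
          (Listₚ.length-upTo n)))))
      where
      inj : ∀ {a b} → a ∈ upTo n → b ∈ upTo n → position u a ≡ position u b → a ≡ b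
      inj {a} {b} a∈ b∈ e with ℕₚ.<-cmp a b
      ... | tri< lt _ _ = contradiction e (position-distinct lt (∈-upTo⁻ b∈))
      ... | tri≈ _ eq _ = eq
      ... | tri> _ _ gt = contradiction (sym e) (position-distinct gt (∈-upTo⁻ a∈))

  arcWeightSum-parts : ∀ γ → Positive γ → total γ ≡ n →
    arcWeightSum n γ ≡ + countᵇ 1 (unbarredParts γ) ℤ.* typeFactor γ
  arcWeightSum-parts γ pos eq = begin
    ∑ (arcPerms n) (λ w → wt γ (sDes n w)) ≡⟨ ∑-↭ (λ w → wt γ (sDes n w)) arcPerms-↭ ⟩
    ∑ arcList (λ w → wt γ (sDes n w)) ≡⟨ ∑-concatMap (λ a → map (arc (n + a)) (words bools n)) (upTo n)
        (λ w → wt γ (sDes n w)) ⟩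
    ∑ (upTo n) (λ a → ∑ (map (arc (n + a)) (words bools n)) (λ w → wt γ (sDes n w)))
      ≡⟨ ∑-cong (upTo n) (λ {a} _ → trans (∑-map (arc (n + a)) (words bools n) (λ w → wt γ (sDes n w)))
          (∑-cong (words bools n) (λ {u} u∈ → weight a u (proj₁ (∈-words⁻ n u∈))))) ⟩
    ∑ (upTo n) (λ a → ∑ (words bools n) (λ u → wordWeight γ u (position u a))) ≡⟨ ∑-swap (upTo n) (words bools n)
        (λ a u → wordWeight γ u (position u a)) ⟩
    ∑ (words bools n) (λ u → ∑ (upTo n) (λ a → wordWeight γ u (position u a)))
      ≡⟨ ∑-cong (words bools n) (λ {u} u∈ → trans (sym (∑-map (position u) (upTo n) (wordWeight γ u)))
          (∑-↭ (wordWeight γ u) (position-↭ {u} (proj₁ (∈-words⁻ n u∈))))) ⟩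
    -- The range of q no longer depends on `u`, so the sums can be exchanged back and the sign words
    -- summed with q fixed.
    ∑ (words bools n) (λ u → ∑ (range1 n) (wordWeight γ u)) ≡⟨ ∑-swap (words bools n) (range1 n) (wordWeight γ) ⟩
    ∑ (range1 n) (λ q → ∑ (words bools n) (λ u → wordWeight γ u q))
      ≡⟨ ∑-cong (range1 n) (λ {q} _ → trans (cong (λ m → ∑ (words bools m) (λ u → wordWeight γ u q)) (sym eq))
          (∑-wordWeight γ q pos)) ⟩
    ∑ (range1 n) (totalWeight γ) ≡⟨ cong (λ m → ∑ (range1 m) (totalWeight γ)) eq ⟨
    ∑ (range1 (total γ)) (totalWeight γ) ≡⟨ ∑-totalWeight γ pos ⟩
    + countᵇ 1 (unbarredParts γ) ℤ.* typeFactor γ ∎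
    where
    open ≡-Reasoning
    weight : ∀ a u → length u ≡ n → wt γ (sDes n (arc (n + a) u)) ≡ wordWeight γ u (position u a)
    weight a u len = trans
      (SDes.wt-wordWeight {n} 2≤n (arc-∈B {n + a} {u} (m≤m+n n a) len) (arc-adjacent {n + a} {u} (m≤m+n n a) len)
        (proj₁ (position-spec {u} len a)) (proj₂ (position-spec {u} len a)) γ pos eq)
      (cong (λ v → wordWeight γ v (position u a)) (barred-arc (n + a) u))

theorem8p3 : (n : ℕ) → 2 ≤ n →
    (γ : SignedComposition) → All (λ p → 0 < proj₁ p) γ → sum (map proj₁ γ) ≡ n →
    (g : List ℤ) → g ∈ B n →
    unbarredParts γ ↭ posCycleLengths n g → barredParts γ ↭ negCycleLengths n g →
    + subgroupOrder n ℤ.* arcWeightSum n γ ≡ inducedScaled n g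
theorem8p3 n 2≤n γ pos eq g g∈ pos↭ neg↭ = trans
  (cong (+ subgroupOrder n ℤ.*_) (Arcs.arcWeightSum-parts n ⦃ ℕ.>-nonZero 1≤n ⦄ 2≤n γ pos eq))
  (sym (inducedScaled-type n γ 1≤n g∈ pos↭ neg↭))
  where
  1≤n : 1 ≤ n
  1≤n = <⇒≤ 2≤n
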